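{- $\mathrm{NMSO}_e=\mathrm{NGSM}_{fin}\,;\,\mathrm{NGSM}_{fin}$, i.e. the nondeterministic mso definable string transductions are exactly the compositions of two transductions realized by finite visit (nondeterministic) two-way generalized sequential machines.
   Context: Composition: $R_1;R_2=\{(w_1,w_3)\mid \exists w_2:(w_1,w_2)\in R_1,(w_2,w_3)\in R_2\}$, extended to families elementwise. 2gsm: $M=(Q,\Sigma_1,\Sigma_2,\delta,q_{in},q_f)$ with finite $Q$, instructions $(p,\sigma,q_1,\alpha_1,\epsilon_1,q_0,\alpha_0,\epsilon_0)$, $p\ne q_f$, $\sigma\in\Sigma_1\cup\{\vdash,\dashv\}$, $\alpha_i\in\Sigma_2^*$, $\epsilon_i\in\{ -1,0,+1\}$; on input $w$ the read-only tape holds $\vdash w\dashv$; in state $p$ scanning $\tau$, an applicable instruction (any one starting with $p$, chosen nondeterministically) makes the machine enter $q_1$, append $\alpha_1$ to the output and move by $\epsilon_1$ if $\tau=\sigma$, and use $(q_0,\alpha_0,\epsilon_0)$ otherwise; $(w,z)$ is realized iff some computation from $q_{in}$ at position $0$ reaches $q_f$ with output $z$. A computation is $k$-visiting if every tape position is visited at most $k$ times; $M$ is finite visit if there is $k$ such that every $(w,z)$ realized by $M$ has a $k$-visiting computation. $\mathrm{NGSM}_{fin}$: transductions realized by finite visit 2gsm's. Graphs and MSO: graphs $(V,E,\mathrm{lab})$ with $E\subseteq V\times\Gamma\times V$ ($*$ = unlabelled), MSO with atomic formulas $\mathrm{lab}_\sigma(x)$, $\mathrm{edge}_\gamma(x,y)$,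 $x=y$, $x\in X$. A nondeterministic mso definable graph transduction is given by parameters $X_1,\dots,X_k$, a domain formula $\varphi_{dom}(\bar X)$, finite copy set $C$, node formulas $\varphi^c_\sigma(x,\bar X)$ and edge formulas $\varphi^{c_1,c_2}_\gamma(x,y,\bar X)$; for each valuation $\bar U$ of the parameters by node sets of the input $g$ with $g\models\varphi_{dom}(\bar U)$ it produces the graph with nodes $(u,c)$ such that exactly one $\sigma$ has $g\models\varphi^c_\sigma(u,\bar U)$ (labelled $\sigma$) and edges $((u,c_1),\gamma,(v,c_2))$ iff $g\models\varphi^{c_1,c_2}_\gamma(u,v,\bar U)$. For $w=a_1\cdots a_k$, $\mathrm{egr}(w)$ has unlabelled nodes $v_0,\dots,v_k$ and edges $(v_{i-1},a_i,v_i)$. $\mathrm{NMSO}_e$: string transductions $m$ with $\{(\mathrm{egr}(w),\mathrm{egr}(z)):(w,z)\in m\}$ a nondeterministic mso definable graph transduction. -}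

module Defs where

open import Data.Nat using (ℕ; zero; suc; _≤_; _<_; _≡ᵇ_)
open import Data.Bool using (Bool; true; false; _∧_; _∨_; not) renaming (_≟_ to ≟B)
open import Data.Fin using (Fin; toℕ) renaming (zero to fzero) renaming (_≟_ to _≟F_)
open import Data.Fin.Subset using (Subset)
open import Data.List using (List; []; _∷_; _++_; map; length; filter; allFin)
open import Data.Bool.ListAction using (any)
open import Data.List.Membership.Propositional using (_∈_)
open import Data.List.Relation.Unary.All using (All)
open import Data.Maybe using (Maybe; just; nothing)
open import Data.Product using (Σ; _×_; _,_; proj₁; proj₂; ∃)
open import Data.Vec using (Vec) renaming ([] to []ᵥ; _∷_ to _∷ᵥ_; lookup to lookupᵥ)
import Data.Vec.Functional as VF
open import Data.Nat using () renaming (_≟_ to _≟ℕ_)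
open import Relation.Binary.PropositionalEquality using (_≡_; _≢_)
open import Relation.Nullary.Decidable using (⌊_⌋)
open import Function.Bundles using (_↔_; Inverse; _⇔_)

Transduction : ℕ → ℕ → Set₁
Transduction n₁ n₂ = List (Fin n₁) → List (Fin n₂) → Set

_⨾_ : ∀ {n₁ n₂ n₃} → Transduction n₁ n₂ → Transduction n₂ n₃ → Transduction n₁ n₃
(R₁ ⨾ R₂) w₁ w₃ = Σ (List _) λ w₂ → R₁ w₁ w₂ × R₂ w₂ w₃

_≐_ : ∀ {n₁ n₂} → Transduction n₁ n₂ → Transduction n₁ n₂ → Set
m ≐ R = ∀ w z → m w z ⇔ R w z

data TSym (n : ℕ) : Set where
  sym  : Fin n → TSym n
  lend : TSym n
  rend : TSym n

data Dir : Set where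
  left stay right : Dir

record Instr (Q n₁ n₂ : ℕ) : Set where
  field
    p  : Fin Q
    σ  : TSym n₁
    q₁ : Fin Q
    α₁ : List (Fin n₂)
    ε₁ : Dir
    q₀ : Fin Q
    α₀ : List (Fin n₂)
    ε₀ : Dir

record GSM (n₁ n₂ : ℕ) : Set where
  field
    Q    : ℕ
    δ    : List (Instr Q n₁ n₂)
    qin  : Fin Q
    qf   : Fin Q
    δ-ok : All (λ ι → Instr.p ι ≢ qf) δ

tape : ∀ {n} → List (Fin n) → List (TSym n)
tape w = lend ∷ (map sym w ++ (rend ∷ []))

at : ∀ {A : Set} → List A → ℕ → Maybe A
at []       _       = nothing
at (x ∷ xs) zero    = just x
at (x ∷ xs) (suc i) = at xs i

move : ℕ → Dir → Maybe ℕ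
move zero    left  = nothing
move (suc i) left  = just i
move i       stay  = just i
move i       right = just (suc i)

Config : ℕ → Set
Config Q = Fin Q × ℕ   -- (state, head position)

module _ {n₁ n₂ : ℕ} (M : GSM n₁ n₂) (w : List (Fin n₁)) where
  open GSM M
  open Instr

  data Step : Config Q → List (Fin n₂) → Config Q → Set where
    step-eq  : ∀ {ι i τ j} → ι ∈ δ → at (tape w) i ≡ just τ → τ ≡ σ ι →
               move i (ε₁ ι) ≡ just j → j < length (tape w) →
               Step (p ι , i) (α₁ ι) (q₁ ι , j)
    step-neq : ∀ {ι i τ j} → ι ∈ δ → at (tape w) i ≡ just τ → τ ≢ σ ι →
               move i (ε₀ ι) ≡ just j → j < length (tape w) →
               Step (p ι , i) (α₀ ι) (q₀ ι , j)

  data Comp : Config Q → List (Fin n₂) → List (Config Q) → Set where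
    halt : ∀ {i} → Comp (qf , i) [] ((qf , i) ∷ [])
    next : ∀ {c α c' z cs} → Step c α c' → Comp c' z cs →
           Comp c (α ++ z) (c ∷ cs)

  visits : ℕ → List (Config Q) → ℕ
  visits i cs = length (filter (λ c → proj₂ c ≟ℕ i) cs)

  Visiting : ℕ → List (Config Q) → Set
  Visiting k cs = ∀ i → visits i cs ≤ k

⟦_⟧G : ∀ {n₁ n₂} → GSM n₁ n₂ → Transduction n₁ n₂
⟦ M ⟧G w z = Σ (List (Config (GSM.Q M))) λ cs → Comp M w (GSM.qin M , 0) z cs

FiniteVisit : ∀ {n₁ n₂} → GSM n₁ n₂ → Set
FiniteVisit M = Σ ℕ λ k → ∀ w z → ⟦ M ⟧G w z →
  Σ (List (Config (GSM.Q M))) λ cs → Comp M w (GSM.qin M , 0) z cs × Visiting M w k cs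

NGSMfin : ∀ {n₁ n₂} → Transduction n₁ n₂ → Set
NGSMfin {n₁} {n₂} m = Σ (GSM n₁ n₂) λ M → FiniteVisit M × (m ≐ ⟦ M ⟧G)

NGSMfin² : ∀ {n₁ n₂} → Transduction n₁ n₂ → Set₁
NGSMfin² {n₁} {n₂} m = Σ ℕ λ n₃ →
  Σ (Transduction n₁ n₃) λ m₁ → Σ (Transduction n₃ n₂) λ m₂ →
  NGSMfin m₁ × NGSMfin m₂ × (m ≐ (m₁ ⨾ m₂))

record Graph (a b : ℕ) : Set where
  field
    N    : ℕ
    lab  : Fin N → Fin a
    edge : Fin N → Fin b → Fin N → Bool

record _≅_ {a b} (g h : Graph a b) : Set where
  private module g = Graph g
  private module h = Graph h
  field
    bij    : Fin g.N ↔ Fin h.N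
  open Inverse bij using (to)
  field
    lab-ok  : ∀ u → h.lab (to u) ≡ g.lab u
    edge-ok : ∀ u γ v → h.edge (to u) γ (to v) ≡ g.edge u γ v

-- egr(w): nodes v₀..v_k (all labelled *, i.e. the unique label of Fin 1),
-- edges (v_{i-1}, a_i, v_i)
egr : ∀ {n} → List (Fin n) → Graph 1 n
egr w = record
  { N    = suc (length w)
  ; lab  = λ _ → fzero
  ; edge = λ u γ v → (suc (toℕ u) ≡ᵇ toℕ v) ∧ isLetter (at w (toℕ u)) γ
  }
  where
  isLetter : Maybe (Fin _) → Fin _ → Bool
  isLetter (just x) γ = ⌊ x ≟F γ ⌋
  isLetter nothing  γ = false

-- MSO logic over Graph a b; formulas with fo free node variables and
-- so free set variables (de Bruijn indices)

data Formula (a b : ℕ) : ℕ → ℕ → Set where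
  labF  : ∀ {fo so} → Fin a → Fin fo → Formula a b fo so
  edgeF : ∀ {fo so} → Fin b → Fin fo → Fin fo → Formula a b fo so
  eqF   : ∀ {fo so} → Fin fo → Fin fo → Formula a b fo so
  memF  : ∀ {fo so} → Fin fo → Fin so → Formula a b fo so
  ¬F    : ∀ {fo so} → Formula a b fo so → Formula a b fo so
  _∧F_  : ∀ {fo so} → Formula a b fo so → Formula a b fo so → Formula a b fo so
  _∨F_  : ∀ {fo so} → Formula a b fo so → Formula a b fo so → Formula a b fo so
  ∃₁    : ∀ {fo so} → Formula a b (suc fo) so → Formula a b fo so
  ∀₁    : ∀ {fo so} → Formula a b (suc fo) so → Formula a b fo so
  ∃₂    : ∀ {fo so} → Formula a b fo (suc so) → Formula a b fo so
  ∀₂    : ∀ {fo so} → Formula a b fo (suc so) → Formula a b fo so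

subsets : (n : ℕ) → List (Subset n)
subsets zero    = []ᵥ ∷ []
subsets (suc n) = map (true ∷ᵥ_) (subsets n) ++ map (false ∷ᵥ_) (subsets n)

allB : ∀ {A : Set} → (A → Bool) → List A → Bool
allB f xs = not (any (λ x → not (f x)) xs)

sat : ∀ {a b fo so} (g : Graph a b) → Formula a b fo so →
      VF.Vector (Fin (Graph.N g)) fo → VF.Vector (Subset (Graph.N g)) so → Bool
sat g (labF σ x)    ρ U = ⌊ Graph.lab g (ρ x) ≟F σ ⌋
sat g (edgeF γ x y) ρ U = Graph.edge g (ρ x) γ (ρ y)
sat g (eqF x y)     ρ U = ⌊ ρ x ≟F ρ y ⌋
sat g (memF x X)    ρ U = lookupᵥ (U X) (ρ x)
sat g (¬F φ)        ρ U = not (sat g φ ρ U)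
sat g (φ ∧F ψ)      ρ U = sat g φ ρ U ∧ sat g ψ ρ U
sat g (φ ∨F ψ)      ρ U = sat g φ ρ U ∨ sat g ψ ρ U
sat g (∃₁ φ)        ρ U = any  (λ u → sat g φ (u VF.∷ ρ) U) (allFin (Graph.N g))
sat g (∀₁ φ)        ρ U = allB (λ u → sat g φ (u VF.∷ ρ) U) (allFin (Graph.N g))
sat g (∃₂ φ)        ρ U = any  (λ S → sat g φ ρ (S VF.∷ U)) (subsets (Graph.N g))
sat g (∀₂ φ)        ρ U = allB (λ S → sat g φ ρ (S VF.∷ U)) (subsets (Graph.N g))

record MSOT (a b a' b' : ℕ) : Set where
  field
    k     : ℕ                                     -- parameters X₁..X_k
    φdom  : Formula a b 0 k
    C     : ℕ                                     -- copy set Fin C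
    φnode : Fin C → Fin a' → Formula a b 1 k
    φedge : Fin C → Fin C → Fin b' → Formula a b 2 k

countTrue : ∀ {n} → (Fin n → Bool) → ℕ
countTrue f = length (filter (λ i → ≟B (f i) true) (allFin _))

module _ {a b a' b'} (T : MSOT a b a' b') (g : Graph a b)
         (U : VF.Vector (Subset (Graph.N g)) (MSOT.k T)) where
  open MSOT T

  nodeHolds : Fin (Graph.N g) → Fin C → Fin a' → Bool
  nodeHolds u c σ = sat g (φnode c σ) (u VF.∷ VF.[]) U

  edgeHolds : Fin (Graph.N g) × Fin C → Fin b' → Fin (Graph.N g) × Fin C → Bool
  edgeHolds (u , c₁) γ (v , c₂) = sat g (φedge c₁ c₂ γ) (u VF.∷ (v VF.∷ VF.[])) U

  OutNode : Set
  OutNode = Σ (Fin (Graph.N g) × Fin C) λ uc →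
              countTrue (nodeHolds (proj₁ uc) (proj₂ uc)) ≡ 1

record MSOOut {a b a' b'} (T : MSOT a b a' b') (g : Graph a b)
       (U : VF.Vector (Subset (Graph.N g)) (MSOT.k T)) (h : Graph a' b') : Set where
  field
    bij     : OutNode T g U ↔ Fin (Graph.N h)
  open Inverse bij using (to)
  field
    lab-ok  : ∀ (n : OutNode T g U) σ →
              nodeHolds T g U (proj₁ (proj₁ n)) (proj₂ (proj₁ n)) σ ≡ true ⇔ Graph.lab h (to n) ≡ σ
    edge-ok : ∀ (n₁ : OutNode T g U) γ (n₂ : OutNode T g U) →
              Graph.edge h (to n₁) γ (to n₂) ≡ edgeHolds T g U (proj₁ n₁) γ (proj₁ n₂)

_⊢_↦_ : ∀ {a b a' b'} → MSOT a b a' b' → Graph a b → Graph a' b' → Set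
T ⊢ g ↦ h = Σ (VF.Vector (Subset (Graph.N g)) (MSOT.k T)) λ U →
              (sat g (MSOT.φdom T) VF.[] U ≡ true) × MSOOut T g U h

-- NMSO_e: {(egr w, egr z) | (w,z) ∈ m} equals, up to isomorphism,
-- the graph transduction defined by some T
NMSOe : ∀ {n₁ n₂} → Transduction n₁ n₂ → Set
NMSOe {n₁} {n₂} m = Σ (MSOT 1 n₁ 1 n₂) λ T →
    (∀ (g : Graph 1 n₁) (h : Graph 1 n₂) → T ⊢ g ↦ h →
       Σ (List (Fin n₁)) λ w → Σ (List (Fin n₂)) λ z →
         m w z × (g ≅ egr w) × (h ≅ egr z))
  × (∀ w z → m w z →
       Σ (Graph 1 n₁) λ g → (g ≅ egr w) × (T ⊢ g ↦ egr z))

module Submission where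

-- From NMSO_e to two machines: a formula is a finite automaton over letters carrying the bits of its
-- variables (Büchi), hence a finite semigroup. The first machine guesses the parameters together with
-- the semigroup values of all prefixes and suffixes. The second machine checks the guess locally and then
-- walks from each output node to the next, evaluating the edge formula on the way. Outputs of a given
-- input have a fixed length, so every loop of a computation has empty output and can be cut, and then no
-- position is visited more often than there are states.
--
-- Conversely, MSO transductions compose, by translating formulas backwards. A k-visiting computation is
-- obtained by guessing the visits as nodes of a graph, checking that this graph is a path, and replacing
-- every visit by its output; each of these steps is a simple MSO transduction.

open import Defs
open import Data.Nat using (ℕ; zero; suc; _+_; _*_; _∸_; _≤_; _<_; z≤n; s≤s; _≡ᵇ_)
import Data.Nat.Properties as ℕₚ
open import Data.Bool using (Bool; true; false; _∧_; _∨_; not) renaming (_≟_ to _≟B_)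
open import Data.Bool.ListAction using (any)
open import Data.Fin using (Fin; toℕ; fromℕ<; combine; remQuot; lift; _↑ˡ_; _↑ʳ_) renaming (zero to fzero; suc to fsuc; _≟_ to _≟F_)
import Data.Fin as Fin
import Data.Fin.Properties as Finₚ
open import Data.Fin.Subset using (Subset)
open import Data.List using (List; []; _∷_; _++_; map; length; filter; allFin; concatMap)
import Data.List as List
import Data.List.Properties as Listₚ
open import Data.List.Membership.Propositional using (_∈_)
import Data.List.Membership.Propositional.Properties as ∈ₚ
open import Data.List.Relation.Unary.All using (All; []; _∷_)
import Data.List.Relation.Unary.All as All
import Data.List.Relation.Unary.All.Properties as Allₚ
open import Data.List.Relation.Unary.Any using (here; there)
import Data.List.Relation.Unary.Any as Any
import Data.List.Relation.Unary.Any.Properties as Anyₚ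
open import Data.List.Relation.Unary.AllPairs using (AllPairs; []; _∷_)
import Data.List.Relation.Unary.AllPairs.Properties as AllPairsₚ
open import Data.List.Relation.Unary.Unique.Propositional using (Unique)
import Data.List.Relation.Unary.Unique.Propositional.Properties as Uniqueₚ
open import Data.Maybe using (Maybe; just; nothing)
import Data.Maybe
import Data.Maybe.Properties as Maybeₚ
open import Data.Product using (Σ; _×_; _,_; proj₁; proj₂; ∃)
import Data.Product.Properties as ×ₚ
open import Data.Product.Function.NonDependent.Propositional using (_×-⇔_)
open import Data.Sum using (_⊎_; inj₁; inj₂)
open import Data.Sum.Function.Propositional using (_⊎-⇔_)
open import Data.Empty using (⊥; ⊥-elim)
open import Data.Unit using (⊤; tt)
import Data.Fin.Relation.Unary.Top as Top
open import Relation.Binary.Definitions using (tri<; tri≈; tri>)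
open import Data.Vec using (Vec) renaming ([] to []ᵥ; _∷_ to _∷ᵥ_; lookup to lookupᵥ)
import Data.Vec as Vec
import Data.Vec.Properties as Vecₚ
import Data.Vec.Functional as VF
import Data.Vec.Functional.Properties as VFₚ
open import Relation.Binary.PropositionalEquality using (_≡_; _≢_; refl; cong; cong₂; trans; subst; subst₂) renaming (sym to ≡sym)
open import Relation.Nullary using (Dec; yes; no; ¬_; contradiction)
open import Relation.Nullary.Decidable using (⌊_⌋; _×-dec_; _⊎-dec_; ¬?; decidable-stable; map′)
open import Relation.Binary.Definitions using (DecidableEquality)
open import Relation.Unary using (Decidable)
open import Function.Base using (_∘_; id)
open import Function.Bundles using (Inverse; _⇔_; mk⇔; Equivalence; mk↔ₛ′)
import Function.Properties.Equivalence as ⇔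
open Graph using (N; lab; edge)
open Equivalence using (to; from)

-- A single machine would have to recall, at every return to a position, in which of the guessed
-- sets it had placed that position. Writing the guess on the intermediate word makes it permanent:
-- the second machine then finds the valuation on its tape, and its output is determined. This must
-- hold on all words, also on those that the first machine never writes, so the check of the
-- annotation has to be complete.
--
-- The nodes of `egr w` are the gaps around the letters, one more than there are letters. Hence the
-- intermediate word is one letter longer than `w`, and outputs carry an end mark while they travel
-- as paths with labelled nodes.
--
-- Graph transductions determine their outputs only up to isomorphism, and `NMSOe` speaks of all
-- graphs, not only of graphs of words. The steps from machines to transductions are therefore
-- stated over canonical graphs (`Realizes`); composition with a filtering identity (`idT`) removes
-- the other graphs and closes a transduction under isomorphism.

⌊⌋⇔ : ∀ {P : Set} (d : Dec P) → ⌊ d ⌋ ≡ true ⇔ P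
⌊⌋⇔ (yes p) = mk⇔ (λ _ → p) (λ _ → refl)
⌊⌋⇔ (no ¬p) = mk⇔ (λ ()) (λ p → ⊥-elim (¬p p))

not⇔ : ∀ b → not b ≡ true ⇔ (¬ b ≡ true)
not⇔ true  = mk⇔ (λ ()) (λ p → ⊥-elim (p refl))
not⇔ false = mk⇔ (λ _ ()) (λ _ → refl)

∧⇔ : ∀ b c → b ∧ c ≡ true ⇔ (b ≡ true × c ≡ true)
∧⇔ true  c = mk⇔ (refl ,_) proj₂
∧⇔ false c = mk⇔ (λ ()) (λ ())

∨⇔ : ∀ b c → b ∨ c ≡ true ⇔ (b ≡ true ⊎ c ≡ true)
∨⇔ true  c = mk⇔ inj₁ (λ _ → refl)
∨⇔ false c = mk⇔ inj₂ λ { (inj₁ ()) ; (inj₂ p) → p }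

bool-ext : ∀ {b c} → (b ≡ true ⇔ c ≡ true) → b ≡ c
bool-ext {true}  {true}  e = refl
bool-ext {true}  {false} e = ≡sym (to e refl)
bool-ext {false} {true}  e = from e refl
bool-ext {false} {false} e = refl

¬-⇔ : ∀ {A B : Set} → A ⇔ B → (¬ A) ⇔ (¬ B)
¬-⇔ e = mk⇔ (λ n b → n (from e b)) (λ n a → n (to e a))

∃-⇔ : ∀ {A : Set} {P Q : A → Set} → (∀ a → P a ⇔ Q a) → Σ A P ⇔ Σ A Q
∃-⇔ e = mk⇔ (λ (a , p) → a , to (e a) p) (λ (a , q) → a , from (e a) q)

∀-⇔ : ∀ {A : Set} {P Q : A → Set} → (∀ a → P a ⇔ Q a) → (∀ a → P a) ⇔ (∀ a → Q a)
∀-⇔ e = mk⇔ (λ p a → to (e a) (p a)) (λ q a → from (e a) (q a))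

any⇔ : ∀ {A : Set} (f : A → Bool) xs → any f xs ≡ true ⇔ ∃ λ x → x ∈ xs × f x ≡ true
any⇔ f []       = mk⇔ (λ ()) (λ ())
any⇔ f (x ∷ xs) = mk⇔ fwd bwd
  where
  fwd : any f (x ∷ xs) ≡ true → _
  fwd p with to (∨⇔ (f x) _) p
  ... | inj₁ q = x , here refl , q
  ... | inj₂ q with to (any⇔ f xs) q
  ... | y , y∈ , r = y , there y∈ , r
  bwd : _ → any f (x ∷ xs) ≡ true
  bwd (_ , here refl , q) = from (∨⇔ (f x) _) (inj₁ q)
  bwd (y , there y∈ , q)  = from (∨⇔ (f x) _) (inj₂ (from (any⇔ f xs) (y , y∈ , q)))

anyFull⇔ : ∀ {A : Set} (f : A → Bool) {xs} → (∀ x → x ∈ xs) → any f xs ≡ true ⇔ ∃ λ x → f x ≡ true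
anyFull⇔ f full = ⇔.trans (any⇔ f _) (mk⇔ (λ (x , _ , p) → x , p) (λ (x , p) → x , full x , p))

allFull⇔ : ∀ {A : Set} (f : A → Bool) {xs} → (∀ x → x ∈ xs) → allB f xs ≡ true ⇔ (∀ x → f x ≡ true)
allFull⇔ f {xs} full = ⇔.trans (not⇔ (any (not ∘ f) xs)) (mk⇔ fwd bwd)
  where
  fwd : ¬ any (not ∘ f) xs ≡ true → ∀ x → f x ≡ true
  fwd n x with f x in eq
  ... | true  = refl
  ... | false = ⊥-elim (n (from (anyFull⇔ (not ∘ f) full) (x , cong not eq)))
  bwd : (∀ x → f x ≡ true) → ¬ any (not ∘ f) xs ≡ true
  bwd p q with to (anyFull⇔ (not ∘ f) full) q
  ... | x , r = to (not⇔ (f x)) r (p x)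

∈-subsets : ∀ {n} (S : Subset n) → S ∈ subsets n
∈-subsets []ᵥ          = here refl
∈-subsets (true ∷ᵥ S)  = ∈ₚ.∈-++⁺ˡ (∈ₚ.∈-map⁺ (true ∷ᵥ_) (∈-subsets S))
∈-subsets (false ∷ᵥ S) = ∈ₚ.∈-++⁺ʳ _ (∈ₚ.∈-map⁺ (false ∷ᵥ_) (∈-subsets S))

mkSubset : ∀ {n} {P : Fin n → Set} → Decidable P → Subset n
mkSubset P? = Vec.tabulate (λ i → ⌊ P? i ⌋)

∈mkSubset : ∀ {n} {P : Fin n → Set} (P? : Decidable P) i → lookupᵥ (mkSubset P?) i ≡ true ⇔ P i
∈mkSubset P? i rewrite Vecₚ.lookup∘tabulate (λ i → ⌊ P? i ⌋) i = ⌊⌋⇔ (P? i)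

-- Propositional semantics of MSO formulas

Sem : ∀ {a b fo so} (g : Graph a b) → Formula a b fo so →
      (Fin fo → Fin (N g)) → (Fin so → Subset (N g)) → Set
Sem g (labF σ x)    ρ U = lab g (ρ x) ≡ σ
Sem g (edgeF γ x y) ρ U = edge g (ρ x) γ (ρ y) ≡ true
Sem g (eqF x y)     ρ U = ρ x ≡ ρ y
Sem g (memF x X)    ρ U = lookupᵥ (U X) (ρ x) ≡ true
Sem g (¬F φ)        ρ U = ¬ Sem g φ ρ U
Sem g (φ ∧F ψ)      ρ U = Sem g φ ρ U × Sem g ψ ρ U
Sem g (φ ∨F ψ)      ρ U = Sem g φ ρ U ⊎ Sem g ψ ρ U
Sem g (∃₁ φ)        ρ U = ∃ λ u → Sem g φ (u VF.∷ ρ) U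
Sem g (∀₁ φ)        ρ U = ∀ u → Sem g φ (u VF.∷ ρ) U
Sem g (∃₂ φ)        ρ U = ∃ λ S → Sem g φ ρ (S VF.∷ U)
Sem g (∀₂ φ)        ρ U = ∀ S → Sem g φ ρ (S VF.∷ U)

sat⇔Sem : ∀ {a b fo so} (g : Graph a b) (φ : Formula a b fo so) ρ U → sat g φ ρ U ≡ true ⇔ Sem g φ ρ U
sat⇔Sem g (labF σ x)    ρ U = ⌊⌋⇔ (lab g (ρ x) ≟F σ)
sat⇔Sem g (edgeF γ x y) ρ U = ⇔.refl
sat⇔Sem g (eqF x y)     ρ U = ⌊⌋⇔ (ρ x ≟F ρ y)
sat⇔Sem g (memF x X)    ρ U = ⇔.refl
sat⇔Sem g (¬F φ)        ρ U = ⇔.trans (not⇔ _) (¬-⇔ (sat⇔Sem g φ ρ U))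
sat⇔Sem g (φ ∧F ψ)      ρ U = ⇔.trans (∧⇔ _ _) (sat⇔Sem g φ ρ U ×-⇔ sat⇔Sem g ψ ρ U)
sat⇔Sem g (φ ∨F ψ)      ρ U = ⇔.trans (∨⇔ _ _) (sat⇔Sem g φ ρ U ⊎-⇔ sat⇔Sem g ψ ρ U)
sat⇔Sem g (∃₁ φ)        ρ U = ⇔.trans (anyFull⇔ _ ∈ₚ.∈-allFin) (∃-⇔ λ u → sat⇔Sem g φ (u VF.∷ ρ) U)
sat⇔Sem g (∀₁ φ)        ρ U = ⇔.trans (allFull⇔ _ ∈ₚ.∈-allFin) (∀-⇔ λ u → sat⇔Sem g φ (u VF.∷ ρ) U)
sat⇔Sem g (∃₂ φ)        ρ U = ⇔.trans (anyFull⇔ _ ∈-subsets) (∃-⇔ λ S → sat⇔Sem g φ ρ (S VF.∷ U))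
sat⇔Sem g (∀₂ φ)        ρ U = ⇔.trans (allFull⇔ _ ∈-subsets) (∀-⇔ λ S → sat⇔Sem g φ ρ (S VF.∷ U))

Sem? : ∀ {a b fo so} (g : Graph a b) (φ : Formula a b fo so) ρ U → Dec (Sem g φ ρ U)
Sem? g φ ρ U = map′ (to (sat⇔Sem g φ ρ U)) (from (sat⇔Sem g φ ρ U)) (sat g φ ρ U ≟B true)

-- The syntax has no constants. A node different from itself exists in no graph, the empty one
-- included.
⊥F : ∀ {a b fo so} → Formula a b fo so
⊥F = ∃₁ (¬F (eqF fzero fzero))

⊥F-elim : ∀ {a b fo so} (g : Graph a b) ρ U {A : Set} → Sem g (⊥F {fo = fo} {so}) ρ U → A
⊥F-elim g ρ U (_ , n) = ⊥-elim (n refl)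

⊤F : ∀ {a b fo so} → Formula a b fo so
⊤F = ¬F ⊥F

⊤F-intro : ∀ {a b fo so} (g : Graph a b) ρ U → Sem g (⊤F {fo = fo} {so}) ρ U
⊤F-intro g ρ U (_ , n) = n refl

⋁ : ∀ {a b fo so n} → (Fin n → Formula a b fo so) → Formula a b fo so
⋁ {n = zero}  φ = ⊥F
⋁ {n = suc n} φ = φ fzero ∨F ⋁ (φ ∘ fsuc)

Sem-⋁ : ∀ {a b fo so n} (g : Graph a b) (φ : Fin n → Formula a b fo so) {ρ U} →
        Sem g (⋁ φ) ρ U ⇔ ∃ λ i → Sem g (φ i) ρ U
Sem-⋁ {n = zero}  g φ {ρ} {U} = mk⇔ (λ s → ⊥F-elim g ρ U s) (λ ())
Sem-⋁ {n = suc n} g φ {ρ} {U} = mk⇔ fwd bwd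
  where
  fwd : Sem g (⋁ φ) ρ U → _
  fwd (inj₁ p) = fzero , p
  fwd (inj₂ p) with to (Sem-⋁ g (φ ∘ fsuc)) p
  ... | i , q = fsuc i , q
  bwd : _ → Sem g (⋁ φ) ρ U
  bwd (fzero  , p) = inj₁ p
  bwd (fsuc i , p) = inj₂ (from (Sem-⋁ g (φ ∘ fsuc)) (i , p))

infixr 4 _⇒F_
_⇒F_ : ∀ {a b fo so} → Formula a b fo so → Formula a b fo so → Formula a b fo so
φ ⇒F ψ = ¬F φ ∨F ψ

Sem-⇒ : ∀ {a b fo so} (g : Graph a b) (φ ψ : Formula a b fo so) {ρ U} →
        Sem g (φ ⇒F ψ) ρ U ⇔ (Sem g φ ρ U → Sem g ψ ρ U)
Sem-⇒ g φ ψ {ρ} {U} = mk⇔ (λ { (inj₁ n) p → ⊥-elim (n p) ; (inj₂ q) _ → q }) bwd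
  where
  bwd : (Sem g φ ρ U → Sem g ψ ρ U) → _
  bwd f with Sem? g φ ρ U
  ... | yes p = inj₂ (f p)
  ... | no n  = inj₁ n

-- Conditions on copies, labels or states do not concern the nodes of the graph; they are decided
-- when the formula is built.
guard : ∀ {a b fo so} {P : Set} → Dec P → Formula a b fo so
guard d = if-yes d
  where
  if-yes : ∀ {a b fo so} {P : Set} → Dec P → Formula a b fo so
  if-yes (yes _) = ⊤F
  if-yes (no _)  = ⊥F

Sem-guard : ∀ {a b fo so} {P : Set} (g : Graph a b) (d : Dec P) {ρ U} →
            Sem g (guard {fo = fo} {so} d) ρ U ⇔ P
Sem-guard g (yes p) {ρ} {U} = mk⇔ (λ _ → p) (λ _ → ⊤F-intro g ρ U)
Sem-guard g (no ¬p) {ρ} {U} = mk⇔ (λ s → ⊥F-elim g ρ U s) (λ p → ⊥-elim (¬p p))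

∷-lift : ∀ {A : Set} {m n} {f : Fin m → A} {f' : Fin n → A} (r : Fin m → Fin n) {u} →
         (∀ x → f' (r x) ≡ f x) → ∀ x → (u VF.∷ f') (lift 1 r x) ≡ (u VF.∷ f) x
∷-lift r e fzero    = refl
∷-lift r e (fsuc x) = e x

ren : ∀ {a b fo so fo' so'} → (Fin fo → Fin fo') → (Fin so → Fin so') → Formula a b fo so → Formula a b fo' so'
ren r s (labF σ x)    = labF σ (r x)
ren r s (edgeF γ x y) = edgeF γ (r x) (r y)
ren r s (eqF x y)     = eqF (r x) (r y)
ren r s (memF x X)    = memF (r x) (s X)
ren r s (¬F φ)        = ¬F (ren r s φ)
ren r s (φ ∧F ψ)      = ren r s φ ∧F ren r s ψ
ren r s (φ ∨F ψ)      = ren r s φ ∨F ren r s ψ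
ren r s (∃₁ φ)        = ∃₁ (ren (lift 1 r) s φ)
ren r s (∀₁ φ)        = ∀₁ (ren (lift 1 r) s φ)
ren r s (∃₂ φ)        = ∃₂ (ren r (lift 1 s) φ)
ren r s (∀₂ φ)        = ∀₂ (ren r (lift 1 s) φ)

Sem-ren : ∀ {a b fo so fo' so'} (g : Graph a b) (r : Fin fo → Fin fo') (s : Fin so → Fin so') φ {ρ ρ' U U'} →
          (∀ x → ρ' (r x) ≡ ρ x) → (∀ X → U' (s X) ≡ U X) → Sem g (ren r s φ) ρ' U' ⇔ Sem g φ ρ U
Sem-ren g r s (labF σ x)    e f rewrite e x = ⇔.refl
Sem-ren g r s (edgeF γ x y) e f rewrite e x | e y = ⇔.refl
Sem-ren g r s (eqF x y)     e f rewrite e x | e y = ⇔.refl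
Sem-ren g r s (memF x X)    e f rewrite e x | f X = ⇔.refl
Sem-ren g r s (¬F φ)        e f = ¬-⇔ (Sem-ren g r s φ e f)
Sem-ren g r s (φ ∧F ψ)      e f = Sem-ren g r s φ e f ×-⇔ Sem-ren g r s ψ e f
Sem-ren g r s (φ ∨F ψ)      e f = Sem-ren g r s φ e f ⊎-⇔ Sem-ren g r s ψ e f
Sem-ren g r s (∃₁ φ)        e f = ∃-⇔ λ u → Sem-ren g (lift 1 r) s φ (∷-lift r e) f
Sem-ren g r s (∀₁ φ)        e f = ∀-⇔ λ u → Sem-ren g (lift 1 r) s φ (∷-lift r e) f
Sem-ren g r s (∃₂ φ)        e f = ∃-⇔ λ S → Sem-ren g r (lift 1 s) φ e (∷-lift s f)
Sem-ren g r s (∀₂ φ)        e f = ∀-⇔ λ S → Sem-ren g r (lift 1 s) φ e (∷-lift s f)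

∷-cong : ∀ {A : Set} {m} {f f' : Fin m → A} {u} → (∀ x → f' x ≡ f x) → ∀ x → (u VF.∷ f') x ≡ (u VF.∷ f) x
∷-cong e fzero    = refl
∷-cong e (fsuc x) = e x

-- Takes the place of function extensionality: valuations are functions and can be compared only
-- pointwise.
Sem-ext : ∀ {a b fo so} (g : Graph a b) (φ : Formula a b fo so) {ρ ρ' U U'} →
          (∀ x → ρ' x ≡ ρ x) → (∀ X → U' X ≡ U X) → Sem g φ ρ' U' ⇔ Sem g φ ρ U
Sem-ext g (labF σ x)    e f rewrite e x = ⇔.refl
Sem-ext g (edgeF γ x y) e f rewrite e x | e y = ⇔.refl
Sem-ext g (eqF x y)     e f rewrite e x | e y = ⇔.refl
Sem-ext g (memF x X)    e f rewrite e x | f X = ⇔.refl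
Sem-ext g (¬F φ)        e f = ¬-⇔ (Sem-ext g φ e f)
Sem-ext g (φ ∧F ψ)      e f = Sem-ext g φ e f ×-⇔ Sem-ext g ψ e f
Sem-ext g (φ ∨F ψ)      e f = Sem-ext g φ e f ⊎-⇔ Sem-ext g ψ e f
Sem-ext g (∃₁ φ)        e f = ∃-⇔ λ u → Sem-ext g φ (∷-cong e) f
Sem-ext g (∀₁ φ)        e f = ∀-⇔ λ u → Sem-ext g φ (∷-cong e) f
Sem-ext g (∃₂ φ)        e f = ∃-⇔ λ S → Sem-ext g φ e (∷-cong f)
Sem-ext g (∀₂ φ)        e f = ∀-⇔ λ S → Sem-ext g φ e (∷-cong f)

lookup-injective : ∀ {A : Set} {xs : List A} → Unique xs → ∀ i j → List.lookup xs i ≡ List.lookup xs j → i ≡ j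
lookup-injective (_ ∷ u) fzero    fzero    p = refl
lookup-injective (n ∷ u) fzero    (fsuc j) p = ⊥-elim (All.lookup n (∈ₚ.∈-lookup j) p)
lookup-injective (n ∷ u) (fsuc i) fzero    p = ⊥-elim (All.lookup n (∈ₚ.∈-lookup i) (≡sym p))
lookup-injective (_ ∷ u) (fsuc i) (fsuc j) p = cong fsuc (lookup-injective u i j p)

-- Outputs of MSO transductions and their isomorphisms

module _ {a b a' b'} (T : MSOT a b a' b') (g : Graph a b) (U : Fin (MSOT.k T) → Subset (N g)) where
  open MSOT T

  Nd : Fin (N g) × Fin C → Fin a' → Set
  Nd (u , c) σ = Sem g (φnode c σ) (u VF.∷ VF.[]) U

  Ed : Fin (N g) × Fin C → Fin b' → Fin (N g) × Fin C → Set
  Ed (u , c) γ (v , d) = Sem g (φedge c d γ) (u VF.∷ (v VF.∷ VF.[])) U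

  -- The logical form of `countTrue` being 1, with the label made explicit.
  Labelled : Fin (N g) × Fin C → Fin a' → Set
  Labelled p σ = ∀ σ' → Nd p σ' ⇔ σ ≡ σ'

  -- Replaces the bijection with `OutNode`, whose elements carry equality proofs. An injective
  -- enumeration that hits every pair with exactly one label says the same without them, see `⊢⇔⊨`.
  record Out (h : Graph a' b') : Set where
    field
      f       : Fin (N h) → Fin (N g) × Fin C
      f-inj   : ∀ {i j} → f i ≡ f j → i ≡ j
      f-surj  : ∀ p σ → Labelled p σ → ∃ λ i → f i ≡ p
      f-lab   : ∀ i → Labelled (f i) (lab h i)
      f-edge  : ∀ i γ j → edge h i γ j ≡ true ⇔ Ed (f i) γ (f j)

infix 4 _⊨_↦_
_⊨_↦_ : ∀ {a b a' b'} → MSOT a b a' b' → Graph a b → Graph a' b' → Set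
T ⊨ g ↦ h = Σ (Fin (MSOT.k T) → Subset (N g)) λ U → Sem g (MSOT.φdom T) VF.[] U × Out T g U h

length1⇔ : ∀ {A : Set} {xs : List A} → Unique xs → length xs ≡ 1 ⇔ ∃ λ x → ∀ y → y ∈ xs ⇔ x ≡ y
length1⇔ {xs = []}         u = mk⇔ (λ ()) λ { (x , e) → contradiction (from (e x) refl) λ () }
length1⇔ {xs = x ∷ []}     u = mk⇔ (λ _ → x , λ y → mk⇔ (λ { (here p) → ≡sym p ; (there ()) }) (λ p → here (≡sym p))) (λ _ → refl)
length1⇔ {xs = x ∷ y ∷ xs} ((x≢y ∷ _) ∷ _) = mk⇔ (λ ()) λ (z , e) →
  ⊥-elim (x≢y (trans (≡sym (to (e x) (here refl))) (to (e y) (there (here refl)))))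

countTrue⇔ : ∀ {n} (f : Fin n → Bool) → countTrue f ≡ 1 ⇔ ∃ λ σ → ∀ σ' → f σ' ≡ true ⇔ σ ≡ σ'
countTrue⇔ f = ⇔.trans (length1⇔ (Uniqueₚ.filter⁺ _ (Uniqueₚ.allFin⁺ _)))
  (∃-⇔ λ x → ∀-⇔ λ y → mk⇔ (⇔.trans (member y)) (⇔.trans (⇔.sym (member y))))
  where
  member : ∀ y → f y ≡ true ⇔ y ∈ filter (λ i → f i ≟B true) (allFin _)
  member y = mk⇔ (λ p → ∈ₚ.∈-filter⁺ (λ i → f i ≟B true) (∈ₚ.∈-allFin y) p)
      (λ q → proj₂ (∈ₚ.∈-filter⁻ (λ i → f i ≟B true) {xs = allFin _} q))

module _ {a b a' b'} {T : MSOT a b a' b'} {g : Graph a b} {U : Fin (MSOT.k T) → Subset (N g)} where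
  open MSOT T

  holds⇔Nd : ∀ p σ → nodeHolds T g U (proj₁ p) (proj₂ p) σ ≡ true ⇔ Nd T g U p σ
  holds⇔Nd (u , c) σ = sat⇔Sem g (φnode c σ) _ U

  outNode⇔ : ∀ p → countTrue (nodeHolds T g U (proj₁ p) (proj₂ p)) ≡ 1 ⇔ ∃ (Labelled T g U p)
  outNode⇔ p = ⇔.trans (countTrue⇔ _) (∃-⇔ λ σ → ∀-⇔ λ σ' →
    mk⇔ (⇔.trans (⇔.sym (holds⇔Nd p σ'))) (⇔.trans (holds⇔Nd p σ')))

  outNode-≡ : {m n : OutNode T g U} → proj₁ m ≡ proj₁ n → m ≡ n
  outNode-≡ {_ , c} {_ , d} refl = cong (_ ,_) (ℕₚ.≡-irrelevant c d)

module _ {a b a' b'} {T : MSOT a b a' b'} {g : Graph a b} {U : Fin (MSOT.k T) → Subset (N g)} {h : Graph a' b'} where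
  open MSOT T

  private
    holds⇔ = holds⇔Nd {T = T} {g} {U}
    out⇔   = outNode⇔ {T = T} {g} {U}
    out-≡  = λ {m n} → outNode-≡ {T = T} {g} {U} {m} {n}

  Out⇒MSOOut : Out T g U h → MSOOut T g U h
  Out⇒MSOOut o = record { bij = mk↔ₛ′ idx node idx-node (λ n → out-≡ (f-idx n)) ; lab-ok = l ; edge-ok = e }
    where
    open Out o
    idx : OutNode T g U → Fin (N h)
    idx (p , c) = let σ , q = to (out⇔ p) c in proj₁ (f-surj p σ q)
    f-idx : ∀ n → f (idx n) ≡ proj₁ n
    f-idx (p , c) = let σ , q = to (out⇔ p) c in proj₂ (f-surj p σ q)
    node : Fin (N h) → OutNode T g U
    node i = f i , from (out⇔ (f i)) (lab h i , f-lab i)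
    idx-node : ∀ i → idx (node i) ≡ i
    idx-node i = f-inj (f-idx (node i))
    l : ∀ n σ → nodeHolds T g U (proj₁ (proj₁ n)) (proj₂ (proj₁ n)) σ ≡ true ⇔ lab h (idx n) ≡ σ
    l n σ = ⇔.trans (holds⇔ (proj₁ n) σ)
      (subst (λ p → Nd T g U p σ ⇔ lab h (idx n) ≡ σ) (f-idx n) (f-lab (idx n) σ))
    e : ∀ n₁ γ n₂ → edge h (idx n₁) γ (idx n₂) ≡ edgeHolds T g U (proj₁ n₁) γ (proj₁ n₂)
    e n₁ γ n₂ = bool-ext (⇔.trans
      (subst₂ (λ p q → edge h (idx n₁) γ (idx n₂) ≡ true ⇔ Ed T g U p γ q) (f-idx n₁) (f-idx n₂) (f-edge _ γ _))
      (⇔.sym (sat⇔Sem g (φedge _ _ γ) _ U)))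

  MSOOut⇒Out : MSOOut T g U h → Out T g U h
  MSOOut⇒Out o = record { f = λ i → proj₁ (node i) ; f-inj = i ; f-surj = s ; f-lab = l ; f-edge = e }
    where
    open MSOOut o
    open Inverse bij using () renaming (to to idx; from to node; strictlyInverseˡ to idx-node; strictlyInverseʳ to node-idx)
    i : ∀ {i j} → proj₁ (node i) ≡ proj₁ (node j) → i ≡ j
    i {i} {j} p = trans (≡sym (idx-node i)) (trans (cong idx (out-≡ p)) (idx-node j))
    s : ∀ p σ → Labelled T g U p σ → ∃ λ i → proj₁ (node i) ≡ p
    s p σ q = idx n , cong proj₁ (node-idx n)
      where n = p , from (out⇔ p) (σ , q)
    l : ∀ i → Labelled T g U (proj₁ (node i)) (lab h i)
    l i σ = ⇔.trans (⇔.sym (holds⇔ (proj₁ (node i)) σ))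
      (subst (λ j → nodeHolds T g U _ _ σ ≡ true ⇔ lab h j ≡ σ) (idx-node i) (lab-ok (node i) σ))
    e : ∀ i γ j → edge h i γ j ≡ true ⇔ Ed T g U (proj₁ (node i)) γ (proj₁ (node j))
    e i γ j rewrite ≡sym (cong₂ (λ i j → edge h i γ j) (idx-node i) (idx-node j)) | edge-ok (node i) γ (node j) =
      sat⇔Sem g (φedge _ _ γ) _ U

⊢⇔⊨ : ∀ {a b a' b'} {T : MSOT a b a' b'} {g h} → T ⊢ g ↦ h ⇔ T ⊨ g ↦ h
⊢⇔⊨ {T = T} {g} {h} = ∃-⇔ λ U → sat⇔Sem g (MSOT.φdom T) _ U ×-⇔ mk⇔ (MSOOut⇒Out {T = T} {g} {U} {h})
    (Out⇒MSOOut {T = T} {g} {U} {h})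

record Iso {a b} (g h : Graph a b) : Set where
  field
    f      : Fin (N g) → Fin (N h)
    f-inj  : ∀ {i j} → f i ≡ f j → i ≡ j
    f-surj : ∀ j → ∃ λ i → f i ≡ j
    f-lab  : ∀ i → lab h (f i) ≡ lab g i
    f-edge : ∀ i γ j → edge h (f i) γ (f j) ≡ true ⇔ edge g i γ j ≡ true

Iso⇒≅ : ∀ {a b} {g h : Graph a b} → Iso g h → g ≅ h
Iso⇒≅ s = record
  { bij     = mk↔ₛ′ f (proj₁ ∘ f-surj) (proj₂ ∘ f-surj) (λ i → f-inj (proj₂ (f-surj (f i))))
  ; lab-ok  = f-lab
  ; edge-ok = λ u γ v → bool-ext (f-edge u γ v) }
  where open Iso s

≅⇒Iso : ∀ {a b} {g h : Graph a b} → g ≅ h → Iso g h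
≅⇒Iso s = record
  { f = idx
  ; f-inj = λ {i} {j} p → trans (≡sym (node-idx i)) (trans (cong node p) (node-idx j))
  ; f-surj = λ j → node j , idx-node j
  ; f-lab = lab-ok
  ; f-edge = λ i γ j → subst (λ b → b ≡ true ⇔ _) (≡sym (edge-ok i γ j)) ⇔.refl }
  where
  open _≅_ s
  open Inverse bij using () renaming (to to idx; from to node; strictlyInverseˡ to idx-node; strictlyInverseʳ to node-idx)

Iso-refl : ∀ {a b} {g : Graph a b} → Iso g g
Iso-refl = record { f = id ; f-inj = id ; f-surj = λ j → j , refl ; f-lab = λ _ → refl ; f-edge = λ _ _ _ → ⇔.refl }

Iso-sym : ∀ {a b} {g h : Graph a b} → Iso g h → Iso h g
Iso-sym {g = g} {h} s = record
  { f = inv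
  ; f-inj = λ {i} {j} p → trans (≡sym (f-inv i)) (trans (cong f p) (f-inv j))
  ; f-surj = λ i → f i , f-inj (f-inv (f i))
  ; f-lab = λ i → trans (≡sym (f-lab (inv i))) (cong (lab h) (f-inv i))
  ; f-edge = λ i γ j → ⇔.sym (subst₂ (λ i' j' → edge h i' γ j' ≡ true ⇔ edge g (inv i) γ (inv j) ≡ true)
                         (f-inv i) (f-inv j) (f-edge (inv i) γ (inv j))) }
  where
  open Iso s
  inv = proj₁ ∘ f-surj
  f-inv : ∀ i → f (inv i) ≡ i
  f-inv = proj₂ ∘ f-surj

Iso-trans : ∀ {a b} {g h k : Graph a b} → Iso g h → Iso h k → Iso g k
Iso-trans s t = record
  { f = t.f ∘ s.f
  ; f-inj = s.f-inj ∘ t.f-inj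
  ; f-surj = λ k → let j , p = t.f-surj k ; i , q = s.f-surj j in i , trans (cong t.f q) p
  ; f-lab = λ i → trans (t.f-lab (s.f i)) (s.f-lab i)
  ; f-edge = λ i γ j → ⇔.trans (t.f-edge (s.f i) γ (s.f j)) (s.f-edge i γ j) }
  where
  module s = Iso s
  module t = Iso t

module _ {a b a' b'} {T : MSOT a b a' b'} {g : Graph a b} {U : Fin (MSOT.k T) → Subset (N g)} where
  open MSOT T

  Out-≅ : ∀ {h h'} → Out T g U h → Iso h h' → Out T g U h'
  Out-≅ {h} {h'} o s = record
    { f = o.f ∘ inv
    ; f-inj = λ {i} {j} p → trans (≡sym (f-inv i)) (trans (cong s.f (o.f-inj p)) (f-inv j))
    ; f-surj = λ p σ q → let i , r = o.f-surj p σ q in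
                 s.f i , trans (cong o.f (s.f-inj (f-inv (s.f i)))) r
    ; f-lab = λ i → subst (Labelled T g U (o.f (inv i)))
                      (trans (≡sym (s.f-lab (inv i))) (cong (lab h') (f-inv i))) (o.f-lab (inv i))
    ; f-edge = λ i γ j → ⇔.trans (subst₂ (λ i' j' → edge h' i' γ j' ≡ true ⇔ edge h (inv i) γ (inv j) ≡ true)
                         (f-inv i) (f-inv j) (s.f-edge (inv i) γ (inv j))) (o.f-edge (inv i) γ (inv j)) }
    where
    module o = Out o
    module s = Iso s
    inv = proj₁ ∘ s.f-surj
    f-inv : ∀ i → s.f (inv i) ≡ i
    f-inv = proj₂ ∘ s.f-surj

  Labelled-unique : ∀ {p σ σ'} → Labelled T g U p σ → Labelled T g U p σ' → σ ≡ σ'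
  Labelled-unique l l' = to (l _) (from (l' _) refl)

  -- Both graphs enumerate the same pairs of node and copy, so matching equal pairs is an
  -- isomorphism.
  Out-unique : ∀ {h h'} → Out T g U h → Out T g U h' → Iso h h'
  Out-unique {h} {h'} o o' = record
    { f = φ
    ; f-inj = λ {i} {j} p → o.f-inj (trans (≡sym (o'φ i)) (trans (cong o'.f p) (o'φ j)))
    ; f-surj = λ j → let i , p = o.f-surj (o'.f j) _ (o'.f-lab j) in i , o'.f-inj (trans (o'φ i) p)
    ; f-lab = λ i → Labelled-unique {o'.f (φ i)} (o'.f-lab (φ i))
        (subst (λ p → Labelled T g U p (lab h i)) (≡sym (o'φ i)) (o.f-lab i))
    ; f-edge = λ i γ j → ⇔.trans
        (subst₂ (λ p q → edge h' (φ i) γ (φ j) ≡ true ⇔ Ed T g U p γ q) (o'φ i) (o'φ j) (o'.f-edge (φ i) γ (φ j)))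
                           (⇔.sym (o.f-edge i γ j)) }
    where
    module o = Out o
    module o' = Out o'
    φ : Fin (N h) → Fin (N h')
    φ i = proj₁ (o'.f-surj (o.f i) _ (o.f-lab i))
    o'φ : ∀ i → o'.f (φ i) ≡ o.f i
    o'φ i = proj₂ (o'.f-surj (o.f i) _ (o.f-lab i))

  Labelled? : ∀ p → Dec (∃ (Labelled T g U p))
  Labelled? p = map′ (to (outNode⇔ {T = T} {g} {U} p)) (from (outNode⇔ {T = T} {g} {U} p))
      (countTrue (nodeHolds T g U (proj₁ p) (proj₂ p)) ℕₚ.≟ 1)

  -- Being an output node is decidable, so the output for a valuation can be listed. This supplies
  -- the intermediate graph when a composition has to be taken apart.
  Out-exists : ∃ (Out T g U)
  Out-exists = h , record
    { f = nth ; f-inj = λ {i} {j} → lookup-injective uniq i j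
    ; f-surj = λ p σ l → let m = ∈ₚ.∈-filter⁺ Labelled? (∈ₚ.∈-cartesianProduct⁺ (∈ₚ.∈-allFin (proj₁ p)) (∈ₚ.∈-allFin (proj₂ p))) (σ , l) in
                 Any.index m , ≡sym (Anyₚ.lookup-index m)
    ; f-lab = λ i → proj₂ (labelled i)
    ; f-edge = λ i γ j → sat⇔Sem g (φedge _ _ γ) _ U }
    where
    nodes : List (Fin (N g) × Fin C)
    nodes = filter Labelled? (List.cartesianProduct (allFin (N g)) (allFin C))
    uniq : Unique nodes
    uniq = Uniqueₚ.filter⁺ Labelled? (Uniqueₚ.cartesianProduct⁺ (Uniqueₚ.allFin⁺ _) (Uniqueₚ.allFin⁺ _))
    nth : Fin (length nodes) → Fin (N g) × Fin C
    nth = List.lookup nodes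
    labelled : ∀ i → ∃ (Labelled T g U (nth i))
    labelled i = proj₂ (∈ₚ.∈-filter⁻ Labelled? {xs = List.cartesianProduct (allFin (N g)) (allFin C)} (∈ₚ.∈-lookup i))
    h : Graph a' b'
    h = record { N = length nodes ; lab = proj₁ ∘ labelled ; edge = λ i γ j → edgeHolds T g U (nth i) γ (nth j) }

-- Composition of MSO transductions

∀⇔¬∃¬ : ∀ {A : Set} {P : A → Set} → Decidable P → (∀ x → P x) ⇔ (¬ ∃ λ x → ¬ P x)
∀⇔¬∃¬ P? = mk⇔ (λ p (x , n) → n (p x)) (λ n x → decidable-stable (P? x) (λ np → n (x , np)))

⋀ : ∀ {a b fo so n} → (Fin n → Formula a b fo so) → Formula a b fo so
⋀ φ = ¬F (⋁ (¬F ∘ φ))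

Sem-⋀ : ∀ {a b fo so n} (g : Graph a b) (φ : Fin n → Formula a b fo so) {ρ U} →
        Sem g (⋀ φ) ρ U ⇔ (∀ i → Sem g (φ i) ρ U)
Sem-⋀ g φ = ⇔.trans (¬-⇔ (Sem-⋁ g (¬F ∘ φ))) (⇔.sym (∀⇔¬∃¬ (λ i → Sem? g (φ i) _ _)))

sign : ∀ {a b fo so} {P : Set} → Dec P → Formula a b fo so → Formula a b fo so
sign (yes _) φ = φ
sign (no _)  φ = ¬F φ

Sem-sign : ∀ {a b fo so} {P : Set} (g : Graph a b) (d : Dec P) (φ : Formula a b fo so) {ρ U} →
           Sem g (sign d φ) ρ U ⇔ (Sem g φ ρ U ⇔ P)
Sem-sign g (yes p) φ = mk⇔ (λ s → mk⇔ (λ _ → p) (λ _ → s)) (λ e → from e p)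
Sem-sign g (no ¬p) φ = mk⇔ (λ n → mk⇔ (λ s → ⊥-elim (n s)) (λ p → ⊥-elim (¬p p))) (λ e s → ¬p (to e s))

exs : ∀ {a b fo n} m → Formula a b fo (m + n) → Formula a b fo n
exs zero    φ = φ
exs (suc m) φ = exs m (∃₂ φ)

Sem-exs : ∀ {a b fo n} (g : Graph a b) m (φ : Formula a b fo (m + n)) {ρ U} →
          Sem g (exs m φ) ρ U ⇔ ∃ λ V → (∀ i → V (m ↑ʳ i) ≡ U i) × Sem g φ ρ V
Sem-exs g zero    φ = mk⇔ (λ s → _ , (λ _ → refl) , s)
                          (λ (V , e , s) → to (Sem-ext g φ (λ _ → refl) e) s)
Sem-exs g (suc m) φ = ⇔.trans (Sem-exs g m (∃₂ φ)) (mk⇔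
  (λ (V , e , S , s) → (S VF.∷ V) , e , s)
  (λ (V , e , s) → V ∘ fsuc , e , V fzero , to (Sem-ext g φ (λ _ → refl) (λ { fzero → refl ; (fsuc i) → refl })) s))

-- Back-translation of formulas along T₁: a node variable of the output becomes a node
-- variable of the input together with a fixed copy, a set variable becomes one set per copy.
module BackTranslation {a b a' b' : ℕ} (T₁ : MSOT a b a' b') where
  open MSOT T₁

  -- Layout of the set variables: a block of `C` variables for each set variable of the output
  -- graph, innermost first, and after all blocks the parameters of `T₁`, where `par` finds them.
  ctx : ℕ → ℕ
  ctx zero     = k
  ctx (suc so) = C + ctx so

  par : ∀ so → Fin k → Fin (ctx so)
  par zero     i = i
  par (suc so) i = C ↑ʳ par so i

  slice : ∀ {so} → Fin so → Fin C → Fin (ctx so)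
  slice {suc so} fzero    c = c ↑ˡ ctx so
  slice {suc so} (fsuc X) c = C ↑ʳ slice X c

  nodeAt : ∀ {fo} so → Fin C → Fin a' → Fin fo → Formula a b fo (ctx so)
  nodeAt so c σ x = ren (λ _ → x) (par so) (φnode c σ)

  isNode : ∀ {fo} so → Fin C → Fin fo → Formula a b fo (ctx so)
  isNode so c x = ⋁ λ σ → ⋀ λ σ' → sign (σ ≟F σ') (nodeAt so c σ' x)

  ∃node : ∀ {fo} so → (Fin C → Formula a b (suc fo) (ctx so)) → Formula a b fo (ctx so)
  ∃node so φ = ⋁ λ c → ∃₁ (isNode so c fzero ∧F φ c)

  bt : ∀ {fo so} → (Fin fo → Fin C) → Formula a' b' fo so → Formula a b fo (ctx so)
  bt {so = so} cp (labF σ x)    = nodeAt so (cp x) σ x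
  bt {so = so} cp (edgeF γ x y) = ren (x VF.∷ (y VF.∷ VF.[])) (par so) (φedge (cp x) (cp y) γ)
  bt cp (eqF x y)          = guard (cp x ≟F cp y) ∧F eqF x y
  bt cp (memF x X)         = memF x (slice X (cp x))
  bt cp (¬F φ)             = ¬F (bt cp φ)
  bt cp (φ ∧F ψ)           = bt cp φ ∧F bt cp ψ
  bt cp (φ ∨F ψ)           = bt cp φ ∨F bt cp ψ
  bt {so = so} cp (∃₁ φ)   = ∃node so (λ c → bt (c VF.∷ cp) φ)
  bt {so = so} cp (∀₁ φ)   = ¬F (∃node so (λ c → ¬F (bt (c VF.∷ cp) φ)))
  bt cp (∃₂ φ)             = exs C (bt cp φ)
  bt cp (∀₂ φ)             = ¬F (exs C (¬F (bt cp φ)))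

  module _ {g : Graph a b} {U : Fin k → Subset (N g)} {h : Graph a' b'} (o : Out T₁ g U h) where
    open Out o

    -- Of the block of a set variable only the bits at output nodes are constrained, so many `V` may
    -- match the same `W`.
    record SetRel {so} (V : Fin (ctx so) → Subset (N g)) (W : Fin so → Subset (N h)) : Set where
      field
        agree : ∀ i → V (par so i) ≡ U i
        cut   : ∀ X j → lookupᵥ (V (slice X (proj₂ (f j)))) (proj₁ (f j)) ≡ lookupᵥ (W X) j
    open SetRel

    NodeRel : ∀ {fo} → (Fin fo → Fin C) → (Fin fo → Fin (N g)) → (Fin fo → Fin (N h)) → Set
    NodeRel cp ρ ρ' = ∀ x → f (ρ' x) ≡ (ρ x , cp x)

    extend : ∀ {fo} {cp : Fin fo → Fin C} {ρ ρ' c u j} → NodeRel cp ρ ρ' → f j ≡ (u , c) →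
             NodeRel (c VF.∷ cp) (u VF.∷ ρ) (j VF.∷ ρ')
    extend e p fzero    = p
    extend e p (fsuc x) = e x

    -- `push` and `pull` are the back-and-forth steps for set quantifiers: a set of output nodes
    -- splits into one set per copy, and any `C` sets of input nodes can be read as a set of output
    -- nodes.
    push : ∀ {so} {V : Fin (ctx so) → Subset (N g)} {W : Fin so → Subset (N h)} → SetRel V W →
           (S : Subset (N h)) → ∃ λ V' → (∀ i → V' (C ↑ʳ i) ≡ V i) × SetRel {suc so} V' (S VF.∷ W)
    push {so} {V} {W} r S = F VF.++ V , VFₚ.lookup-++ʳ F V , record
      { agree = λ i → trans (VFₚ.lookup-++ʳ F V (par so i)) (agree r i)
      ; cut = λ { fzero j → trans (cong (λ S → lookupᵥ S (proj₁ (f j))) (VFₚ.lookup-++ˡ F V (proj₂ (f j)))) (hit j)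
                ; (fsuc X) j → trans (cong (λ S → lookupᵥ S (proj₁ (f j))) (VFₚ.lookup-++ʳ F V _)) (cut r X j) } }
      where
      Hit? : ∀ c → Decidable (λ u → ∃ λ j → f j ≡ (u , c) × lookupᵥ S j ≡ true)
      Hit? c u = Finₚ.any? λ j → ×ₚ.≡-dec _≟F_ _≟F_ (f j) (u , c) ×-dec lookupᵥ S j ≟B true
      F : Fin C → Subset (N g)
      F c = mkSubset (Hit? c)
      hit : ∀ j → lookupᵥ (F (proj₂ (f j))) (proj₁ (f j)) ≡ lookupᵥ S j
      hit j = bool-ext (⇔.trans (∈mkSubset (Hit? (proj₂ (f j))) (proj₁ (f j)))
        (mk⇔ (λ (i , p , q) → subst (λ i → lookupᵥ S i ≡ true) (f-inj p) q) (λ q → j , refl , q)))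

    pull : ∀ {so} {V : Fin (ctx so) → Subset (N g)} {W : Fin so → Subset (N h)} → SetRel V W →
           ∀ V' → (∀ i → V' (C ↑ʳ i) ≡ V i) → ∃ λ S → SetRel {suc so} V' (S VF.∷ W)
    pull {so} {V} {W} r V' e = S , record
      { agree = λ i → trans (e (par so i)) (agree r i)
      ; cut = λ { fzero j → ≡sym (Vecₚ.lookup∘tabulate member j)
                ; (fsuc X) j → trans (cong (λ S → lookupᵥ S (proj₁ (f j))) (e _)) (cut r X j) } }
      where
      member : Fin (N h) → Bool
      member j = lookupᵥ (V' (proj₂ (f j) ↑ˡ ctx so)) (proj₁ (f j))
      S : Subset (N h)
      S = Vec.tabulate member

    Sem-nodeAt : ∀ {fo so} {V : Fin (ctx so) → Subset (N g)} {W : Fin so → Subset (N h)} → SetRel V W →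
        ∀ c σ x {ρ : Fin fo → _} →
                 Sem g (nodeAt so c σ x) ρ V ⇔ Nd T₁ g U (ρ x , c) σ
    Sem-nodeAt r c σ x = Sem-ren g _ _ (φnode c σ) (λ { fzero → refl }) (agree r)

    Sem-isNode : ∀ {fo so} {V : Fin (ctx so) → Subset (N g)} {W : Fin so → Subset (N h)} → SetRel V W →
        ∀ c x {ρ : Fin fo → _} →
                 Sem g (isNode so c x) ρ V ⇔ ∃ (Labelled T₁ g U (ρ x , c))
    Sem-isNode {so = so} r c x = ⇔.trans (Sem-⋁ g _) (∃-⇔ λ σ → ⇔.trans (Sem-⋀ g _) (∀-⇔ λ σ' →
      ⇔.trans (Sem-sign g (σ ≟F σ') (nodeAt so c σ' x))
              (mk⇔ (⇔.trans (⇔.sym (Sem-nodeAt r c σ' x))) (⇔.trans (Sem-nodeAt r c σ' x)))))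

    Sem-∃node : ∀ {fo so} {V : Fin (ctx so) → Subset (N g)} {W : Fin so → Subset (N h)} → SetRel V W →
                ∀ (φ : Fin C → Formula a b (suc fo) (ctx so)) {ρ : Fin fo → _} {P : Fin (N h) → Set} →
                (∀ {u c j} → f j ≡ (u , c) → Sem g (φ c) (u VF.∷ ρ) V ⇔ P j) →
                Sem g (∃node so φ) ρ V ⇔ ∃ P
    Sem-∃node r φ {ρ} e = ⇔.trans (Sem-⋁ g _) (mk⇔
      (λ (c , u , n , s) → let σ , l = to (Sem-isNode r c fzero {u VF.∷ ρ}) n ; j , p = f-surj (u , c) σ l in j , to (e p) s)
      (λ (j , q) → proj₂ (f j) , proj₁ (f j) , from (Sem-isNode r _ fzero {proj₁ (f j) VF.∷ ρ})
          (lab h j , f-lab j) , from (e refl) q))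

    Sem-exs-copies : ∀ {fo so} {V : Fin (ctx so) → Subset (N g)} {W : Fin so → Subset (N h)} → SetRel V W →
                     ∀ (φ : Formula a b fo (C + ctx so)) {ρ} {P : Subset (N h) → Set} →
                     (∀ {V' S} → SetRel {suc so} V' (S VF.∷ W) → Sem g φ ρ V' ⇔ P S) →
                     Sem g (exs C φ) ρ V ⇔ ∃ P
    Sem-exs-copies r φ e = ⇔.trans (Sem-exs g C φ) (mk⇔
      (λ (V' , q , s) → let S , r' = pull r V' q in S , to (e r') s)
      (λ (S , s) → let V' , q , r' = push r S in V' , q , from (e r') s))

    Sem-bt : ∀ {fo so} {cp : Fin fo → Fin C} (φ : Formula a' b' fo so) {ρ ρ'}
             {V : Fin (ctx so) → Subset (N g)} {W : Fin so → Subset (N h)} →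
             NodeRel cp ρ ρ' → SetRel V W → Sem g (bt cp φ) ρ V ⇔ Sem h φ ρ' W

    Sem-bt {cp = cp} (labF σ x) {ρ} {ρ'} e r = ⇔.trans (Sem-nodeAt r (cp x) σ x)
      (subst (λ p → Nd T₁ g U p σ ⇔ lab h (ρ' x) ≡ σ) (e x) (f-lab (ρ' x) σ))
    Sem-bt {cp = cp} (edgeF γ x y) {ρ} {ρ'} e r = ⇔.trans
      (Sem-ren g _ _ (φedge (cp x) (cp y) γ) (λ { fzero → refl ; (fsuc fzero) → refl }) (agree r))
      (⇔.sym (subst₂ (λ p q → edge h (ρ' x) γ (ρ' y) ≡ true ⇔ Ed T₁ g U p γ q) (e x) (e y) (f-edge (ρ' x) γ (ρ' y))))
    Sem-bt {cp = cp} (eqF x y) {ρ} e r = mk⇔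
      (λ (c , p) → f-inj (trans (e x) (trans (cong₂ _,_ p (to (Sem-guard g (cp x ≟F cp y) {ρ}) c)) (≡sym (e y)))))
      (λ p → let q = trans (≡sym (e x)) (trans (cong f p) (e y)) in
         from (Sem-guard g (cp x ≟F cp y) {ρ}) (cong proj₂ q) , cong proj₁ q)
    Sem-bt {cp = cp} (memF x X) {ρ} {ρ'} {V} {W} e r =
      subst (λ p → lookupᵥ (V (slice X (proj₂ p))) (proj₁ p) ≡ true ⇔ lookupᵥ (W X) (ρ' x) ≡ true) (e x)
        (mk⇔ (trans (≡sym (cut r X (ρ' x)))) (trans (cut r X (ρ' x))))
    Sem-bt (¬F φ)   e r = ¬-⇔ (Sem-bt φ e r)
    Sem-bt (φ ∧F ψ) e r = Sem-bt φ e r ×-⇔ Sem-bt ψ e r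
    Sem-bt (φ ∨F ψ) e r = Sem-bt φ e r ⊎-⇔ Sem-bt ψ e r
    Sem-bt (∃₁ φ) e r = Sem-∃node r _ (λ p → Sem-bt φ (extend e p) r)
    Sem-bt (∀₁ φ) e r = ⇔.trans (¬-⇔ (Sem-∃node r _ (λ p → ¬-⇔ (Sem-bt φ (extend e p) r))))
      (⇔.sym (∀⇔¬∃¬ (λ j → Sem? h φ (j VF.∷ _) _)))
    Sem-bt (∃₂ φ) e r = Sem-exs-copies r _ (λ r' → Sem-bt φ e r')
    Sem-bt (∀₂ φ) e r = ⇔.trans (¬-⇔ (Sem-exs-copies r _ (λ r' → ¬-⇔ (Sem-bt φ e r'))))
        (⇔.sym (∀⇔¬∃¬ (λ S → Sem? h φ _ (S VF.∷ _))))

module _ {a b a' b' a'' b'' : ℕ} (T₁ : MSOT a b a' b') (T₂ : MSOT a' b' a'' b'') where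
  private
    module T₁ = MSOT T₁
    module T₂ = MSOT T₂
  open BackTranslation T₁

  copy₁ : Fin (T₁.C * T₂.C) → Fin T₁.C
  copy₁ c = proj₁ (remQuot {T₁.C} T₂.C c)

  copy₂ : Fin (T₁.C * T₂.C) → Fin T₂.C
  copy₂ c = proj₂ (remQuot {T₁.C} T₂.C c)

  composite : MSOT a b a'' b''
  composite = record
    { k     = ctx T₂.k
    ; φdom  = ren (λ ()) (par T₂.k) T₁.φdom ∧F bt (λ ()) T₂.φdom
    ; C     = T₁.C * T₂.C
    -- `Sem-bt` says nothing about pairs that are not nodes of the intermediate graph; `isNode`
    -- keeps them out of the output.
    ; φnode = λ c σ → isNode T₂.k (copy₁ c) fzero ∧F bt (copy₁ c VF.∷ VF.[]) (T₂.φnode (copy₂ c) σ)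
    ; φedge = λ c d γ → bt (copy₁ c VF.∷ (copy₁ d VF.∷ VF.[])) (T₂.φedge (copy₂ c) (copy₂ d) γ)
    }

  module _ {g : Graph a b} {U : Fin T₁.k → Subset (N g)} {h : Graph a' b'} (o : Out T₁ g U h) where
    private module o = Out o

    module _ {V : Fin (ctx T₂.k) → Subset (N g)} {W : Fin T₂.k → Subset (N h)} (r : SetRel o V W) where

      -- This relation is one-to-one, and the `isNode` conjunct makes every composite node lie over
      -- something. Outputs are carried along it in both directions.
      Over : Fin (N g) × Fin (T₁.C * T₂.C) → Fin (N h) × Fin T₂.C → Set
      Over (u , c) (j , d) = o.f j ≡ (u , copy₁ c) × copy₂ c ≡ d

      over : ∀ q → ∃ λ p → Over p q
      over (j , d) = (proj₁ (o.f j) , combine (proj₂ (o.f j)) d) ,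
        cong (proj₁ (o.f j) ,_) (≡sym (cong proj₁ e)) , cong proj₂ e
        where e = Finₚ.remQuot-combine {T₁.C} {T₂.C} (proj₂ (o.f j)) d

      copies-injective : ∀ {c c'} → copy₁ c ≡ copy₁ c' → copy₂ c ≡ copy₂ c' → c ≡ c'
      copies-injective {c} {c'} e e' = trans (≡sym (Finₚ.combine-remQuot {T₁.C} T₂.C c))
        (trans (cong₂ combine e e') (Finₚ.combine-remQuot {T₁.C} T₂.C c'))

      Over-injective : ∀ {p q p' q'} → Over p q → Over p' q' → p ≡ p' → q ≡ q'
      Over-injective (e , refl) (e' , refl) refl = cong (_, _) (o.f-inj (trans e (≡sym e')))

      Over-functional : ∀ {p q p' q'} → Over p q → Over p' q' → q ≡ q' → p ≡ p'
      Over-functional (e , refl) (e' , d) refl = let p = trans (≡sym e) e' in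
        cong₂ _,_ (cong proj₁ p) (copies-injective (cong proj₂ p) (≡sym d))

      Nd-comp : ∀ {p q} → Over p q → ∀ σ → Nd composite g V p σ ⇔ Nd T₂ h W q σ
      Nd-comp {u , c} {j , _} (e , refl) σ = mk⇔
        (λ (_ , s) → to bt⇔ s)
        (λ s → from (Sem-isNode o r (copy₁ c) fzero {u VF.∷ VF.[]})
            (lab h j , subst (λ p → Labelled T₁ g U p (lab h j)) e (o.f-lab j))
             , from bt⇔ s)
        where bt⇔ = Sem-bt o {cp = copy₁ c VF.∷ VF.[]} (T₂.φnode (copy₂ c) σ) {u VF.∷ VF.[]} {j VF.∷ VF.[]} (λ { fzero → e }) r

      Ed-comp : ∀ {p q p' q'} → Over p q → Over p' q' → ∀ γ → Ed composite g V p γ p' ⇔ Ed T₂ h W q γ q'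
      Ed-comp {u , c} {j , _} {u' , c'} {j' , _} (e , refl) (e' , refl) γ =
        Sem-bt o (T₂.φedge (copy₂ c) (copy₂ c') γ) {ρ' = j VF.∷ (j' VF.∷ VF.[])} (λ { fzero → e ; (fsuc fzero) → e' }) r

      Nd-over : ∀ {p σ} → Nd composite g V p σ → ∃ λ q → Over p q
      Nd-over {u , c} (n , _) = let σ , l = to (Sem-isNode o r (copy₁ c) fzero) n ; j , e = o.f-surj _ σ l in (j , copy₂ c) , e , refl

      module _ {k : Graph a'' b''} where

        Out-comp : Out T₂ h W k → Out composite g V k
        Out-comp p = record
          { f = λ i → proj₁ (over (p.f i))
          ; f-inj = λ {i} {i'} e → p.f-inj (Over-injective (O i) (O i') e)
          ; f-surj = λ q σ l →
              let q' , O' = Nd-over (from (l σ) refl)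
                  i , e = p.f-surj q' σ (λ σ' → ⇔.trans (⇔.sym (Nd-comp O' σ')) (l σ'))
              in i , Over-functional (O i) O' e
          ; f-lab = λ i σ → ⇔.trans (Nd-comp (O i) σ) (p.f-lab i σ)
          ; f-edge = λ i γ j → ⇔.trans (p.f-edge i γ j) (⇔.sym (Ed-comp (O i) (O j) γ)) }
          where
          module p = Out p
          O : ∀ i → Over (proj₁ (over (p.f i))) (p.f i)
          O i = proj₂ (over (p.f i))

        comp-Out : Out composite g V k → Out T₂ h W k
        comp-Out p = record
          { f = λ i → proj₁ (over' i)
          ; f-inj = λ {i} {i'} e → p.f-inj (Over-functional (O i) (O i') e)
          ; f-surj = λ q σ l →
              let q' , O' = over q
                  i , e = p.f-surj q' σ (λ σ' → ⇔.trans (Nd-comp O' σ') (l σ'))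
              in i , Over-injective (O i) O' e
          ; f-lab = λ i σ → ⇔.trans (⇔.sym (Nd-comp (O i) σ)) (p.f-lab i σ)
          ; f-edge = λ i γ j → ⇔.trans (p.f-edge i γ j) (Ed-comp (O i) (O j) γ) }
          where
          module p = Out p
          over' : ∀ i → ∃ λ q → Over (p.f i) q
          over' i = Nd-over (from (p.f-lab i (lab k i)) refl)
          O : ∀ i → Over (p.f i) (proj₁ (over' i))
          O i = proj₂ (over' i)

    Sem-dom : ∀ {V W} → SetRel o V W → Sem g T₁.φdom VF.[] U → Sem h T₂.φdom VF.[] W → Sem g
        (MSOT.φdom composite) VF.[] V
    Sem-dom r s t = from (Sem-ren g _ _ T₁.φdom (λ ()) (SetRel.agree r)) s , from (Sem-bt o T₂.φdom (λ ()) r) t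

    pushAll : ∀ {n} (W : Fin n → Subset (N h)) → ∃ λ V → SetRel o V W
    pushAll {zero}  W = U , record { agree = λ _ → refl ; cut = λ () }
    pushAll {suc n} W =
      let V , r = pushAll (W ∘ fsuc) ; V' , _ , r' = push o r (W fzero)
      in V' , record { agree = SetRel.agree r' ; cut = λ { fzero → SetRel.cut r' fzero ; (fsuc X) → SetRel.cut r' (fsuc X) } }

    pullAll : ∀ {n} (V : Fin (ctx n) → Subset (N g)) → (∀ i → V (par n i) ≡ U i) → ∃ λ W → SetRel o {n} V W
    pullAll {zero}  V e = (λ ()) , record { agree = e ; cut = λ () }
    pullAll {suc n} V e =
      let W , r = pullAll {n} (V ∘ (T₁.C ↑ʳ_)) e ; S , r' = pull o r V (λ _ → refl) in S VF.∷ W , r'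

  -- Abstract, to keep iterated compositions from being unfolded.
  abstract
    comp : MSOT a b a'' b''
    comp = composite

    comp-complete : ∀ {g h k} → T₁ ⊨ g ↦ h → T₂ ⊨ h ↦ k → comp ⊨ g ↦ k
    comp-complete (U , s , o) (W , t , p) = let V , r = pushAll o W in V , Sem-dom o r s t , Out-comp o r p

    -- The graph found by `Out-exists` comes in an arbitrary enumeration. Quantifying over its
    -- isomorphic copies lets the next step continue from a canonical graph.
    comp-sound : ∀ {g k} → comp ⊨ g ↦ k → ∃ λ h → T₁ ⊨ g ↦ h × (∀ h' → Iso h h' → T₂ ⊨ h' ↦ k)
    comp-sound {g} {k} (V , (s , t) , p) = h , (U , s₁ , o) , λ h' i → second (Out-≅ o i)
      where
      U : Fin T₁.k → Subset (N g)
      U = V ∘ par T₂.k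
      s₁ : Sem g T₁.φdom VF.[] U
      s₁ = to (Sem-ren g _ _ T₁.φdom (λ ()) (λ _ → refl)) s
      h : Graph a' b'
      h = proj₁ (Out-exists {T = T₁} {g} {U})
      o : Out T₁ g U h
      o = proj₂ (Out-exists {T = T₁} {g} {U})
      second : ∀ {h'} → Out T₁ g U h' → T₂ ⊨ h' ↦ k
      second o' = let W , r = pullAll o' V (λ _ → refl) in W , to (Sem-bt o' T₂.φdom (λ ()) r) t , comp-Out o' r p

-- Path graphs

≡ᵇ⇔ : ∀ m n → (m ≡ᵇ n) ≡ true ⇔ m ≡ n
≡ᵇ⇔ zero    zero    = mk⇔ (λ _ → refl) (λ _ → refl)
≡ᵇ⇔ zero    (suc n) = mk⇔ (λ ()) (λ ())
≡ᵇ⇔ (suc m) zero    = mk⇔ (λ ()) (λ ())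
≡ᵇ⇔ (suc m) (suc n) = mk⇔ (cong suc ∘ to (≡ᵇ⇔ m n)) (from (≡ᵇ⇔ m n) ∘ ℕₚ.suc-injective)

at-lookup : ∀ {A : Set} (xs : List A) (i : Fin (length xs)) → at xs (toℕ i) ≡ just (List.lookup xs i)
at-lookup (x ∷ xs) fzero    = refl
at-lookup (x ∷ xs) (fsuc i) = at-lookup xs i

at-≥ : ∀ {A : Set} (xs : List A) {i} → length xs ≤ i → at xs i ≡ nothing
at-≥ []       _       = refl
at-≥ (x ∷ xs) (s≤s p) = at-≥ xs p

at-just⇒< : ∀ {A : Set} (xs : List A) {i x} → at xs i ≡ just x → i < length xs
at-just⇒< (x ∷ xs) {zero}  e = s≤s z≤n
at-just⇒< (x ∷ xs) {suc i} e = s≤s (at-just⇒< xs e)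

at-map : ∀ {A B : Set} (f : A → B) (xs : List A) i → at (map f xs) i ≡ Data.Maybe.map f (at xs i)
at-map f []       i       = refl
at-map f (x ∷ xs) zero    = refl
at-map f (x ∷ xs) (suc i) = at-map f xs i

at-++ˡ : ∀ {A : Set} (xs ys : List A) {i} → i < length xs → at (xs ++ ys) i ≡ at xs i
at-++ˡ (x ∷ xs) ys {zero}  p       = refl
at-++ˡ (x ∷ xs) ys {suc i} (s≤s p) = at-++ˡ xs ys p

at-++ʳ : ∀ {A : Set} (xs ys : List A) i → at (xs ++ ys) (length xs + i) ≡ at ys i
at-++ʳ []       ys i = refl
at-++ʳ (x ∷ xs) ys i = at-++ʳ xs ys i

-- The list may carry more than the labels, such as the cell and slot of a visit; `lbl` forgets the
-- surplus.
pathG : ∀ {A : Set} {a} → (A → Fin a) → List A → Graph a 1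
pathG lbl K = record
  { N    = length K
  ; lab  = lbl ∘ List.lookup K
  ; edge = λ u _ v → suc (toℕ u) ≡ᵇ toℕ v }

pgr : ∀ {a} → List (Fin a) → Graph a 1
pgr = pathG id

pathG-≅ : ∀ {A : Set} {a} (lbl : A → Fin a) K {v} → map lbl K ≡ v → Iso (pathG lbl K) (pgr v)
pathG-≅ lbl K refl = record
  { f = c
  ; f-inj = λ {i} {j} p → Finₚ.toℕ-injective (trans (≡sym (toℕ-c i)) (trans (cong toℕ p) (toℕ-c j)))
  ; f-surj = λ j → Fin.cast (Listₚ.length-map lbl K) j , Finₚ.cast-involutive (≡sym (Listₚ.length-map lbl K))
      (Listₚ.length-map lbl K) j
  ; f-lab = λ i → Maybeₚ.just-injective (trans (≡sym (at-lookup (map lbl K) (c i)))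
      (trans (cong (at (map lbl K)) (toℕ-c i))
          (trans (at-map lbl K (toℕ i)) (cong (Data.Maybe.map lbl) (at-lookup K i)))))
  ; f-edge = λ i _ j → subst₂ (λ m n → (suc m ≡ᵇ n) ≡ true ⇔ (suc (toℕ i) ≡ᵇ toℕ j) ≡ true) (≡sym (toℕ-c i))
      (≡sym (toℕ-c j)) ⇔.refl
  }
  where
  c : Fin (length K) → Fin (length (map lbl K))
  c = Fin.cast (≡sym (Listₚ.length-map lbl K))
  toℕ-c : ∀ i → toℕ (c i) ≡ toℕ i
  toℕ-c = Finₚ.toℕ-cast _

egr-edge⇔ : ∀ {n} (w : List (Fin n)) i γ j → edge (egr w) i γ j ≡ true ⇔ (suc (toℕ i) ≡ toℕ j × at w (toℕ i) ≡ just γ)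
egr-edge⇔ w i γ j with at w (toℕ i)
... | just x  = ⇔.trans (∧⇔ _ _)
    (≡ᵇ⇔ (suc (toℕ i)) (toℕ j) ×-⇔ ⇔.trans (⌊⌋⇔ (x ≟F γ)) (mk⇔ (cong just) Maybeₚ.just-injective))
... | nothing = ⇔.trans (∧⇔ _ _) (≡ᵇ⇔ (suc (toℕ i)) (toℕ j) ×-⇔ mk⇔ (λ ()) (λ ()))

-- A filter by a closed formula. Since it relates a graph to all its isomorphic copies, placing it
-- in front also closes a transduction under isomorphism of the input.
idT : ∀ {a b} → Formula a b 0 0 → MSOT a b a b
idT ψ = record { k = 0 ; φdom = ψ ; C = 1 ; φnode = λ _ σ → labF σ fzero ; φedge = λ _ _ γ → edgeF γ fzero
    (fsuc fzero) }

module _ {a b} {ψ : Formula a b 0 0} {g : Graph a b} where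

  Out-id : ∀ {U} → Out (idT ψ) g U g
  Out-id = record
    { f = _, fzero ; f-inj = cong proj₁ ; f-surj = λ { (u , fzero) σ l → u , refl }
    ; f-lab = λ i σ → ⇔.refl ; f-edge = λ i γ j → ⇔.refl }

  idT-complete : ∀ {h} → Sem g ψ VF.[] VF.[] → Iso g h → idT ψ ⊨ g ↦ h
  idT-complete s i = VF.[] , s , Out-≅ Out-id i

  idT-sound : ∀ {h} → idT ψ ⊨ g ↦ h → Sem g ψ VF.[] VF.[] × Iso g h
  idT-sound (U , s , o) = to (Sem-ext g ψ (λ ()) (λ ())) s , Out-unique Out-id o

Adj : ∀ {a b} (g : Graph a b) → Fin (N g) → Fin (N g) → Set
Adj g u v = ∃ λ γ → edge g u γ v ≡ true

adjF : ∀ {a b fo so} → Fin fo → Fin fo → Formula a b fo so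
adjF x y = ⋁ λ γ → edgeF γ x y

Sem-adjF : ∀ {a b fo so} (g : Graph a b) x y {ρ : Fin fo → _} {U} → Sem g (adjF {so = so} x y) ρ U ⇔ Adj g (ρ x) (ρ y)
Sem-adjF g x y = Sem-⋁ g _

pattern 0F = fzero
pattern 1F = fsuc fzero
pattern 2F = fsuc (fsuc fzero)

-- The nodes are enumerated backwards from the end node, so reachability is stated against the edges.
record IsPath {a b} (g : Graph a b) : Set where
  field
    functional : ∀ {u v v'} → Adj g u v → Adj g u v' → v ≡ v'
    injective  : ∀ {u u' v} → Adj g u v → Adj g u' v → u ≡ u'
    letter     : ∀ {u v γ γ'} → edge g u γ v ≡ true → edge g u γ' v ≡ true → γ ≡ γ'
    end        : Fin (N g)
    end-last   : ∀ {v} → ¬ Adj g end v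
    reaches    : ∀ (S : Subset (N g)) → lookupᵥ S end ≡ true →
                 (∀ u v → lookupᵥ S v ≡ true × Adj g u v → lookupᵥ S u ≡ true) → ∀ u → lookupᵥ S u ≡ true

-- Reachability of the end is not first-order: `reachF` asks that every set which contains the node
-- and is closed under predecessors be everything. In a context without the variable that `closedF`
-- or `reachF` speaks about, `⊤F` is a dummy value.
closedF reachF isPathF functionalF injectiveF letterF : ∀ {a b fo so} → Formula a b fo so
closedF {so = zero}  = ⊤F
closedF {so = suc _} = ∀₁ (∀₁ ((memF 0F 0F ∧F adjF 1F 0F) ⇒F memF 1F 0F))
reachF {fo = zero}   = ⊤F
reachF {fo = suc _}  = ∀₂ (memF 0F 0F ⇒F (closedF ⇒F ∀₁ (memF 0F 0F)))
functionalF = ∀₁ (∀₁ (∀₁ ((adjF 2F 1F ∧F adjF 2F 0F) ⇒F eqF 1F 0F)))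
injectiveF  = ∀₁ (∀₁ (∀₁ ((adjF 2F 0F ∧F adjF 1F 0F) ⇒F eqF 2F 1F)))
letterF     = ∀₁ (∀₁ (⋀ λ γ → ⋀ λ γ' → (edgeF γ 1F 0F ∧F edgeF γ' 1F 0F) ⇒F guard (γ ≟F γ')))
isPathF = functionalF ∧F (injectiveF ∧F (letterF ∧F ∃₁ ((¬F (∃₁ (adjF 1F 0F))) ∧F reachF)))

→-⇔ : ∀ {A B A' B' : Set} → A ⇔ A' → B ⇔ B' → (A → B) ⇔ (A' → B')
→-⇔ e e' = mk⇔ (λ f → to e' ∘ f ∘ from e) (λ f → from e' ∘ f ∘ to e)

-- Sem is a function and so blocks unification; the record exposes φ, ρ and U to it.
record Means {a b fo so} (g : Graph a b) (ρ : Fin fo → Fin (N g)) (U : Fin so → Subset (N g))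
             (φ : Formula a b fo so) (P : Set) : Set where
  constructor means
  field sem : Sem g φ ρ U ⇔ P
open Means

module _ {a b fo so} {g : Graph a b} {ρ : Fin fo → Fin (N g)} {U : Fin so → Subset (N g)} where

  m-id : ∀ {φ} → Means g ρ U φ (Sem g φ ρ U)
  m-id = means ⇔.refl

  m-⇔ : ∀ {φ P Q} → Means g ρ U φ P → P ⇔ Q → Means g ρ U φ Q
  m-⇔ (means e) e' = means (⇔.trans e e')

  infixr 2 _m∧_
  infixr 1 _m∨_ _m⇒_
  _m∧_ : ∀ {φ ψ P Q} → Means g ρ U φ P → Means g ρ U ψ Q → Means g ρ U (φ ∧F ψ) (P × Q)
  means e m∧ means e' = means (e ×-⇔ e')

  _m∨_ : ∀ {φ ψ P Q} → Means g ρ U φ P → Means g ρ U ψ Q → Means g ρ U (φ ∨F ψ) (P ⊎ Q)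
  means e m∨ means e' = means (e ⊎-⇔ e')

  _m⇒_ : ∀ {φ ψ P Q} → Means g ρ U φ P → Means g ρ U ψ Q → Means g ρ U (φ ⇒F ψ) (P → Q)
  _m⇒_ {φ} {ψ} (means e) (means e') = means (⇔.trans (Sem-⇒ g φ ψ) (→-⇔ e e'))

  m¬ : ∀ {φ P} → Means g ρ U φ P → Means g ρ U (¬F φ) (¬ P)
  m¬ (means e) = means (¬-⇔ e)

  m∃ : ∀ {φ P} → (∀ u → Means g (u VF.∷ ρ) U φ (P u)) → Means g ρ U (∃₁ φ) (∃ P)
  m∃ e = means (∃-⇔ (sem ∘ e))

  m∀ : ∀ {φ} {P : Fin (N g) → Set} → (∀ u → Means g (u VF.∷ ρ) U φ (P u)) → Means g ρ U (∀₁ φ) (∀ u → P u)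
  m∀ e = means (∀-⇔ (sem ∘ e))

  m∀₂ : ∀ {φ} {P : Subset (N g) → Set} → (∀ S → Means g ρ (S VF.∷ U) φ (P S)) → Means g ρ U (∀₂ φ) (∀ S → P S)
  m∀₂ e = means (∀-⇔ (sem ∘ e))

  m⋁ : ∀ {n} {φ : Fin n → Formula a b fo so} {P : Fin n → Set} → (∀ i → Means g ρ U (φ i) (P i)) → Means g ρ U
      (⋁ φ) (∃ P)
  m⋁ {φ = φ} e = means (⇔.trans (Sem-⋁ g φ) (∃-⇔ (sem ∘ e)))

  m⋀ : ∀ {n} {φ : Fin n → Formula a b fo so} {P : Fin n → Set} → (∀ i → Means g ρ U (φ i) (P i)) → Means g ρ U
      (⋀ φ) (∀ i → P i)
  m⋀ {φ = φ} e = means (⇔.trans (Sem-⋀ g φ) (∀-⇔ (sem ∘ e)))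

  m-guard : ∀ {P : Set} {d : Dec P} → Means g ρ U (guard d) P
  m-guard {d = d} = means (Sem-guard g d)

  m-⊥ : Means g ρ U ⊥F ⊥
  m-⊥ = means (mk⇔ (⊥F-elim g ρ U) ⊥-elim)

  m-adj : ∀ {x y} → Means g ρ U (adjF x y) (Adj g (ρ x) (ρ y))
  m-adj {x} {y} = means (Sem-adjF g x y)

module _ {a b} (g : Graph a b) where

  ClosedUnderPred : Subset (N g) → Set
  ClosedUnderPred S = ∀ u v → lookupᵥ S v ≡ true × Adj g u v → lookupᵥ S u ≡ true

  m-reachF : ∀ {fo} {ρ : Fin (suc fo) → Fin (N g)} → Means g ρ VF.[] reachF
    (∀ S → lookupᵥ S (ρ 0F) ≡ true → ClosedUnderPred S → ∀ u → lookupᵥ S u ≡ true)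
  m-reachF = m∀₂ λ S → m-id m⇒ (m∀ λ u → m∀ λ v → (m-id m∧ m-adj) m⇒ m-id) m⇒ (m∀ λ u → m-id)

  m-functionalF : Means g VF.[] VF.[] functionalF (∀ u v v' → Adj g u v × Adj g u v' → v ≡ v')
  m-functionalF = m∀ λ u → m∀ λ v → m∀ λ v' → (m-adj m∧ m-adj) m⇒ m-id

  m-injectiveF : Means g VF.[] VF.[] injectiveF (∀ u u' v → Adj g u v × Adj g u' v → u ≡ u')
  m-injectiveF = m∀ λ u → m∀ λ u' → m∀ λ v → (m-adj m∧ m-adj) m⇒ m-id

  m-letterF : Means g VF.[] VF.[] letterF (∀ u v γ γ' → edge g u γ v ≡ true × edge g u γ' v ≡ true → γ ≡ γ')
  m-letterF = m∀ λ u → m∀ λ v → m⋀ λ γ → m⋀ λ γ' → (m-id m∧ m-id) m⇒ m-guard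

  m-isPathF : Means g VF.[] VF.[] isPathF (IsPath g)
  m-isPathF = m-⇔ (m-functionalF m∧ m-injectiveF m∧ m-letterF m∧ m∃ λ u → m¬ (m∃ λ v → m-adj) m∧ m-reachF) (mk⇔
    (λ (f , i , l , e , n , r) → record
      { functional = λ p q → f _ _ _ (p , q)
      ; injective = λ p q → i _ _ _ (p , q)
      ; letter = λ p q → l _ _ _ _ (p , q)
      ; end = e
      ; end-last = λ {v} p → n (v , p)
      ; reaches = r })
    (λ p → (λ _ _ _ (q , r) → IsPath.functional p q r)
         , (λ _ _ _ (q , r) → IsPath.injective p q r)
         , (λ _ _ _ _ (q , r) → IsPath.letter p q r)
         , IsPath.end p
         , (λ (v , s) → IsPath.end-last p s)
         , IsPath.reaches p))

  -- For `reaches`, membership travels against the edges from the last node, by induction on the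
  -- distance to it.
  consecutive⇒IsPath : ∀ {n} → N g ≡ suc n → (∀ u v → Adj g u v ⇔ suc (toℕ u) ≡ toℕ v) →
    (∀ {u v γ γ'} → edge g u γ v ≡ true → edge g u γ' v ≡ true → γ ≡ γ') → IsPath g
  consecutive⇒IsPath {n} eq e l = record
    { functional = λ p q → Finₚ.toℕ-injective (trans (≡sym (to (e _ _) p)) (to (e _ _) q))
    ; injective = λ p q → Finₚ.toℕ-injective (ℕₚ.suc-injective (trans (to (e _ _) p) (≡sym (to (e _ _) q))))
    ; letter = l
    ; end = last
    ; end-last = λ {v} p → ℕₚ.<⇒≢ (Finₚ.toℕ<n v) (trans (≡sym (to (e _ _) p)) (trans (cong suc toℕ-last) (≡sym eq)))
    ; reaches = λ S s c u → down S s c (n ∸ toℕ u) u (ℕₚ.m+[n∸m]≡n (ℕₚ.≤-pred (subst (toℕ u <_) eq (Finₚ.toℕ<n u)))) }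
    where
    last : Fin (N g)
    last = Fin.cast (≡sym eq) (Fin.fromℕ n)
    toℕ-last : toℕ last ≡ n
    toℕ-last = trans (Finₚ.toℕ-cast _ (Fin.fromℕ n)) (Finₚ.toℕ-fromℕ n)
    down : ∀ S → lookupᵥ S last ≡ true → (∀ u v → lookupᵥ S v ≡ true × Adj g u v → lookupᵥ S u ≡ true) →
           ∀ d u → toℕ u + d ≡ n → lookupᵥ S u ≡ true
    down S s c zero u p = subst (λ u → lookupᵥ S u ≡ true)
        (Finₚ.toℕ-injective (trans toℕ-last (trans (≡sym p) (ℕₚ.+-identityʳ _)))) s
    down S s c (suc d) u p = c u v (down S s c d v (trans (cong (_+ d) toℕ-v) p') , from (e u v) (≡sym toℕ-v))
      where
      p' : suc (toℕ u) + d ≡ n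
      p' = trans (≡sym (ℕₚ.+-suc _ d)) p
      u< : suc (toℕ u) < N g
      u< = subst (suc (toℕ u) <_) (≡sym eq) (s≤s (subst (suc (toℕ u) ≤_) p' (ℕₚ.m≤m+n _ d)))
      v : Fin (N g)
      v = fromℕ< u<
      toℕ-v : toℕ v ≡ suc (toℕ u)
      toℕ-v = Finₚ.toℕ-fromℕ< u<

length≤ : ∀ {n} {K : List (Fin n)} → Unique K → length K ≤ n
length≤ u = Finₚ.injective⇒≤ (λ {i} {j} → lookup-injective u i j)

module Enumeration {a b} {g : Graph a b} (path : IsPath g) where
  open IsPath path

  data Chain : Fin (N g) → List (Fin (N g)) → List (Fin b) → Set where
    stop : Chain end [] []
    _◅_  : ∀ {u v γ K w} → edge g u γ v ≡ true → Chain v K w → Chain u (v ∷ K) (γ ∷ w)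

  chain-pred : ∀ {u K w x} → Chain u K w → x ∈ K → ∃ λ y → y ∈ (u ∷ K) × Adj g y x
  chain-pred (e ◅ c) (here refl) = _ , here refl , _ , e
  chain-pred (e ◅ c) (there x∈) = let y , y∈ , p = chain-pred c x∈ in y , there y∈ , p

  chain-succ : ∀ {u K w x} → Chain u K w → x ∈ (u ∷ K) → x ≡ end ⊎ ∃ λ y → y ∈ K × Adj g x y
  chain-succ stop (here refl) = inj₁ refl
  chain-succ (e ◅ c) (here refl) = inj₂ (_ , here refl , _ , e)
  chain-succ (e ◅ c) (there x∈) with chain-succ c x∈
  ... | inj₁ p = inj₁ p
  ... | inj₂ (y , y∈ , p) = inj₂ (y , there y∈ , p)

  -- A repetition of the head v would give v a successor inside the tail, hence repeat u there.
  fresh : ∀ {u v γ K w} → Unique (v ∷ K) → edge g u γ v ≡ true → Chain v K w → ¬ u ∈ (v ∷ K)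
  fresh (n ∷ _) e c u∈ with chain-succ c u∈
  ... | inj₁ refl = end-last (_ , e)
  ... | inj₂ (y , y∈ , p) = All.lookup n y∈ (functional (_ , e) p)

  chain-unique : ∀ {u K w} → Chain u K w → Unique (u ∷ K)
  chain-unique stop = [] ∷ []
  chain-unique (e ◅ c) = let u = chain-unique c in
    All.tabulate (λ x∈ p → fresh u e c (subst (_∈ _) (≡sym p) x∈)) ∷ u

  -- Predecessors are prepended until there is none. A chain has no repetition, so running out of
  -- fuel would give it more than `N g` nodes.
  grow : ∀ fuel {u K w} → Chain u K w → N g < fuel + length (u ∷ K) →
         ∃ λ s → ∃ λ K → ∃ λ w → Chain s K w × (∀ {v} → ¬ Adj g v s)
  grow zero c p = ⊥-elim (ℕₚ.<⇒≱ p (length≤ (chain-unique c)))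
  grow (suc fuel) {u} {K} c p with Finₚ.any? (λ v → Finₚ.any? λ γ → edge g v γ u ≟B true)
  ... | yes (v , γ , e) = grow fuel (e ◅ c) (subst (N g <_) (≡sym (ℕₚ.+-suc fuel _)) p)
  ... | no n = _ , _ , _ , c , λ {v} p → n (v , p)

  private
    full : ∃ λ s → ∃ λ K → ∃ λ w → Chain s K w × (∀ {v} → ¬ Adj g v s)
    full = grow (N g) stop (subst (N g <_) (ℕₚ.+-comm 1 (N g)) ℕₚ.≤-refl)

  start : Fin (N g)
  start = proj₁ full

  rest : List (Fin (N g))
  rest = proj₁ (proj₂ full)

  nodes : List (Fin (N g))
  nodes = start ∷ rest

  word : List (Fin b)
  word = proj₁ (proj₂ (proj₂ full))

  chain : Chain start rest word
  chain = proj₁ (proj₂ (proj₂ (proj₂ full)))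

  start-first : ∀ {v} → ¬ Adj g v start
  start-first = proj₂ (proj₂ (proj₂ (proj₂ full)))

  end∈ : ∀ {u K w} → Chain u K w → end ∈ (u ∷ K)
  end∈ stop = here refl
  end∈ (e ◅ c) = there (end∈ c)

  -- The enumerated set contains the end and is closed under predecessors: `start` has none, and by
  -- injectivity any other node has only its neighbour in the chain. So `reaches` applies to it.
  ∈nodes : ∀ u → u ∈ nodes
  ∈nodes u = to (in⇔ u) (reaches S (from (in⇔ end) (end∈ chain)) closed u)
    where
    in? : Decidable (_∈ nodes)
    in? u = Any.any? (u ≟F_) nodes
    S = mkSubset in?
    in⇔ : ∀ u → lookupᵥ S u ≡ true ⇔ u ∈ nodes
    in⇔ = ∈mkSubset in?
    closed : ∀ u v → lookupᵥ S v ≡ true × Adj g u v → lookupᵥ S u ≡ true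
    closed u v (s , p) with to (in⇔ v) s
    ... | here refl = ⊥-elim (start-first p)
    ... | there v∈ with chain-pred chain v∈
    ... | y , y∈ , q = from (in⇔ u) (subst (_∈ nodes) (injective q p) y∈)

  chain-edge : ∀ {u K w} → Chain u K w → ∀ i j → suc (toℕ i) ≡ toℕ j →
               ∃ λ γ → at w (toℕ i) ≡ just γ × edge g (List.lookup (u ∷ K) i) γ (List.lookup (u ∷ K) j) ≡ true
  chain-edge (e ◅ c) fzero (fsuc fzero) p = _ , refl , e
  chain-edge (e ◅ c) (fsuc i) (fsuc j) p = chain-edge c i j (ℕₚ.suc-injective p)

  chain-end : ∀ {u K w} → Chain u K w → ∀ i → suc (toℕ i) ≡ length (u ∷ K) → List.lookup (u ∷ K) i ≡ end
  chain-end stop fzero p = refl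
  chain-end (e ◅ c) (fsuc i) p = chain-end c i (ℕₚ.suc-injective p)

  length-word : ∀ {u K w} → Chain u K w → length w ≡ length K
  length-word stop = refl
  length-word (e ◅ c) = cong suc (length-word c)

  nth : Fin (length nodes) → Fin (N g)
  nth = List.lookup nodes

  nth-injective : ∀ {i j} → nth i ≡ nth j → i ≡ j
  nth-injective {i} {j} = lookup-injective (chain-unique chain) i j

  -- By functionality an edge of the graph is the one that the chain already uses at its source, and
  -- `letter` fixes its label; the end has no outgoing edge.
  edge⇔ : ∀ i γ j → edge g (nth i) γ (nth j) ≡ true ⇔ (suc (toℕ i) ≡ toℕ j × at word (toℕ i) ≡ just γ)
  edge⇔ i γ j = mk⇔ fwd (λ (p , q) → let γ' , q' , e = chain-edge chain i j p in
      subst (λ γ → edge g (nth i) γ (nth j) ≡ true) (Maybeₚ.just-injective (trans (≡sym q') q)) e)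
    where
    fwd : edge g (nth i) γ (nth j) ≡ true → suc (toℕ i) ≡ toℕ j × at word (toℕ i) ≡ just γ
    fwd e with suc (toℕ i) ℕₚ.<? length nodes
    ... | no ¬p = ⊥-elim (end-last (γ , subst (λ u → edge g u γ (nth j) ≡ true)
                    (chain-end chain i (ℕₚ.≤-antisym (Finₚ.toℕ<n i) (ℕₚ.≮⇒≥ ¬p))) e))
    ... | yes p with chain-edge chain i (fromℕ< p) (≡sym (Finₚ.toℕ-fromℕ< p))
    ... | γ' , q , e' with nth-injective {fromℕ< p} {j} (functional (γ' , e') (γ , e))
    ... | refl = ≡sym (Finₚ.toℕ-fromℕ< p) , trans q (cong just (letter e' e))

-- Nodes of an egr graph all carry the same label, so an edge-labelled path is an egr graph ...
isPath⇒egr : ∀ {n} {g : Graph 1 n} → IsPath g → ∃ λ w → Iso (egr w) g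
isPath⇒egr {n} {g} path = word , record
  { f = nth ∘ c
  ; f-inj = λ {i} {j} p → Finₚ.toℕ-injective (trans (≡sym (toℕ-c i)) (trans (cong toℕ (nth-injective {c i} {c j} p)) (toℕ-c j)))
  ; f-surj = λ u → Fin.cast (≡sym len) (Any.index (∈nodes u)) ,
      trans (cong nth (Finₚ.cast-involutive len (≡sym len) (Any.index (∈nodes u))))
          (≡sym (Anyₚ.lookup-index (∈nodes u)))
  ; f-lab = λ i → all-zero _
  ; f-edge = λ i γ j → ⇔.trans (edge⇔ (c i) γ (c j)) (⇔.trans
      (subst₂ (λ x y → (suc x ≡ y × at word x ≡ just γ) ⇔ (suc (toℕ i) ≡ toℕ j × at word (toℕ i) ≡ just γ))
          (≡sym (toℕ-c i)) (≡sym (toℕ-c j)) ⇔.refl)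
      (⇔.sym (egr-edge⇔ word i γ j))) }
  where
  open Enumeration path
  len : suc (length word) ≡ length nodes
  len = cong suc (length-word chain)
  c : Fin (suc (length word)) → Fin (length nodes)
  c = Fin.cast len
  toℕ-c : ∀ i → toℕ (c i) ≡ toℕ i
  toℕ-c = Finₚ.toℕ-cast len
  all-zero : ∀ (i : Fin 1) → i ≡ fzero
  all-zero fzero = refl

-- ... and dually for graphs with a single edge letter.
isPath⇒pathG : ∀ {a} {g : Graph a 1} → IsPath g → ∃ λ u → ∃ λ K → Iso (pathG (lab g) (u ∷ K)) g
isPath⇒pathG {a} {g} path = start , rest , record
  { f = nth
  ; f-inj = λ {i} {j} → nth-injective {i} {j}
  ; f-surj = λ u → Any.index (∈nodes u) , ≡sym (Anyₚ.lookup-index (∈nodes u))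
  ; f-lab = λ i → refl
  ; f-edge = λ { i 0F j → ⇔.trans (edge⇔ i 0F j) (mk⇔ (from (≡ᵇ⇔ (suc (toℕ i)) (toℕ j)) ∘ proj₁)
       (λ e → let p = to (≡ᵇ⇔ (suc (toℕ i)) (toℕ j)) e in p , letter-at (chain-edge chain i j p))) } }
  where
  open Enumeration path
  letter-at : ∀ {i u v} → (∃ λ γ → at word i ≡ just γ × edge g u γ v ≡ true) → at word i ≡ just 0F
  letter-at (0F , p , _) = p

IsPath-egr : ∀ {n} (w : List (Fin n)) → IsPath (egr w)
IsPath-egr w = consecutive⇒IsPath (egr w) refl
  (λ u v → mk⇔ (λ (γ , e) → proj₁ (to (egr-edge⇔ w u γ v) e)) λ p → letter-of u v p)
  (λ {u} {v} {γ} {γ'} p q → Maybeₚ.just-injective (trans (≡sym (proj₂ (to (egr-edge⇔ w u γ v) p))) (proj₂ (to (egr-edge⇔ w u γ' v) q))))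
  where
  letter-of : ∀ u v → suc (toℕ u) ≡ toℕ v → Adj (egr w) u v
  letter-of u v p = _ , from (egr-edge⇔ w u _ v)
      (p , trans (cong (at w) (≡sym (Finₚ.toℕ-fromℕ< u<))) (at-lookup w (fromℕ< u<)))
    where
    u< : toℕ u < length w
    u< = ℕₚ.≤-pred (subst (_< suc (length w)) (≡sym p) (Finₚ.toℕ<n v))

IsPath-pathG : ∀ {A : Set} {a} (lbl : A → Fin a) x K → IsPath (pathG lbl (x ∷ K))
IsPath-pathG lbl x K = consecutive⇒IsPath (pathG lbl (x ∷ K)) refl
  (λ u v → mk⇔ (λ (_ , e) → to (≡ᵇ⇔ (suc (toℕ u)) (toℕ v)) e) (λ p → 0F , from (≡ᵇ⇔ (suc (toℕ u)) (toℕ v)) p))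
  (λ { {γ = 0F} {0F} _ _ → refl })

-- Elementary transductions between path graphs

-- `γ` and `δ` choose canonical graphs for the data, so that relations on the data compose although
-- intermediate graphs are known only up to isomorphism.
record Realizes {X Y : Set} {a b a' b'} (γ : X → Graph a b) (δ : Y → Graph a' b')
                (T : MSOT a b a' b') (R : X → Y → Set) : Set where
  field
    sound    : ∀ x {h} → T ⊨ γ x ↦ h → ∃ λ y → R x y × Iso h (δ y)
    complete : ∀ {x y} → R x y → T ⊨ γ x ↦ δ y

module _ {X Y Z : Set} {a b a' b' a'' b''} {γ : X → Graph a b} {δ : Y → Graph a' b'} {ε : Z → Graph a'' b''} where

  Realizes-comp : ∀ {T₁ T₂ R S} → Realizes γ δ T₁ R → Realizes δ ε T₂ S →
                  Realizes γ ε (comp T₁ T₂) (λ x z → ∃ λ y → R x y × S y z)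
  Realizes-comp {T₁} {T₂} p q = record
    { sound = λ x t → let h , t₁ , t₂ = comp-sound T₁ T₂ t ; y , r , i = Realizes.sound p x t₁
                          z , s , j = Realizes.sound q y (t₂ _ i) in z , (y , r , s) , j
    ; complete = λ (y , r , s) → comp-complete T₁ T₂ (Realizes.complete p r) (Realizes.complete q s) }

module _ {X Y : Set} {a b a' b'} {γ : X → Graph a b} {δ : Y → Graph a' b'} where

  Realizes-function : ∀ {T} (F : X → Y) → (∀ x U → Sem (γ x) (MSOT.φdom T) VF.[] U × Out T (γ x) U (δ (F x))) →
                      Realizes γ δ T (λ x y → y ≡ F x)
  Realizes-function F o = record
    { sound = λ x (U , _ , o') → F x , refl , Out-unique o' (proj₂ (o x U))
    ; complete = λ { {x} refl → let U = λ _ → Vec.replicate _ false in U , o x U } }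

  Realizes-⇔ : ∀ {T} {R S : X → Y → Set} → Realizes γ δ T R → (∀ x y → R x y ⇔ S x y) → Realizes γ δ T S
  Realizes-⇔ p e = record
    { sound = λ x t → let y , r , i = Realizes.sound p x t in y , to (e x y) r , i
    ; complete = λ s → Realizes.complete p (from (e _ _) s) }

-- A total reading of the tape: every position past the last letter yields ⊣. It agrees with `tape`
-- only inside the tape, so a bound on the position has to accompany it there.
symAt : ∀ {n} → List (Fin n) → ℕ → TSym n
symAt w zero    = lend
symAt w (suc i) = Data.Maybe.maybe sym rend (at w i)

symCode : ∀ {n} → TSym n → Fin (2 + n)
symCode lend    = 0F
symCode rend    = 1F
symCode (sym a) = fsuc (fsuc a)

symCode-injective : ∀ {n} {s t : TSym n} → symCode s ≡ symCode t → s ≡ t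
symCode-injective {s = lend}  {lend}  p = refl
symCode-injective {s = rend}  {rend}  p = refl
symCode-injective {s = sym a} {sym b} p = cong sym (Finₚ.suc-injective (Finₚ.suc-injective p))

-- With one node per tape cell, end markers included, the scanned symbol is a node label and head
-- moves follow edges.
tgr : ∀ {n} → List (Fin n) → Graph (2 + n) 1
tgr w = record
  { N    = suc (suc (length w))
  ; lab  = λ u → symCode (symAt w (toℕ u))
  ; edge = λ u _ v → suc (toℕ u) ≡ᵇ toℕ v }

-- Copy 0 of node i is tape cell i; the cell of ⊣ is copy 1 of the last node.
tapeT : ∀ n → MSOT 1 n (2 + n) 1
tapeT n = record { k = 0 ; φdom = ⊤F ; C = 2 ; φnode = node ; φedge = λ c d _ → arc c d }
  where
  node : Fin 2 → Fin (2 + n) → Formula 1 n 1 0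
  node 0F 0F              = ¬F (∃₁ (adjF 0F 1F))
  node 0F 1F              = ⊥F
  node 0F (fsuc (fsuc a)) = ∃₁ (edgeF a 0F 1F)
  node 1F 0F              = ⊥F
  node 1F 1F              = ¬F (∃₁ (adjF 1F 0F))
  node 1F (fsuc (fsuc a)) = ⊥F
  arc : Fin 2 → Fin 2 → Formula 1 n 2 0
  arc 0F 0F = adjF 0F 1F
  arc 0F 1F = eqF 0F 1F
  arc 1F _  = ⊥F

module _ {n} (w : List (Fin n)) (U : Fin 0 → Subset (suc (length w))) where

  adj-egr : ∀ u v → Adj (egr w) u v ⇔ suc (toℕ u) ≡ toℕ v
  adj-egr u v = mk⇔ (λ (γ , e) → proj₁ (to (egr-edge⇔ w u γ v) e))
    (λ p → let l , q = at-succ u v p in l , from (egr-edge⇔ w u l v) (p , q))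
    where
    at-succ : ∀ (u v : Fin (suc (length w))) → suc (toℕ u) ≡ toℕ v → ∃ λ l → at w (toℕ u) ≡ just l
    at-succ u (fsuc v) p = _ , trans (cong (at w) (ℕₚ.suc-injective p)) (at-lookup w v)

  private
    g = egr w
    T = tapeT n

    tapeNode : ∀ {u : Fin (suc (suc (length w)))} → Top.View u → Fin (suc (length w)) × Fin 2
    tapeNode Top.‵fromℕ        = Fin.fromℕ (length w) , 1F
    tapeNode (Top.‵inject₁ j) = j , 0F

    f : Fin (suc (suc (length w))) → Fin (suc (length w)) × Fin 2
    f u = tapeNode (Top.view u)

    tapeNode-inj : ∀ {u v} (p : Top.View u) (q : Top.View v) → tapeNode p ≡ tapeNode q → u ≡ v
    tapeNode-inj Top.‵fromℕ        Top.‵fromℕ        e = refl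
    tapeNode-inj Top.‵fromℕ        (Top.‵inject₁ j) e = contradiction (cong proj₂ e) λ ()
    tapeNode-inj (Top.‵inject₁ i) Top.‵fromℕ        e = contradiction (cong proj₂ e) λ ()
    tapeNode-inj (Top.‵inject₁ i) (Top.‵inject₁ j) e = cong Fin.inject₁ (cong proj₁ e)

    m-lend : ∀ u → Nd T g U (u , 0F) 0F ⇔ (¬ ∃ λ v → Adj g v u)
    m-lend u = ¬-⇔ (∃-⇔ λ v → Sem-adjF g 0F 1F {v VF.∷ (u VF.∷ VF.[])} {U})

    m-rend : ∀ u → Nd T g U (u , 1F) 1F ⇔ (¬ ∃ λ v → Adj g u v)
    m-rend u = ¬-⇔ (∃-⇔ λ v → Sem-adjF g 1F 0F {v VF.∷ (u VF.∷ VF.[])} {U})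

    last-final : ∀ v → ¬ Adj g (Fin.fromℕ (length w)) v
    last-final v p = ℕₚ.<⇒≢ (Finₚ.toℕ<n v) (trans (≡sym (to (adj-egr _ v) p)) (cong suc (Finₚ.toℕ-fromℕ _)))

    labelled : ∀ {u} (p : Top.View u) → Labelled T g U (tapeNode p) (symCode (symAt w (toℕ u)))
    labelled Top.‵fromℕ σ = subst (λ s → Nd T g U (Fin.fromℕ (length w) , 1F) σ ⇔ symCode s ≡ σ)
      (≡sym (cong (Data.Maybe.maybe sym rend) (at-≥ w (ℕₚ.≤-reflexive (≡sym (Finₚ.toℕ-fromℕ (length w))))))) (go σ)
      where
      go : ∀ σ → Nd T g U (Fin.fromℕ (length w) , 1F) σ ⇔ 1F ≡ σ
      go 0F = mk⇔ (⊥F-elim g (Fin.fromℕ (length w) VF.∷ VF.[]) U) (λ ())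
      go 1F = mk⇔ (λ _ → refl) (λ _ → from (m-rend _) (λ (v , p) → last-final v p))
      go (fsuc (fsuc a)) = mk⇔ (⊥F-elim g (Fin.fromℕ (length w) VF.∷ VF.[]) U) (λ ())
    labelled (Top.‵inject₁ fzero) = go
      where
      go : ∀ σ → Nd T g U (fzero , 0F) σ ⇔ 0F ≡ σ
      go 0F = mk⇔ (λ _ → refl) (λ _ → from (m-lend fzero) (λ (v , p) → contradiction (to (adj-egr v fzero) p) λ ()))
      go 1F = mk⇔ (⊥F-elim g (fzero VF.∷ VF.[]) U) (λ ())
      go (fsuc (fsuc a)) = mk⇔ (λ (v , p) → contradiction (to (adj-egr v fzero) (a , p)) λ ()) (λ ())
    labelled (Top.‵inject₁ (fsuc j)) σ = subst (λ s → Nd T g U (fsuc j , 0F) σ ⇔ symCode s ≡ σ)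
      (≡sym (cong (Data.Maybe.maybe sym rend) (trans (cong (at w) (Finₚ.toℕ-inject₁ j)) (at-lookup w j)))) (go σ)
      where
      pre : toℕ (Fin.inject₁ j) ≡ toℕ j
      pre = Finₚ.toℕ-inject₁ j
      go : ∀ σ → Nd T g U (fsuc j , 0F) σ ⇔ fsuc (fsuc (List.lookup w j)) ≡ σ
      go 0F = mk⇔ (λ s → ⊥-elim (to (m-lend (fsuc j)) s
          (Fin.inject₁ j , from (adj-egr _ (fsuc j)) (cong suc pre)))) (λ ())
      go 1F = mk⇔ (⊥F-elim g (fsuc j VF.∷ VF.[]) U) (λ ())
      go (fsuc (fsuc a)) = mk⇔
        (λ (v , p) → let q , l = to (egr-edge⇔ w v a (fsuc j)) p in
          cong (fsuc ∘ fsuc) (Maybeₚ.just-injective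
              (trans (≡sym (at-lookup w j)) (trans (cong (at w) (≡sym (ℕₚ.suc-injective q))) l))))
        (λ p → Fin.inject₁ j , from (egr-edge⇔ w (Fin.inject₁ j) a (fsuc j)) (cong suc pre ,
          trans (cong (at w) pre) (trans (at-lookup w j) (cong just (Finₚ.suc-injective (Finₚ.suc-injective p))))))

    arcs : ∀ {u v} (p : Top.View u) (q : Top.View v) → suc (toℕ u) ≡ toℕ v ⇔ Ed T g U (tapeNode p) 0F (tapeNode q)
    arcs {v = v} Top.‵fromℕ q = mk⇔
      (λ e → ⊥-elim (ℕₚ.<⇒≢ (Finₚ.toℕ<n v) (trans (≡sym e) (cong (suc ∘ suc) (Finₚ.toℕ-fromℕ _)))))
      (⊥F-elim g (Fin.fromℕ (length w) VF.∷ (proj₁ (tapeNode q) VF.∷ VF.[])) U)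
    arcs (Top.‵inject₁ i) Top.‵fromℕ = mk⇔
      (λ e → Finₚ.toℕ-injective (trans (≡sym (Finₚ.toℕ-inject₁ i)) (ℕₚ.suc-injective e)))
      (λ e → cong suc (trans (Finₚ.toℕ-inject₁ i) (cong toℕ e)))
    arcs (Top.‵inject₁ i) (Top.‵inject₁ j) = ⇔.trans
      (subst₂ (λ x y → suc (toℕ (Fin.inject₁ i)) ≡ toℕ (Fin.inject₁ j) ⇔ suc x ≡ y) (Finₚ.toℕ-inject₁ i)
          (Finₚ.toℕ-inject₁ j) ⇔.refl)
      (⇔.trans (⇔.sym (adj-egr i j)) (⇔.sym (Sem-adjF g 0F 1F {i VF.∷ (j VF.∷ VF.[])} {U})))

  Out-tape : Out T g U (tgr w)
  Out-tape = record
    { f = f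
    ; f-inj = λ {i} {j} → tapeNode-inj (Top.view i) (Top.view j)
    ; f-surj = surj
    ; f-lab = λ i → labelled (Top.view i)
    ; f-edge = λ { i 0F j → ⇔.trans (≡ᵇ⇔ (suc (toℕ i)) (toℕ j)) (arcs (Top.view i) (Top.view j)) } }
    where
    surj : ∀ p σ → Labelled T g U p σ → ∃ λ i → f i ≡ p
    surj (u , 0F) σ l = Fin.inject₁ u , cong tapeNode (Top.view-inject₁ u)
    surj (u , 1F) 0F l = ⊥F-elim g (u VF.∷ VF.[]) U (from (l 0F) refl)
    surj (u , 1F) (fsuc (fsuc a)) l = ⊥F-elim g (u VF.∷ VF.[]) U (from (l (fsuc (fsuc a))) refl)
    surj (u , 1F) 1F l with Top.view u
    ... | Top.‵fromℕ = Fin.fromℕ _ , cong tapeNode (Top.view-fromℕ _)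
    ... | Top.‵inject₁ j = ⊥-elim (to (m-rend (Fin.inject₁ j)) (from (l 1F) refl)
            (fsuc j , from (adj-egr (Fin.inject₁ j) (fsuc j)) (cong suc (Finₚ.toℕ-inject₁ j))))

tapeT-realizes : ∀ n → Realizes egr tgr (tapeT n) (λ w w' → w' ≡ w)
tapeT-realizes n = Realizes-function id λ w U → ⊤F-intro (egr w) VF.[] U , Out-tape w U

-- The letter 0 of the intermediate alphabet marks the end of the output.
marked : ∀ {n} → List (Fin n) → List (Fin (suc n))
marked z = map fsuc z ++ fzero ∷ []

at-marked : ∀ {n} (z : List (Fin n)) i {a} → at (marked z) i ≡ just (fsuc a) ⇔ at z i ≡ just a
at-marked []      zero    = mk⇔ (λ ()) (λ ())
at-marked []      (suc i) = mk⇔ (λ ()) (λ ())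
at-marked (x ∷ z) zero    = mk⇔ (λ { refl → refl }) (λ { refl → refl })
at-marked (x ∷ z) (suc i) = at-marked z i

length-marked : ∀ {n} (z : List (Fin n)) → suc (length z) ≡ length (marked z)
length-marked []      = refl
length-marked (x ∷ z) = cong suc (length-marked z)

-- Each letter moves from a node to its outgoing edge. The node of the end mark becomes the last
-- node of `egr z`, so even the empty output has a node.
unmarkT : ∀ n → MSOT (suc n) 1 1 n
unmarkT n = record { k = 0 ; φdom = ⊤F ; C = 1 ; φnode = λ _ _ → ⊤F ; φedge = λ _ _ γ → labF
    (fsuc γ) 0F ∧F edgeF 0F 0F 1F }

unmarkT-realizes : ∀ n → Realizes (pgr ∘ marked) egr (unmarkT n) (λ z z' → z' ≡ z)
unmarkT-realizes n = Realizes-function id λ z U → ⊤F-intro (pgr (marked z)) VF.[] U , record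
  { f = λ i → c z i , 0F
  ; f-inj = λ {i} {j} p → Finₚ.toℕ-injective (trans (≡sym (toℕ-c z i)) (trans (cong (toℕ ∘ proj₁) p) (toℕ-c z j)))
  ; f-surj = λ { (u , 0F) σ l → Fin.cast (≡sym (length-marked z)) u , cong (_, 0F) (Finₚ.cast-involutive (length-marked z) (≡sym (length-marked z)) u) }
  ; f-lab = λ { i 0F → mk⇔ (λ _ → refl) (λ _ → ⊤F-intro (pgr (marked z)) (c z i VF.∷ VF.[]) U) }
  ; f-edge = λ i γ j → ⇔.trans (egr-edge⇔ z i γ j) (mk⇔
      (λ (p , q) → Maybeₚ.just-injective
          (trans (≡sym (at-lookup (marked z) (c z i)))
          (trans (cong (at (marked z)) (toℕ-c z i)) (from (at-marked z (toℕ i)) q)))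
                 , from (≡ᵇ⇔ _ _) (trans (cong suc (toℕ-c z i)) (trans p (≡sym (toℕ-c z j)))))
      (λ (q , p) → trans (≡sym (cong suc (toℕ-c z i))) (trans (to (≡ᵇ⇔ _ _) p) (toℕ-c z j))
                 , to (at-marked z (toℕ i))
                     (trans (cong (at (marked z)) (≡sym (toℕ-c z i)))
                     (trans (at-lookup (marked z) (c z i)) (cong just q))))) }
  where
  c : ∀ (z : List (Fin n)) → Fin (suc (length z)) → Fin (length (marked z))
  c z = Fin.cast (length-marked z)
  toℕ-c : ∀ z i → toℕ (c z i) ≡ toℕ i
  toℕ-c z = Finₚ.toℕ-cast (length-marked z)

-- Definable order on paths, and replacement of every node by a word

sorted-lookup : ∀ {A : Set} {_≺_ : A → A → Set} {K : List A} → AllPairs _≺_ K →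
                ∀ i j → toℕ i < toℕ j → List.lookup K i ≺ List.lookup K j
sorted-lookup (p ∷ ps) fzero    (fsuc j) _       = All.lookup p (∈ₚ.∈-lookup j)
sorted-lookup (p ∷ ps) (fsuc i) (fsuc j) (s≤s q) = sorted-lookup ps i j q

module _ {A : Set} {_≺_ : A → A → Set} (irrefl : ∀ {x} → ¬ x ≺ x) (≺-trans : ∀ {x y z} → x ≺ y → y ≺ z → x ≺ z)
         {K : List A} (sorted : AllPairs _≺_ K) where

  sorted-reflects : ∀ i j → List.lookup K i ≺ List.lookup K j → toℕ i < toℕ j
  sorted-reflects i j p with ℕₚ.<-cmp (toℕ i) (toℕ j)
  ... | tri< i<j _ _ = i<j
  ... | tri≈ _ i≡j _ = ⊥-elim
      (irrefl (subst (λ x → List.lookup K i ≺ List.lookup K x) (≡sym (Finₚ.toℕ-injective i≡j)) p))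
  ... | tri> _ _ j<i = ⊥-elim (irrefl (≺-trans p (sorted-lookup sorted j i j<i)))

  -- In a strictly sorted list the order of the entries mirrors that of the indices, so the
  -- successor is the covering relation. The latter is definable as soon as the order is.
  successor⇔covers : ∀ i j → suc (toℕ i) ≡ toℕ j ⇔
    (List.lookup K i ≺ List.lookup K j × ¬ ∃ λ c → c ∈ K × List.lookup K i ≺ c × c ≺ List.lookup K j)
  successor⇔covers i j = mk⇔
    (λ e → sorted-lookup sorted i j (ℕₚ.≤-reflexive e) , λ (c , c∈ , p , q) →
      let m = Any.index c∈ ; eq = Anyₚ.lookup-index c∈
          i<m = sorted-reflects i m (subst (List.lookup K i ≺_) eq p)
          m<j = sorted-reflects m j (subst (_≺ List.lookup K j) eq q)
      in ℕₚ.<-irrefl e (ℕₚ.≤-trans (s≤s i<m) m<j))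
    (λ (p , n) → go p n (ℕₚ.m≤n⇒m<n∨m≡n (sorted-reflects i j p)))
    where
    go : List.lookup K i ≺ List.lookup K j → (¬ ∃ λ c → c ∈ K × List.lookup K i ≺ c × c ≺ List.lookup K j) →
         suc (toℕ i) < toℕ j ⊎ suc (toℕ i) ≡ toℕ j → suc (toℕ i) ≡ toℕ j
    go p n (inj₂ e) = e
    go p n (inj₁ l) = ⊥-elim (n (List.lookup K m , ∈ₚ.∈-lookup m ,
        sorted-lookup sorted i m (ℕₚ.≤-reflexive (≡sym e)) , sorted-lookup sorted m j (subst (_< toℕ j) (≡sym e) l)))
      where
      m = fromℕ< (ℕₚ.<-trans l (Finₚ.toℕ<n j))
      e : toℕ m ≡ suc (toℕ i)
      e = Finₚ.toℕ-fromℕ< _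

-- The transitive closure of the edge relation: `y` lies in every successor-closed set that contains
-- the successors of `x`.
lessF : ∀ {a fo so} → Fin fo → Fin fo → Formula a 1 fo so
lessF x y = ∀₂ (∀₁ (edgeF 0F (fsuc x) 0F ⇒F memF 0F 0F) ⇒F
                (∀₁ (∀₁ ((memF 1F 0F ∧F edgeF 0F 1F 0F) ⇒F memF 0F 0F)) ⇒F memF y 0F))

module _ {a fo so} (v : List (Fin a)) {ρ : Fin fo → Fin (length v)} {U : Fin so → Subset (length v)} where

  m-edge : ∀ {x y} → Means (pgr v) ρ U (edgeF 0F x y) (suc (toℕ (ρ x)) ≡ toℕ (ρ y))
  m-edge {x} {y} = means (≡ᵇ⇔ (suc (toℕ (ρ x))) (toℕ (ρ y)))

module _ {a fo so} (v : List (Fin a)) {ρ : Fin fo → Fin (length v)} {U : Fin so → Subset (length v)} where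

  m-less : ∀ {x y} → Means (pgr v) ρ U (lessF x y) (toℕ (ρ x) < toℕ (ρ y))
  m-less {x} {y} = m-⇔ (m∀₂ λ S → (m∀ λ u → m-edge v m⇒ m-id) m⇒
      (m∀ λ u → m∀ λ u' → (m-id m∧ m-edge v) m⇒ m-id) m⇒ m-id)
    (mk⇔ fwd bwd)
    where
    Contains Closed : Subset (length v) → Set
    Contains S = ∀ u → suc (toℕ (ρ x)) ≡ toℕ u → lookupᵥ S u ≡ true
    Closed S = ∀ u u' → lookupᵥ S u ≡ true × suc (toℕ u) ≡ toℕ u' → lookupᵥ S u' ≡ true
    fwd : (∀ S → Contains S → Closed S → lookupᵥ S (ρ y) ≡ true) → toℕ (ρ x) < toℕ (ρ y)
    fwd h = to (above⇔ (ρ y)) (h above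
        (λ u e → from (above⇔ u) (ℕₚ.≤-reflexive e))
        (λ u u' (p , e) → from (above⇔ u') (subst (toℕ (ρ x) <_) e (ℕₚ.m<n⇒m<1+n (to (above⇔ u) p)))))
      where
      above = mkSubset (λ u → toℕ (ρ x) ℕₚ.<? toℕ u)
      above⇔ = ∈mkSubset (λ u → toℕ (ρ x) ℕₚ.<? toℕ u)
    bwd : toℕ (ρ x) < toℕ (ρ y) → ∀ S → Contains S → Closed S → lookupᵥ S (ρ y) ≡ true
    bwd p S s c = up (toℕ (ρ y) ∸ suc (toℕ (ρ x))) (ρ y) (ℕₚ.m+[n∸m]≡n p)
      where
      up : ∀ d u → suc (toℕ (ρ x)) + d ≡ toℕ u → lookupᵥ S u ≡ true
      up zero    u e = s u (trans (≡sym (ℕₚ.+-identityʳ _)) e)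
      up (suc d) u e = c (fromℕ< l) u
          (up d (fromℕ< l) (≡sym (Finₚ.toℕ-fromℕ< l)) , trans (cong suc (Finₚ.toℕ-fromℕ< l)) e')
        where
        e' : suc (suc (toℕ (ρ x)) + d) ≡ toℕ u
        e' = trans (≡sym (ℕₚ.+-suc _ d)) e
        l : suc (toℕ (ρ x)) + d < length v
        l = ℕₚ.<-trans (ℕₚ.≤-reflexive e') (Finₚ.toℕ<n u)

-- Copy `r` of a node holds letter `r` of its image; copies beyond the length of the image stay
-- unlabelled. Edges are the covering pairs of the lexicographic order on labelled copies, which
-- passes over nodes with empty image.
module HomT {a a'} (f : Fin a → List (Fin a')) (L : ℕ) (bounded : ∀ τ → length (f τ) ≤ L) where

  holds? : ∀ τ (r : Fin L) σ → Dec (at (f τ) (toℕ r) ≡ just σ)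
  holds? τ r σ = Maybeₚ.≡-dec _≟F_ (at (f τ) (toℕ r)) (just σ)

  nodeF : ∀ {fo so} → Fin L → Fin a' → Fin fo → Formula a 1 fo so
  nodeF r σ x = ⋁ λ τ → labF τ x ∧F guard (holds? τ r σ)

  ltF : ∀ {fo so} → Fin L → Fin L → Fin fo → Fin fo → Formula a 1 fo so
  ltF r s x y = lessF x y ∨F (eqF x y ∧F guard (toℕ r ℕₚ.<? toℕ s))

  homT : MSOT a 1 a' 1
  homT = record { k = 0 ; φdom = ⊤F ; C = L ; φnode = λ r σ → nodeF r σ 0F
    ; φedge = λ r s _ → ltF r s 0F 1F ∧F ¬F (∃₁ (⋁ λ t → ⋁ λ σ → nodeF t σ 0F ∧F (ltF r t 1F 0F ∧F ltF t s 0F 2F))) }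

  module _ (v : List (Fin a)) (U : Fin 0 → Subset (length v)) where

    Entry : Set
    Entry = (Fin (length v) × Fin L) × Fin a'

    _≺_ : Entry → Entry → Set
    ((p , r) , _) ≺ ((q , s) , _) = toℕ p < toℕ q ⊎ (p ≡ q × toℕ r < toℕ s)

    irrefl : ∀ {e} → ¬ e ≺ e
    irrefl (inj₁ p) = ℕₚ.<-irrefl refl p
    irrefl (inj₂ (_ , p)) = ℕₚ.<-irrefl refl p

    ≺-trans : ∀ {e e' e''} → e ≺ e' → e' ≺ e'' → e ≺ e''
    ≺-trans (inj₁ p) (inj₁ q) = inj₁ (ℕₚ.<-trans p q)
    ≺-trans (inj₁ p) (inj₂ (refl , _)) = inj₁ p
    ≺-trans (inj₂ (refl , _)) (inj₁ q) = inj₁ q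
    ≺-trans (inj₂ (refl , p)) (inj₂ (refl , q)) = inj₂ (refl , ℕₚ.<-trans p q)

    out : Fin (length v) → List (Fin a')
    out p = f (List.lookup v p)

    entry : ∀ p → Fin (length (out p)) → Entry
    entry p i = (p , Fin.inject≤ i (bounded _)) , List.lookup (out p) i

    block : Fin (length v) → List Entry
    block p = List.tabulate (entry p)

    K : List Entry
    K = concatMap block (allFin (length v))

    toℕ-slot : ∀ p i → toℕ (proj₂ (proj₁ (entry p i))) ≡ toℕ i
    toℕ-slot p i = Finₚ.toℕ-inject≤ i _

    sorted : AllPairs _≺_ K
    sorted = AllPairsₚ.concat⁺
      (Allₚ.map⁺ (All.tabulate λ {p} _ → AllPairsₚ.tabulate⁺-< λ {i} {j} i<j →
        inj₂ (refl , subst₂ _<_ (≡sym (toℕ-slot p i)) (≡sym (toℕ-slot p j)) i<j)))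
      (AllPairsₚ.map⁺ (AllPairsₚ.tabulate⁺-< λ p<q → Allₚ.tabulate⁺ λ i → Allₚ.tabulate⁺ λ j → inj₁ p<q))

    ∈K⇔ : ∀ p r σ → ((p , r) , σ) ∈ K ⇔ at (out p) (toℕ r) ≡ just σ
    ∈K⇔ p r σ = mk⇔ fwd bwd
      where
      fwd : ((p , r) , σ) ∈ K → at (out p) (toℕ r) ≡ just σ
      fwd m with Any.satisfied (∈ₚ.∈-concatMap⁻ block {xs = allFin (length v)} m)
      ... | q , m' with ∈ₚ.∈-tabulate⁻ {f = entry q} m'
      ... | i , refl = trans (cong (at (out q)) (toℕ-slot q i)) (at-lookup (out q) i)
      bwd : at (out p) (toℕ r) ≡ just σ → ((p , r) , σ) ∈ K
      bwd e = ∈ₚ.∈-concatMap⁺ block (Any.map (λ { refl → subst (_∈ block p) eq (∈ₚ.∈-tabulate⁺ {f = entry p} i) }) (∈ₚ.∈-allFin p))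
        where
        l = at-just⇒< (out p) e
        i = fromℕ< l
        eq : entry p i ≡ ((p , r) , σ)
        eq = cong₂ (λ r σ → (p , r) , σ)
          (Finₚ.toℕ-injective (trans (toℕ-slot p i) (Finₚ.toℕ-fromℕ< l)))
          (Maybeₚ.just-injective (trans (≡sym (at-lookup (out p) i))
              (trans (cong (at (out p)) (Finₚ.toℕ-fromℕ< l)) e)))

    labels : map proj₂ K ≡ concatMap f v
    labels = trans (Listₚ.map-concatMap proj₂ block (allFin (length v)))
      (trans (Listₚ.concatMap-cong
          (λ p → trans (Listₚ.map-tabulate (entry p) proj₂) (Listₚ.tabulate-lookup (out p))) (allFin (length v)))
      (trans (≡sym (Listₚ.concatMap-map f (List.lookup v) (allFin (length v))))
        (cong (concatMap f) (trans (Listₚ.map-tabulate id (List.lookup v)) (Listₚ.tabulate-lookup v)))))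

    m-node : ∀ {fo so} {ρ : Fin fo → _} {W : Fin so → _} r σ {x} → Means (pgr v) ρ W (nodeF r σ x)
        (at (out (ρ x)) (toℕ r) ≡ just σ)
    m-node r σ {x} = m-⇔ (m⋁ λ τ → m-id m∧ m-guard) (mk⇔ (λ { (_ , refl , e) → e }) (λ e → _ , refl , e))

    Lt : Fin (length v) → Fin L → Fin (length v) → Fin L → Set
    Lt p r q s = toℕ p < toℕ q ⊎ (p ≡ q × toℕ r < toℕ s)

    m-lt : ∀ {fo so} {ρ : Fin fo → _} {W : Fin so → _} {r s x y} → Means (pgr v) ρ W (ltF r s x y)
        (Lt (ρ x) r (ρ y) s)
    m-lt = m-less v m∨ (m-id m∧ m-guard)

    Ed-hom : ∀ {p r q s} → Ed homT (pgr v) U (p , r) 0F (q , s) ⇔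
      (Lt p r q s × ¬ ∃ λ u → ∃ λ t → ∃ λ σ → at (out u) (toℕ t) ≡ just σ × Lt p r u t × Lt u t q s)
    Ed-hom {p} {r} {q} {s} = sem m-Ed
      where
      m-Ed : Means (pgr v) (p VF.∷ (q VF.∷ VF.[])) U (MSOT.φedge homT r s 0F) _
      m-Ed = m-lt m∧ m¬ (m∃ λ u → m⋁ λ t → m⋁ λ σ → m-node t σ m∧ m-lt m∧ m-lt)

    private
      key : Fin (length K) → Fin (length v) × Fin L
      key i = proj₁ (List.lookup K i)

      key-∈ : ∀ i → at (out (proj₁ (key i))) (toℕ (proj₂ (key i))) ≡ just (proj₂ (List.lookup K i))
      key-∈ i = to (∈K⇔ _ _ _) (∈ₚ.∈-lookup i)

      Covered Covered' : Fin (length K) → Fin (length K) → Set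
      Covered i j = ∃ λ c → c ∈ K × List.lookup K i ≺ c × c ≺ List.lookup K j
      Covered' i j = ∃ λ u → ∃ λ t → ∃ λ σ → at (out u) (toℕ t) ≡ just σ ×
        Lt (proj₁ (key i)) (proj₂ (key i)) u t × Lt u t (proj₁ (key j)) (proj₂ (key j))

      covered⇔ : ∀ i j → Covered i j ⇔ Covered' i j
      covered⇔ i j = mk⇔
        (λ (((u , t) , σ) , m , p , q) → u , t , σ , to (∈K⇔ u t σ) m , p , q)
        (λ (u , t , σ , e , p , q) → ((u , t) , σ) , from (∈K⇔ u t σ) e , p , q)

      covers⇔ : ∀ i j → (List.lookup K i ≺ List.lookup K j × ¬ Covered i j) ⇔ Ed homT (pgr v) U (key i) 0F (key j)
      covers⇔ i j = ⇔.trans (⇔.refl ×-⇔ ¬-⇔ (covered⇔ i j)) (⇔.sym Ed-hom)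

      key-injective : ∀ {i j} → key i ≡ key j → i ≡ j
      key-injective {i} {j} e with ℕₚ.<-cmp (toℕ i) (toℕ j)
      ... | tri≈ _ p _ = Finₚ.toℕ-injective p
      ... | tri< p _ _ = ⊥-elim (irrefl {List.lookup K j}
          (subst (λ k → (k , proj₂ (List.lookup K i)) ≺ List.lookup K j) e (sorted-lookup sorted i j p)))
      ... | tri> _ _ p = ⊥-elim (irrefl {List.lookup K i}
          (subst (λ k → (k , proj₂ (List.lookup K j)) ≺ List.lookup K i) (≡sym e) (sorted-lookup sorted j i p)))

    Out-hom : Out homT (pgr v) U (pgr (concatMap f v))
    Out-hom = Out-≅ (record
      { f = key
      ; f-inj = key-injective
      ; f-surj = λ (p , r) σ l → let m = from (∈K⇔ p r σ) (to (sem (m-node r σ)) (from (l σ) refl)) in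
          Any.index m , cong proj₁ (≡sym (Anyₚ.lookup-index m))
      ; f-lab = λ i σ → ⇔.trans (sem (m-node _ σ)) (mk⇔
          (λ e → Maybeₚ.just-injective (trans (≡sym (key-∈ i)) e))
          (λ e → trans (key-∈ i) (cong just e)))
      ; f-edge = λ { i 0F j → ⇔.trans (≡ᵇ⇔ (suc (toℕ i)) (toℕ j))
          (⇔.trans (successor⇔covers (λ {e} → irrefl {e}) (λ {e} {e'} {e''} → ≺-trans {e} {e'} {e''}) sorted i j) (covers⇔ i j)) }
      }) (pathG-≅ proj₂ K labels)

-- From finite visit machines to MSO transductions

-- Only a retract of `Fin size` is asked for. That suffices for decidable equality and is easily
-- closed under products, sums and vectors; indices outside the image of `code` may decode to
-- anything.
record Finite (A : Set) : Set where
  field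
    size        : ℕ
    code        : A → Fin size
    decode      : Fin size → A
    decode-code : ∀ a → decode (code a) ≡ a
open Finite

Finite-retract : ∀ {A B : Set} (f : A → B) (g : B → A) → (∀ a → g (f a) ≡ a) → Finite B → Finite A
Finite-retract f g e F = record
  { size = size F ; code = code F ∘ f ; decode = g ∘ decode F
  ; decode-code = λ a → trans (cong g (decode-code F (f a))) (e a) }

Finite-Fin : ∀ n → Finite (Fin n)
Finite-Fin n = record { size = n ; code = id ; decode = id ; decode-code = λ _ → refl }

Finite-× : ∀ {A B : Set} → Finite A → Finite B → Finite (A × B)
Finite-× {A} {B} F G = record
  { size = size F * size G
  ; code = λ (a , b) → combine (code F a) (code G b)
  ; decode = dec
  ; decode-code = λ (a , b) → trans (cong decPair (Finₚ.remQuot-combine (code F a) (code G b)))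
      (cong₂ _,_ (decode-code F a) (decode-code G b)) }
  where
  decPair : Fin (size F) × Fin (size G) → A × B
  decPair (i , j) = decode F i , decode G j
  dec : Fin (size F * size G) → A × B
  dec i = decPair (remQuot {size F} (size G) i)

Finite-Maybe : ∀ {A : Set} → Finite A → Finite (Maybe A)
Finite-Maybe F = record
  { size = suc (size F)
  ; code = Data.Maybe.maybe (fsuc ∘ code F) fzero
  ; decode = λ { fzero → nothing ; (fsuc i) → just (decode F i) }
  ; decode-code = λ { nothing → refl ; (just a) → cong just (decode-code F a) } }

Finite-Bool : Finite Bool
Finite-Bool = record
  { size = 2 ; code = λ { true → 0F ; false → 1F } ; decode = λ { 0F → true ; 1F → false }
  ; decode-code = λ { true → refl ; false → refl } }

Finite-TSym : ∀ {n} → Finite (TSym n)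
Finite-TSym = record
  { size = _ ; code = symCode ; decode = λ { 0F → lend ; 1F → rend ; (fsuc (fsuc a)) → sym a }
  ; decode-code = λ { lend → refl ; rend → refl ; (sym a) → refl } }

code-injective : ∀ {A : Set} (F : Finite A) {a b} → code F a ≡ code F b → a ≡ b
code-injective F {a} {b} p = trans (≡sym (decode-code F a)) (trans (cong (decode F) p) (decode-code F b))

Finite-≟ : ∀ {A : Set} → Finite A → DecidableEquality A
Finite-≟ F a b = map′ (code-injective F) (cong (code F)) (code F a ≟F code F b)

length-tape : ∀ {n} (w : List (Fin n)) → length (tape w) ≡ suc (suc (length w))
length-tape w = cong suc (trans (Listₚ.length-++ (map sym w))
    (trans (cong (_+ 1) (Listₚ.length-map sym w)) (ℕₚ.+-comm _ 1)))

at-tape : ∀ {n} (w : List (Fin n)) {i} → i < suc (suc (length w)) → at (tape w) i ≡ just (symAt w i)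
at-tape w {zero}  p = refl
at-tape w {suc i} (s≤s p) = go w p
  where
  go : ∀ {i} w → i < suc (length w) → at (map sym w ++ rend ∷ []) i ≡ just (Data.Maybe.maybe sym rend (at w i))
  go {zero}  []      p       = refl
  go {suc i} []      (s≤s ())
  go {zero}  (x ∷ w) p       = refl
  go {suc i} (x ∷ w) (s≤s p) = go w p

at-tape⁻ : ∀ {n} (w : List (Fin n)) {i τ} → at (tape w) i ≡ just τ → i < suc (suc (length w)) × symAt w i ≡ τ
at-tape⁻ w {i} e = p , Maybeₚ.just-injective (trans (≡sym (at-tape w p)) e)
  where p = subst (i <_) (length-tape w) (at-just⇒< (tape w) e)

lookup∈⇒ : ∀ {A : Set} {xs : List A} {x} → x ∈ xs → ∃ λ i → List.lookup xs i ≡ x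
lookup∈⇒ m = Any.index m , ≡sym (Anyₚ.lookup-index m)

-- A k-visiting computation is coded on the tape graph: slot s of a cell holds its s-th visit, labelled
-- by the scanned symbol and (unless the visit halts) the instruction used, whether its test succeeds,
-- and the slot of the next visit.
module VisitT {n₁ n₂} (M : GSM n₁ n₂) (k : ℕ) where
  open GSM M
  open Instr

  Visit : Set
  Visit = TSym n₁ × Maybe (Fin (length δ) × Bool × Fin k)

  -- Abstract, since ⋁ would unfold on the concrete number of visits.
  abstract
    FV : Finite Visit
    FV = Finite-× Finite-TSym (Finite-Maybe (Finite-× (Finite-Fin _) (Finite-× Finite-Bool (Finite-Fin k))))

  V : ℕ
  V = size FV

  state : Visit → Fin Q
  state (τ , nothing)      = qf
  state (τ , just (i , _)) = p (List.lookup δ i)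

  Action : Set
  Action = Fin Q × List (Fin n₂) × Dir × Fin k

  _≟S_ : DecidableEquality (TSym n₁)
  _≟S_ = Finite-≟ Finite-TSym

  -- The recorded outcome has to be the true one: a visit with a wrong outcome gets no action, hence
  -- no outgoing edge.
  ifTest : ∀ {A : Set} {P : Set} → Dec P → Bool → A → A → Maybe A
  ifTest (yes _) true  a b = just a
  ifTest (yes _) false a b = nothing
  ifTest (no _)  true  a b = nothing
  ifTest (no _)  false a b = just b

  action : Visit → Maybe Action
  action (τ , nothing)          = nothing
  action (τ , just (i , b , t)) = let ι = List.lookup δ i in
    ifTest (τ ≟S σ ι) b (q₁ ι , α₁ ι , ε₁ ι , t) (q₀ ι , α₀ ι , ε₀ ι , t)

  output : Visit → List (Fin (suc n₂))
  output (τ , nothing)              = fzero ∷ []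
  output (τ , just (i , true  , t)) = map fsuc (α₁ (List.lookup δ i))
  output (τ , just (i , false , t)) = map fsuc (α₀ (List.lookup δ i))

  action-output : ∀ ℓ {q α ε t} → action ℓ ≡ just (q , α , ε , t) → output ℓ ≡ map fsuc α
  action-output (τ , just (i , b , t)) e with τ ≟S σ (List.lookup δ i) | b
  action-output (τ , just (i , b , t)) refl | yes _ | true  = refl
  action-output (τ , just (i , b , t)) refl | no _  | false = refl

  action-step : ∀ w ℓ {q α ε t i j} → i < suc (suc (length w)) → symAt w i ≡ proj₁ ℓ →
                action ℓ ≡ just (q , α , ε , t) → move i ε ≡ just j → j < suc (suc (length w)) →
                Step M w (state ℓ , i) α (q , j)
  action-step w (τ , just (i , b , t)) i< s e m j< with τ ≟S σ (List.lookup δ i) | b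
  action-step w (τ , just (i , b , t)) {j = j} i< s refl m j< | yes p | true =
    step-eq (∈ₚ.∈-lookup i) (trans (at-tape w i<) (cong just s)) p m (subst (j <_) (≡sym (length-tape w)) j<)
  action-step w (τ , just (i , b , t)) {j = j} i< s refl m j< | no n | false =
    step-neq (∈ₚ.∈-lookup i) (trans (at-tape w i<) (cong just s)) n m (subst (j <_) (≡sym (length-tape w)) j<)

  step-action : ∀ {w q i α q' j} (t : Fin k) → Step M w (q , i) α (q' , j) → ∃ λ ℓ → ∃ λ ε →
                i < suc (suc (length w)) × j < suc (suc (length w)) ×
                symAt w i ≡ proj₁ ℓ × state ℓ ≡ q × action ℓ ≡ just (q' , α , ε , t) × move i ε ≡ just j
  step-action {w} t (step-eq {ι} {i} {τ} {j} ι∈ s e m j<) with lookup∈⇒ ι∈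
  ... | x , refl = let i< , s≡ = at-tape⁻ w {i} {τ} s in
    (τ , just (x , true , t)) , _ , i< , subst (j <_) (length-tape w) j< , s≡ , refl , act , m
    where
    act : action (τ , just (x , true , t)) ≡ _
    act with τ ≟S σ (List.lookup δ x)
    ... | yes _ = refl
    ... | no n = ⊥-elim (n e)
  step-action {w} t (step-neq {ι} {i} {τ} {j} ι∈ s e m j<) with lookup∈⇒ ι∈
  ... | x , refl = let i< , s≡ = at-tape⁻ w {i} {τ} s in
    (τ , just (x , false , t)) , _ , i< , subst (j <_) (length-tape w) j< , s≡ , refl , act , m
    where
    act : action (τ , just (x , false , t)) ≡ _
    act with τ ≟S σ (List.lookup δ x)
    ... | yes p = ⊥-elim (e p)
    ... | no _ = refl

  visit : Fin V → Visit
  visit = decode FV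

  visF : ∀ {fo} → Fin k → Fin V → Fin fo → Formula (2 + n₁) 1 fo (k * V)
  visF s c x = labF (symCode (proj₁ (visit c))) x ∧F memF x (combine s c)

  dirF : Dir → Formula (2 + n₁) 1 2 (k * V)
  dirF left  = edgeF 0F 1F 0F
  dirF stay  = eqF 0F 1F
  dirF right = edgeF 0F 0F 1F

  linkF : Maybe Action → Fin Q → Fin k → Formula (2 + n₁) 1 2 (k * V)
  linkF nothing                 q' s' = ⊥F
  linkF (just (q , α , ε , t)) q' s' = guard (q ≟F q') ∧F (guard (t ≟F s') ∧F dirF ε)

  -- Parameter `combine s c` is the set of cells whose slot `s` holds visit `c`. A slot with no
  -- fitting label, or with several, yields no node.
  visitT : MSOT (2 + n₁) 1 V 1
  visitT = record { k = k * V ; φdom = ⊤F ; C = k ; φnode = λ s c → visF s c 0F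
    ; φedge = λ s s' _ → ⋁ λ c → ⋁ λ c' → visF s c 0F ∧F
        (visF s' c' 1F ∧F linkF (action (visit c)) (state (visit c')) s') }

  initial? : ∀ (ℓ : Visit) → Dec (proj₁ ℓ ≡ lend × state ℓ ≡ qin)
  initial? ℓ = proj₁ ℓ ≟S lend ×-dec state ℓ ≟F qin

  halting? : ∀ (ℓ : Visit) → Dec (proj₂ ℓ ≡ nothing)
  halting? (τ , nothing) = yes refl
  halting? (τ , just _)  = no λ ()

  -- The guessed parameters yield an arbitrary graph of visits. It describes a computation once it
  -- is a path from an initial visit to a halting one.
  acceptingF : Formula V 1 0 0
  acceptingF = isPathF ∧F
    (∃₁ ((¬F (∃₁ (adjF 0F 1F))) ∧F (⋁ λ c → labF c 0F ∧F guard (initial? (visit c)))) ∧F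
     ∃₁ ((¬F (∃₁ (adjF 1F 0F))) ∧F (⋁ λ c → labF c 0F ∧F guard (halting? (visit c)))))

  m-label : ∀ {g : Graph V 1} {P : Fin V → Set}
      (P? : Decidable P) {ρ : Fin 1 → Fin (N g)} {U : Fin 0 → Subset (N g)} →
            Means g ρ U (⋁ λ c → labF c 0F ∧F guard (P? c)) (P (lab g (ρ 0F)))
  m-label {g} {P} P? {ρ} = m-⇔ (m⋁ {P = λ c → lab g (ρ 0F) ≡ c × P c} λ c → m-id m∧ m-guard)
    (mk⇔ (λ { (_ , refl , q) → q }) (λ q → _ , refl , q))

  m-acceptingF : ∀ {g : Graph V 1} → Means g VF.[] VF.[] acceptingF (IsPath g ×
    (∃ λ u → ¬ (∃ λ v → Adj g v u) × proj₁ (visit (lab g u)) ≡ lend × state (visit (lab g u)) ≡ qin) ×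
    (∃ λ u → ¬ (∃ λ v → Adj g u v) × proj₂ (visit (lab g u)) ≡ nothing))
  m-acceptingF {g} = m-isPathF g m∧
    (m∃ λ u → m¬ (m∃ λ v → m-adj) m∧ m-label (initial? ∘ visit)) m∧
    (m∃ λ u → m¬ (m∃ λ v → m-adj) m∧ m-label (halting? ∘ visit))

  module _ (w : List (Fin n₁)) where

    Cell : Set
    Cell = Fin (suc (suc (length w)))

    Entry : Set
    Entry = (Cell × Fin k) × Fin V

    pos : Entry → ℕ
    pos e = toℕ (proj₁ (proj₁ e))

    vis : Entry → Visit
    vis e = visit (proj₂ e)

    Fits : Entry → Set
    Fits e = symAt w (pos e) ≡ proj₁ (vis e)

    Link : Entry → Entry → Set
    Link e e' = ∃ λ α → ∃ λ ε → action (vis e) ≡ just (state (vis e') , α , ε , proj₂ (proj₁ e')) × move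
        (pos e) ε ≡ just (pos e')

    m-dirF : ∀ {U u u'} ε → Means (tgr w) (u VF.∷ (u' VF.∷ VF.[])) U (dirF ε) (move (toℕ u) ε ≡ just (toℕ u'))
    m-dirF {u = u} {u'} left = m-⇔ (means (≡ᵇ⇔ (suc (toℕ u')) (toℕ u))) (go (toℕ u))
      where
      go : ∀ i → suc (toℕ u') ≡ i ⇔ move i left ≡ just (toℕ u')
      go zero    = mk⇔ (λ ()) (λ ())
      go (suc i) = mk⇔ (λ { refl → refl }) (λ { refl → refl })
    m-dirF {u = u} {u'} stay = m-⇔ m-id (mk⇔ (λ { refl → move-stay (toℕ u) }) (λ e → Finₚ.toℕ-injective (Maybeₚ.just-injective (trans (≡sym (move-stay (toℕ u))) e))))
      where
      move-stay : ∀ i → move i stay ≡ just i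
      move-stay zero    = refl
      move-stay (suc i) = refl
    m-dirF {u = u} {u'} right = m-⇔ (means (≡ᵇ⇔ (suc (toℕ u)) (toℕ u'))) (go (toℕ u))
      where
      go : ∀ i → suc i ≡ toℕ u' ⇔ move i right ≡ just (toℕ u')
      go zero    = mk⇔ (cong just) Maybeₚ.just-injective
      go (suc i) = mk⇔ (cong just) Maybeₚ.just-injective

    m-linkF : ∀ {U u u'} A q' s' → Means (tgr w) (u VF.∷ (u' VF.∷ VF.[])) U (linkF A q' s')
                (∃ λ α → ∃ λ ε → A ≡ just (q' , α , ε , s') × move (toℕ u) ε ≡ just (toℕ u'))
    m-linkF nothing q' s' = m-⇔ m-⊥ (mk⇔ ⊥-elim λ ())
    m-linkF (just (q , α , ε , t)) q' s' = m-⇔ (m-guard m∧ m-guard m∧ m-dirF ε)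
      (mk⇔ (λ { (refl , refl , m) → α , ε , refl , m }) (λ { (_ , _ , refl , m) → refl , refl , m }))

    module _ (U : Fin (k * V) → Subset (suc (suc (length w)))) where

      Marked : Entry → Set
      Marked e@((u , s) , c) = Fits e × lookupᵥ (U (combine s c)) u ≡ true

      m-visF : ∀ {fo} {ρ : Fin fo → Cell} s c x → Means (tgr w) ρ U (visF s c x) (Marked ((ρ x , s) , c))
      m-visF s c x = m-⇔ m-id (mk⇔ symCode-injective (cong symCode) ×-⇔ ⇔.refl)

      Nd-visit : ∀ p c → Nd visitT (tgr w) U p c ⇔ Marked (p , c)
      Nd-visit (u , s) c = sem (m-visF {ρ = u VF.∷ VF.[]} s c 0F)

      Ed-visit : ∀ p p' → Ed visitT (tgr w) U p 0F p' ⇔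
          (∃ λ c → ∃ λ c' → Marked (p , c) × Marked (p' , c') × Link (p , c) (p' , c'))
      Ed-visit (u , s) (u' , s') = sem m-Ed
        where
        m-Ed : Means (tgr w) (u VF.∷ (u' VF.∷ VF.[])) U (MSOT.φedge visitT s s' 0F) _
        m-Ed = m⋁ λ c → m⋁ λ c' → m-visF s c 0F m∧ m-visF s' c' 1F m∧ m-linkF (action (visit c)) (state (visit c')) s'

    halting : ∀ (ℓ : Visit) → proj₂ ℓ ≡ nothing → state ℓ ≡ qf × output ℓ ≡ fzero ∷ []
    halting (τ , nothing) _ = refl , refl

    -- The computation is read off the path visit by visit. Cells are given as a function of the
    -- index so that the induction can shift it.
    run : ∀ x v (cell : Fin (suc (length v)) → Cell × Fin k) → let entry = λ i → cell i , List.lookup (x ∷ v) i in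
          (∀ i → Fits (entry i)) → (∀ i j → suc (toℕ i) ≡ toℕ j → Link (entry i) (entry j)) →
          (∀ i → suc (toℕ i) ≡ suc (length v) → proj₂ (vis (entry i)) ≡ nothing) →
          ∃ λ z → (∃ λ cs → Comp M w (state (visit x) , toℕ (proj₁ (cell 0F))) z cs) × concatMap
              (output ∘ visit) (x ∷ v) ≡ marked z
    run x [] cell fits links last = let q , o = halting (visit x) (last 0F refl) in
      [] , (_ , subst (λ q → Comp M w (q , toℕ (proj₁ (cell 0F))) [] ((qf , toℕ (proj₁ (cell 0F))) ∷ []))
          (≡sym q) halt) , cong (_++ []) o
    run x (y ∷ v) cell fits links last =
      let z , (cs , c) , e = run y v (cell ∘ fsuc) (fits ∘ fsuc) (λ i j p → links (fsuc i) (fsuc j) (cong suc p)) (λ i p → last (fsuc i) (cong suc p))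
          α , ε , a , m = links 0F 1F refl
      in α ++ z , (_ , next (action-step w (visit x) (Finₚ.toℕ<n (proj₁ (cell 0F))) (fits 0F) a m (Finₚ.toℕ<n (proj₁ (cell 1F)))) c)
       , trans (cong₂ _++_ (action-output (visit x) a) e)
           (trans (≡sym (Listₚ.++-assoc (map fsuc α) (map fsuc z) _))
               (cong (_++ fzero ∷ []) (≡sym (Listₚ.map-++ fsuc α z))))

    sound : ∀ {x v U} → Out visitT (tgr w) U (pgr (x ∷ v)) → Sem (pgr (x ∷ v)) acceptingF VF.[] VF.[] →
            ∃ λ z → ⟦ M ⟧G w z × concatMap (output ∘ visit) (x ∷ v) ≡ marked z
    sound {x} {v} {U} o s with to (sem (m-acceptingF {pgr (x ∷ v)})) s
    ... | _ , (u , first , l , q) , (u' , final , h) =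
      let z , (cs , c) , e = run x v f fits links last in z , (cs , subst (λ c → Comp M w c z cs) (cong₂ _,_ qin≡ pos≡) c) , e
      where
      open Out o
      lbl : ∀ i → Marked U (f i , List.lookup (x ∷ v) i)
      lbl i = to (Nd-visit U (f i) _) (from (f-lab i _) refl)
      fits : ∀ i → Fits (f i , List.lookup (x ∷ v) i)
      fits i = proj₁ (lbl i)
      links : ∀ i j → suc (toℕ i) ≡ toℕ j → Link (f i , List.lookup (x ∷ v) i) (f j , List.lookup (x ∷ v) j)
      links i j p with to (Ed-visit U (f i) (f j)) (to (f-edge i 0F j) (from (≡ᵇ⇔ (suc (toℕ i)) (toℕ j)) p))
      ... | c , c' , m , m' , L with to (f-lab i c) (from (Nd-visit U (f i) c) m) | to (f-lab j c')
          (from (Nd-visit U (f j) c') m')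
      ... | refl | refl = L
      minimal : ∀ (u : Fin (suc (length v))) → ¬ (∃ λ u' → Adj (pgr (x ∷ v)) u' u) → u ≡ 0F
      minimal 0F       n = refl
      minimal (fsuc u) n = ⊥-elim (n (Fin.inject₁ u , 0F , from (≡ᵇ⇔ _ _) (cong suc (Finₚ.toℕ-inject₁ u))))
      u≡0 : u ≡ 0F
      u≡0 = minimal u first
      qin≡ : state (visit x) ≡ qin
      qin≡ = subst (λ u → state (visit (List.lookup (x ∷ v) u)) ≡ qin) u≡0 q
      -- ⊢ is scanned at position 0 only, so the initial visit sits where computations begin.
      pos≡ : toℕ (proj₁ (f 0F)) ≡ 0
      pos≡ = lend-pos (toℕ (proj₁ (f 0F)))
          (trans (fits 0F) (subst (λ u → proj₁ (visit (List.lookup (x ∷ v) u)) ≡ lend) u≡0 l))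
        where
        lend-pos : ∀ i → symAt w i ≡ lend → i ≡ 0
        lend-pos zero    e = refl
        lend-pos (suc i) e with at w i
        lend-pos (suc i) () | just _
        lend-pos (suc i) () | nothing
      last : ∀ i → suc (toℕ i) ≡ suc (length v) → proj₂ (visit (List.lookup (x ∷ v) i)) ≡ nothing
      last i p = subst (λ u → proj₂ (visit (List.lookup (x ∷ v) u)) ≡ nothing)
          (Finₚ.toℕ-injective (≡sym (trans i≡ (≡sym u≡)))) h
        where
        i≡ : toℕ i ≡ length v
        i≡ = ℕₚ.suc-injective p
        u≡ : toℕ u' ≡ length v
        u≡ with suc (toℕ u') ℕₚ.<? suc (length v)
        ... | yes l = ⊥-elim (final (fromℕ< l , 0F , from (≡ᵇ⇔ _ _) (≡sym (Finₚ.toℕ-fromℕ< l))))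
        ... | no l = ℕₚ.suc-injective (ℕₚ.≤-antisym (Finₚ.toℕ<n u') (ℕₚ.≮⇒≥ l))

    -- The intermediate form between a computation and a valuation: every configuration has received
    -- its cell, slot and label.
    data Trace : Entry → List Entry → List (Fin n₂) → Set where
      done : ∀ {e} → Fits e → proj₂ (vis e) ≡ nothing → Trace e [] []
      step : ∀ {e e' es α ε z} → Fits e → action (vis e) ≡ just (state (vis e') , α , ε , proj₂ (proj₁ e')) →
             move (pos e) ε ≡ just (pos e') → Trace e' es z → Trace e (e' ∷ es) (α ++ z)

    trace-fits : ∀ {e es z} → Trace e es z → All Fits (e ∷ es)
    trace-fits (done f _)     = f ∷ []
    trace-fits (step f _ _ t) = f ∷ trace-fits t

    trace-link : ∀ {e es z} → Trace e es z → ∀ i j → suc (toℕ i) ≡ toℕ j → Link (List.lookup (e ∷ es) i)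
        (List.lookup (e ∷ es) j)
    trace-link (step _ a m t) 0F       1F       p = _ , _ , a , m
    trace-link (step _ a m t) (fsuc i) (fsuc j) p = trace-link t i j (ℕₚ.suc-injective p)

    trace-last : ∀ {e es z} → Trace e es z → ∀ i → suc (toℕ i) ≡ length (e ∷ es) → proj₂
        (vis (List.lookup (e ∷ es) i)) ≡ nothing
    trace-last (done _ h)     0F       p = h
    trace-last (step _ a m t) (fsuc i) p = trace-last t i (ℕₚ.suc-injective p)

    trace-output : ∀ {e es z} → Trace e es z → concatMap (output ∘ vis) (e ∷ es) ≡ marked z
    trace-output {e} (done _ h) = cong (_++ []) (proj₂ (halting (vis e) h))
    trace-output {e} (step {α = α} {z = z} _ a m t) = trans (cong₂ _++_ (action-output (vis e) a) (trace-output t))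
      (trans (≡sym (Listₚ.++-assoc (map fsuc α) (map fsuc z) _))
          (cong (_++ fzero ∷ []) (≡sym (Listₚ.map-++ fsuc α z))))

    -- `proj₁` of an entry is the pair of cell and slot, so a cell may recur in another slot.
    DistinctCells : List Entry → Set
    DistinctCells = AllPairs (λ e e' → proj₁ e ≢ proj₁ e')

    module _ {e₀ es z} (t : Trace e₀ es z) (distinct : DistinctCells (e₀ ∷ es)) where

      private
        K : List Entry
        K = e₀ ∷ es

        nth : Fin (length K) → Entry
        nth = List.lookup K

        ∈K? : ∀ s c → Decidable (λ u → ((u , s) , c) ∈ K)
        ∈K? s c u = Any.any? (×ₚ.≡-dec (×ₚ.≡-dec _≟F_ _≟F_) _≟F_ ((u , s) , c)) K

        U : Fin (k * V) → Subset (suc (suc (length w)))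
        U X = mkSubset (∈K? (proj₁ (remQuot {k} V X)) (proj₂ (remQuot {k} V X)))

        U⇔ : ∀ s c u → lookupᵥ (U (combine s c)) u ≡ true ⇔ ((u , s) , c) ∈ K
        U⇔ s c u = subst (λ (s' , c') → lookupᵥ (U (combine s c)) u ≡ true ⇔ ((u , s') , c') ∈ K)
          (Finₚ.remQuot-combine {k} {V} s c) (∈mkSubset (∈K? _ _) u)

        cells-injective : ∀ {i j} → proj₁ (nth i) ≡ proj₁ (nth j) → i ≡ j
        cells-injective {i} {j} e with ℕₚ.<-cmp (toℕ i) (toℕ j)
        ... | tri≈ _ p _ = Finₚ.toℕ-injective p
        ... | tri< p _ _ = ⊥-elim (sorted-lookup distinct i j p e)
        ... | tri> _ _ p = ⊥-elim (sorted-lookup distinct j i p (≡sym e))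

        ∈K⇒nth : ∀ {e} → e ∈ K → ∃ λ i → nth i ≡ e
        ∈K⇒nth = lookup∈⇒

        Marked⇔ : ∀ e → Marked U e ⇔ e ∈ K
        Marked⇔ e@((u , s) , c) = mk⇔ (λ (_ , m) → to (U⇔ s c u) m)
            (λ m → All.lookup (trace-fits t) m , from (U⇔ s c u) m)

        label⇔ : ∀ i c → Marked U (proj₁ (nth i) , c) ⇔ proj₂ (nth i) ≡ c
        label⇔ i c = ⇔.trans (Marked⇔ (proj₁ (nth i) , c)) (mk⇔ fwd (λ { refl → ∈ₚ.∈-lookup i }))
          where
          fwd : (proj₁ (nth i) , c) ∈ K → proj₂ (nth i) ≡ c
          fwd m with ∈K⇒nth m
          ... | j , q with cells-injective {j} {i} (cong proj₁ q)
          ... | refl = cong proj₂ q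

        -- A visit fixes its successor: the move gives the cell and the action names the slot.
        -- Recording that slot in the label is what excludes edges to other visits of the same cell.
        link⇒succ : ∀ i j → Link (nth i) (nth j) → suc (toℕ i) ≡ toℕ j
        link⇒succ i j (α , ε , a , m) with suc (toℕ i) ℕₚ.<? length K
        ... | no ¬p = contradiction
            (trans (≡sym a) (halt-action (vis (nth i))
            (trace-last t i (ℕₚ.≤-antisym (Finₚ.toℕ<n i) (ℕₚ.≮⇒≥ ¬p))))) λ ()
          where
          halt-action : ∀ ℓ → proj₂ ℓ ≡ nothing → action ℓ ≡ nothing
          halt-action (τ , nothing) _ = refl
        ... | yes p with trace-link t i (fromℕ< p) (≡sym (Finₚ.toℕ-fromℕ< p))
        ... | α' , ε' , a' , m' with Maybeₚ.just-injective (trans (≡sym a) a')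
        ... | q with cong (λ x → proj₁ (proj₂ (proj₂ x))) q | cong (λ x → proj₂ (proj₂ (proj₂ x))) q
        ... | refl | slot≡ = trans (≡sym (Finₚ.toℕ-fromℕ< p)) (cong toℕ (cells-injective {fromℕ< p} {j}
                (cong₂ _,_ (Finₚ.toℕ-injective (Maybeₚ.just-injective (trans (≡sym m') m))) (≡sym slot≡))))

      Out-trace : Out visitT (tgr w) U (pathG proj₂ K)
      Out-trace = record
        { f = proj₁ ∘ nth
        ; f-inj = cells-injective
        ; f-surj = λ p σ l → let i , q = ∈K⇒nth (to (Marked⇔ (p , σ)) (to (Nd-visit U p σ) (from (l σ) refl))) in i , cong proj₁ q
        ; f-lab = λ i σ → ⇔.trans (Nd-visit U (proj₁ (nth i)) σ) (label⇔ i σ)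
        ; f-edge = λ { i 0F j → ⇔.trans (≡ᵇ⇔ (suc (toℕ i)) (toℕ j)) (⇔.trans (mk⇔
            (λ p → proj₂ (nth i) , proj₂ (nth j) , from (label⇔ i (proj₂ (nth i))) refl , from
                (label⇔ j (proj₂ (nth j))) refl , trace-link t i j p)
            (λ (c , c' , m , m' , L) → link⇒succ i j (subst₂ (λ c c' → Link (proj₁ (nth i) , c) (proj₁ (nth j) , c'))
               (≡sym (to (label⇔ i c) m)) (≡sym (to (label⇔ j c') m')) L)))
                   (⇔.sym (Ed-visit U (proj₁ (nth i)) (proj₁ (nth j))))) } }

      visitT-trace : visitT ⊨ tgr w ↦ pathG proj₂ K
      visitT-trace = U , ⊤F-intro (tgr w) VF.[] U , Out-trace

      accepting : pos e₀ ≡ 0 → state (vis e₀) ≡ qin → Sem (pathG proj₂ K) acceptingF VF.[] VF.[]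
      accepting p q = from (sem (m-acceptingF {pathG proj₂ K})) (IsPath-pathG proj₂ e₀ es ,
        (0F , (λ (v , _ , e) → contradiction (to (≡ᵇ⇔ (suc (toℕ v)) 0) e) λ ()) , trans
            (≡sym (All.head (trace-fits t))) (cong (symAt w) p) , q) ,
        (Fin.fromℕ (length es) , (λ (v , _ , e) → ℕₚ.<⇒≢ (Finₚ.toℕ<n v)
            (trans (≡sym (to (≡ᵇ⇔ (suc (toℕ (Fin.fromℕ (length es)))) (toℕ v)) e)) (cong suc (Finₚ.toℕ-fromℕ _)))) ,
           trace-last t (Fin.fromℕ (length es)) (cong suc (Finₚ.toℕ-fromℕ _))))

    visits-here : ∀ q i cs → visits M w i ((q , i) ∷ cs) ≡ suc (visits M w i cs)
    visits-here q i cs = cong length (Listₚ.filter-accept (λ c → proj₂ c ℕₚ.≟ i) {q , i} {cs} refl)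

    -- Handing a configuration from the future to the past preserves the total, so the bound `k` on
    -- it is an invariant of `trace`.
    visits-∷ : ∀ p c cs ds → visits M w p (c ∷ cs) + visits M w p ds ≡ visits M w p cs + visits M w p (c ∷ ds)
    visits-∷ p c cs ds with proj₂ c ℕₚ.≟ p
    ... | yes e = trans (cong (λ xs → length xs + _) (Listₚ.filter-accept (λ c → proj₂ c ℕₚ.≟ p) {c} {cs} e))
      (trans (≡sym (ℕₚ.+-suc _ _))
          (cong (visits M w p cs +_) (≡sym (cong length (Listₚ.filter-accept (λ c → proj₂ c ℕₚ.≟ p) {c} {ds} e)))))
    ... | no n = cong₂ (λ xs ys → length xs + length ys) (Listₚ.filter-reject (λ c → proj₂ c ℕₚ.≟ p) {c} {cs} n)
        (≡sym (Listₚ.filter-reject (λ c → proj₂ c ℕₚ.≟ p) {c} {ds} n))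

    visits-mono : ∀ p c cs → visits M w p cs ≤ visits M w p (c ∷ cs)
    visits-mono p c cs with proj₂ c ℕₚ.≟ p
    ... | yes e = subst (visits M w p cs ≤_)
        (≡sym (cong length (Listₚ.filter-accept (λ c → proj₂ c ℕₚ.≟ p) {c} {cs} e))) (ℕₚ.n≤1+n _)
    ... | no n = ℕₚ.≤-reflexive (≡sym (cong length (Listₚ.filter-reject (λ c → proj₂ c ℕₚ.≟ p) {c} {cs} n)))

    -- The slot of a visit is the number of earlier visits to the same cell.
    Fresh : List (Config Q) → Entry → Set
    Fresh past e = visits M w (pos e) past ≤ toℕ (proj₂ (proj₁ e))

    -- Every later entry is `Fresh` for a past that includes the head. At the head's own cell its
    -- slot is therefore strictly larger, which makes all pairs of cell and slot distinct.
    trace : ∀ past {q i z cs} → Comp M w (q , i) z cs → i < suc (suc (length w)) →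
            (∀ p → visits M w p past + visits M w p cs ≤ k) →
            ∃ λ e → ∃ λ es → Trace e es z × DistinctCells (e ∷ es) × All (Fresh past) (e ∷ es) ×
            pos e ≡ i × toℕ (proj₂ (proj₁ e)) ≡ visits M w i past × state (vis e) ≡ q

    module Head (past : List (Config Q)) (q : Fin Q) (i : ℕ) (cs : List (Config Q)) (i< : i < suc (suc (length w)))
                (b : ∀ p → visits M w p past + visits M w p ((q , i) ∷ cs) ≤ k) where

      slot< : visits M w i past < k
      slot< = ℕₚ.≤-trans (ℕₚ.≤-trans (s≤s (ℕₚ.m≤m+n _ (visits M w i cs)))
        (ℕₚ.≤-reflexive (trans (≡sym (ℕₚ.+-suc _ _))
            (cong (visits M w i past +_) (≡sym (visits-here q i cs)))))) (b i)

      slot : Fin k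
      slot = fromℕ< slot<

      slot≡ : toℕ slot ≡ visits M w i past
      slot≡ = Finₚ.toℕ-fromℕ< slot<

      cell : Cell
      cell = fromℕ< i<

      cell≡ : toℕ cell ≡ i
      cell≡ = Finₚ.toℕ-fromℕ< i<

      entry : Visit → Entry
      entry ℓ = (cell , slot) , code FV ℓ

      vis≡ : ∀ ℓ → vis (entry ℓ) ≡ ℓ
      vis≡ = decode-code FV

      fits : ∀ ℓ → symAt w i ≡ proj₁ ℓ → Fits (entry ℓ)
      fits ℓ e = trans (cong (symAt w) cell≡) (trans e (≡sym (cong proj₁ (vis≡ ℓ))))

      fresh : ∀ ℓ → Fresh past (entry ℓ)
      fresh ℓ = ℕₚ.≤-reflexive (trans (cong (λ p → visits M w p past) cell≡) (≡sym slot≡))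

      differs : ∀ ℓ {x} → Fresh ((q , i) ∷ past) x → (cell , slot) ≢ proj₁ x
      differs ℓ {x} f e = ℕₚ.<⇒≢
          (ℕₚ.≤-trans (ℕₚ.≤-reflexive (trans (cong suc slot≡) (trans (≡sym (visits-here q i past))
        (cong (λ p → visits M w p ((q , i) ∷ past)) (trans (≡sym cell≡) (cong (toℕ ∘ proj₁) e)))))) f)
            (cong (toℕ ∘ proj₂) e)

      older : ∀ {x} → Fresh ((q , i) ∷ past) x → Fresh past x
      older {x} = ℕₚ.≤-trans (visits-mono (pos x) (q , i) past)

      cons : ∀ {α q' j z e' es} → Step M w (q , i) α (q' , j) → Trace e' es z → DistinctCells (e' ∷ es) →
             All (Fresh ((q , i) ∷ past)) (e' ∷ es) → pos e' ≡ j → state (vis e') ≡ q' →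
             ∃ λ e → ∃ λ es → Trace e es (α ++ z) × DistinctCells (e ∷ es) × All (Fresh past) (e ∷ es) ×
             pos e ≡ i × toℕ (proj₂ (proj₁ e)) ≡ visits M w i past × state (vis e) ≡ q
      cons {α} {e' = e'} {es} S t d fr p≡ q≡ =
        let ℓ , ε , _ , _ , s , st , a , m = step-action (proj₂ (proj₁ e')) S
            act = trans (cong action (vis≡ ℓ)) (trans a (cong (λ q → just (q , α , ε , proj₂ (proj₁ e'))) (≡sym q≡)))
            mv = trans (cong (λ i → move i ε) cell≡) (trans m (cong just (≡sym p≡)))
        in entry ℓ , e' ∷ es , step (fits ℓ s) act mv t , All.map (λ {x} → differs ℓ {x}) fr ∷ d , fresh ℓ ∷ All.map (λ {x} → older {x}) fr ,
           cell≡ , slot≡ , trans (cong state (vis≡ ℓ)) st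

    step-range : ∀ {q i α q' j} → Step M w (q , i) α (q' , j) → j < suc (suc (length w))
    step-range {j = j} (step-eq  _ _ _ _ j<) = subst (j <_) (length-tape w) j<
    step-range {j = j} (step-neq _ _ _ _ j<) = subst (j <_) (length-tape w) j<

    trace past {i = i} halt i< b = H.entry ℓ , [] , done (H.fits ℓ refl) (cong proj₂ (H.vis≡ ℓ)) , [] ∷ [] ,
        H.fresh ℓ ∷ [] , H.cell≡ , H.slot≡ , cong state (H.vis≡ ℓ)
      where
      module H = Head past qf i [] i< b
      ℓ : Visit
      ℓ = symAt w i , nothing
    trace past {q} {i} (next {cs = cs} S C) i< b =
      let e' , es , t , d , fr , p≡ , _ , q≡ = trace ((q , i) ∷ past) C (step-range S) (λ p → subst (_≤ k) (≡sym (visits-∷ p (q , i) past cs)) (b p))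
      in Head.cons past q i cs i< b S t d fr p≡ q≡

  Y : Set
  Y = ∃ λ v → ∃ λ z → concatMap (output ∘ visit) v ≡ marked z

  computeT : MSOT (2 + n₁) 1 V 1
  computeT = comp visitT (idT acceptingF)

  module _ (w : List (Fin n₁)) {h : Graph V 1} (t : computeT ⊨ tgr w ↦ h) where

    Result : Set
    Result = ∃ λ ((v , z , _) : Y) → (⟦ M ⟧G w z × computeT ⊨ tgr w ↦ pgr v) × Iso h (pgr v)

    fromPath : ∀ {u K} → (∃ λ U → Out visitT (tgr w) U (pgr (u ∷ K))) → Sem (pgr (u ∷ K)) acceptingF VF.[] VF.[] ×
               Iso (pgr (u ∷ K)) h → Result
    fromPath {u} {K} (U , o) (s , j) = result (sound w {x = u} {v = K} o s)
      where
      retarget : computeT ⊨ tgr w ↦ h → computeT ⊨ tgr w ↦ pgr (u ∷ K)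
      retarget (U , s , o) = U , s , Out-≅ o (Iso-sym j)
      result : (∃ λ z → ⟦ M ⟧G w z × concatMap (output ∘ visit) (u ∷ K) ≡ marked z) → Result
      result (z , c , e) = (u ∷ K , z , e) , (c , retarget t) , Iso-sym j

    fromGraph : (∃ λ g → visitT ⊨ tgr w ↦ g × (∀ g' → Iso g g' → idT acceptingF ⊨ g' ↦ h)) → Result
    fromGraph (g , (U , _ , o) , acc) = enumerate (isPath⇒pathG path)
      where
      path : IsPath g
      path = proj₁ (to (sem (m-acceptingF {g})) (proj₁ (idT-sound (acc g Iso-refl))))
      enumerate : (∃ λ u → ∃ λ K → Iso (pathG (lab g) (u ∷ K)) g) → Result
      enumerate (u , K , iso) = fromPath {lab g u} {map (lab g) K} (U , Out-≅ o i) (idT-sound (acc _ i))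
        where
        i : Iso g (pgr (lab g u ∷ map (lab g) K))
        i = Iso-trans (Iso-sym iso) (pathG-≅ (lab g) (u ∷ K) refl)

  -- Which visit words describe computations is not characterized independently: the relation keeps
  -- the transduction itself and adds that the decoded output is realized by `M`.
  -- `computeT-complete` then shows that enough visit words exist.
  computeT-realizes : Realizes tgr (pgr ∘ proj₁) computeT (λ w (v , z , _) → ⟦ M ⟧G w z × computeT ⊨ tgr w ↦ pgr v)
  computeT-realizes = record { sound = λ w t → fromGraph w t
      (comp-sound visitT (idT acceptingF) t) ; complete = proj₂ }

  computeT-complete : ∀ w {z cs} → Comp M w (qin , 0) z cs → Visiting M w k cs →
                      ∃ λ ((v , z' , _) : Y) → z' ≡ z × computeT ⊨ tgr w ↦ pgr v
  computeT-complete w {z} C b = fromTrace (trace w [] C (s≤s z≤n) b)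
    where
    fromTrace : (∃ λ e → ∃ λ es → Trace w e es z × DistinctCells w (e ∷ es) × All (Fresh w []) (e ∷ es) ×
                pos w e ≡ 0 × toℕ (proj₂ (proj₁ e)) ≡ 0 × state (vis w e) ≡ qin) →
                ∃ λ ((v , z' , _) : Y) → z' ≡ z × computeT ⊨ tgr w ↦ pgr v
    fromTrace (e , es , t , d , _ , p , _ , q) =
      (map proj₂ (e ∷ es) , z , trans (Listₚ.concatMap-map (output ∘ visit) proj₂ (e ∷ es))
          (trace-output w t)) , refl ,
      comp-complete visitT (idT acceptingF) (visitT-trace w t d)
          (idT-complete (accepting w t d p q) (pathG-≅ proj₂ (e ∷ es) refl))

  L : ℕ
  L = List.foldr (λ c m → length (output (visit c)) Data.Nat.⊔ m) 0 (allFin V)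

  bounded : ∀ c → length (output (visit c)) ≤ L
  bounded c = go (∈ₚ.∈-allFin c)
    where
    go : ∀ {cs} → c ∈ cs → length (output (visit c)) ≤ List.foldr
        (λ c m → length (output (visit c)) Data.Nat.⊔ m) 0 cs
    go (here refl) = ℕₚ.m≤m⊔n _ _
    go (there m)   = ℕₚ.≤-trans (go m) (ℕₚ.m≤n⊔m _ _)

  open HomT (output ∘ visit) L bounded using (homT; Out-hom)

  outputT-realizes : Realizes {X = Y} (pgr ∘ proj₁) (pgr ∘ marked) homT (λ (_ , z , _) z' → z' ≡ z)
  outputT-realizes = Realizes-function (proj₁ ∘ proj₂) λ (v , z , e) U →
    ⊤F-intro (pgr v) VF.[] U , subst (λ v' → Out homT (pgr v) U (pgr v')) e (Out-hom v U)

  gsmT : MSOT 1 n₁ 1 n₂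
  gsmT = comp (tapeT n₁) (comp computeT (comp homT (unmarkT n₂)))

  -- The bound enters where a realized pair must receive a visit word: some computation of it has to
  -- fit into `k` slots per cell.
  gsmT-realizes : (∀ w z → ⟦ M ⟧G w z → ∃ λ cs → Comp M w (qin , 0) z cs × Visiting M w k cs) →
                  Realizes egr egr gsmT ⟦ M ⟧G
  gsmT-realizes fv = Realizes-⇔
    (Realizes-comp (tapeT-realizes n₁)
        (Realizes-comp computeT-realizes (Realizes-comp outputT-realizes (unmarkT-realizes n₂))))
    (λ w z → mk⇔
      (λ { (_ , refl , _ , (c , _) , _ , refl , refl) → c })
      (λ c → build w z c (computeT-complete w (proj₁ (proj₂ (fv w z c))) (proj₂ (proj₂ (fv w z c))))))
    where
    build : ∀ w z → ⟦ M ⟧G w z → (∃ λ ((v , z' , _) : Y) → z' ≡ z × computeT ⊨ tgr w ↦ pgr v) → _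
    build w z c (y , e , t) = w , refl , y , (subst (⟦ M ⟧G w) (≡sym e) c , t) , z , ≡sym e , refl

-- From formulas to automata and finite semigroups

Finite-⊤ : Finite ⊤
Finite-⊤ = record { size = 1 ; code = λ _ → fzero ; decode = λ _ → tt ; decode-code = λ _ → refl }

Finite-Vec : ∀ {A : Set} → Finite A → ∀ n → Finite (Vec A n)
Finite-Vec F zero    = Finite-retract (λ _ → tt) (λ _ → []ᵥ) (λ { []ᵥ → refl }) Finite-⊤
Finite-Vec F (suc n) = Finite-retract (λ { (a ∷ᵥ v) → a , v }) (λ { (a , v) → a ∷ᵥ v }) (λ { (a ∷ᵥ v) → refl })
                         (Finite-× F (Finite-Vec F n))

≡⇒⇔ : ∀ {b c} → b ≡ c → b ≡ true ⇔ c ≡ true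
≡⇒⇔ refl = ⇔.refl

record DFA (A : Set) : Set where
  field
    q    : ℕ
    init : Fin q
    succ : Fin q → A → Fin q
    acc  : Fin q → Bool

  runFrom : Fin q → List A → Fin q
  runFrom = List.foldl succ

  accepts : List A → Bool
  accepts w = acc (runFrom init w)
open DFA using (accepts)

module _ {A S : Set} (F : Finite S) (s₀ : S) (succ : S → A → S) (acc : S → Bool) where

  fromFinite : DFA A
  fromFinite = record { q = size F ; init = code F s₀ ; succ = λ i a → code F
      (succ (decode F i) a) ; acc = acc ∘ decode F }

  accepts-fromFinite : ∀ w → accepts fromFinite w ≡ acc (List.foldl succ s₀ w)
  accepts-fromFinite w = trans (cong (acc ∘ decode F) (runs s₀ w)) (cong acc (decode-code F _))
    where
    runs : ∀ s w → DFA.runFrom fromFinite (code F s) w ≡ code F (List.foldl succ s w)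
    runs s []      = refl
    runs s (a ∷ w) rewrite decode-code F s = runs (succ s a) w

abstract
  complement : ∀ {A : Set} → DFA A → DFA A
  complement D = record { DFA D ; acc = not ∘ DFA.acc D }

  accepts-complement : ∀ {A : Set} (D : DFA A) w → accepts (complement D) w ≡ not (accepts D w)
  accepts-complement D w = refl

module _ {A : Set} (_⊕_ : Bool → Bool → Bool) (D E : DFA A) where
  private
    module D = DFA D
    module E = DFA E

  private
    F : Finite (Fin D.q × Fin E.q)
    F = Finite-× (Finite-Fin D.q) (Finite-Fin E.q)

    both : Fin D.q × Fin E.q → A → Fin D.q × Fin E.q
    both (i , j) a = D.succ i a , E.succ j a

    verdict : Fin D.q × Fin E.q → Bool
    verdict (i , j) = D.acc i ⊕ E.acc j

    runs : ∀ i j w → List.foldl both (i , j) w ≡ (D.runFrom i w , E.runFrom j w)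
    runs i j []      = refl
    runs i j (a ∷ w) = runs (D.succ i a) (E.succ j a) w

  abstract
    pair : DFA A
    pair = fromFinite F (D.init , E.init) both verdict

    accepts-pair : ∀ w → accepts pair w ≡ accepts D w ⊕ accepts E w
    accepts-pair w = trans (accepts-fromFinite F (D.init , E.init) both verdict w)
        (cong verdict (runs D.init E.init w))

module _ {A : Set} (P : A → Bool) where

  abstract
    someLetter : DFA A
    someLetter = fromFinite Finite-Bool false (λ b a → b ∨ P a) id

    accepts-someLetter : ∀ w → accepts someLetter w ≡ true ⇔ ∃ λ i → ∃ λ a → at w i ≡ just a × P a ≡ true
    accepts-someLetter w = ⇔.trans (≡⇒⇔ (accepts-fromFinite Finite-Bool false (λ b a → b ∨ P a) id w)) (
      ⇔.trans (runs false w) (mk⇔ (λ { (inj₁ ()) ; (inj₂ e) → e }) inj₂))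
      where
      runs : ∀ b w → List.foldl (λ b a → b ∨ P a) b w ≡ true ⇔
          (b ≡ true ⊎ ∃ λ i → ∃ λ a → at w i ≡ just a × P a ≡ true)
      runs b []      = mk⇔ inj₁ (λ { (inj₁ e) → e ; (inj₂ (_ , _ , () , _)) })
      runs b (a ∷ w) = ⇔.trans (runs (b ∨ P a) w) (mk⇔
        (λ { (inj₁ e) → fwd (to (∨⇔ b (P a)) e) ; (inj₂ (i , e)) → inj₂ (suc i , e) })
        (λ { (inj₁ e) → inj₁ (from (∨⇔ b (P a)) (inj₁ e)) ; (inj₂ (zero , _ , refl , e)) → inj₁ (from (∨⇔ b (P a)) (inj₂ e)) ; (inj₂ (suc i , e)) → inj₂ (i , e) }))
        where
        fwd : b ≡ true ⊎ P a ≡ true → b ≡ true ⊎ ∃ λ i → ∃ λ a' → at (a ∷ w) i ≡ just a' × P a' ≡ true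
        fwd (inj₁ e) = inj₁ e
        fwd (inj₂ e) = inj₂ (0 , a , refl , e)

module _ {A : Set} (P R : A → Bool) where

  Factor : List A → Set
  Factor w = ∃ λ i → ∃ λ a → ∃ λ b → at w i ≡ just a × at w (suc i) ≡ just b × P a ≡ true × R b ≡ true

  private
    -- The first bit tells whether the previous letter satisfied `P`, the second whether a factor
    -- has been completed.
    succ : Bool × Bool → A → Bool × Bool
    succ (p , f) a = P a , f ∨ (p ∧ R a)

    First : List A → Set
    First w = ∃ λ b → at w 0 ≡ just b × R b ≡ true

    runs : ∀ p f w → proj₂ (List.foldl succ (p , f) w) ≡ true ⇔ (f ≡ true ⊎ ((p ≡ true × First w) ⊎ Factor w))
    runs p f [] = mk⇔ inj₁ (λ { (inj₁ e) → e ; (inj₂ (inj₁ (_ , _ , () , _))) ; (inj₂ (inj₂ (_ , _ , _ , () , _))) })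
    runs p f (a ∷ w) = ⇔.trans (runs (P a) (f ∨ (p ∧ R a)) w) (mk⇔ fwd bwd)
      where
      fwd : (f ∨ (p ∧ R a) ≡ true) ⊎ ((P a ≡ true × First w) ⊎ Factor w) → f ≡ true ⊎
          ((p ≡ true × First (a ∷ w)) ⊎ Factor (a ∷ w))
      fwd (inj₁ e) with to (∨⇔ f _) e
      ... | inj₁ e' = inj₁ e'
      ... | inj₂ e' = let x , y = to (∧⇔ p _) e' in inj₂ (inj₁ (x , a , refl , y))
      fwd (inj₂ (inj₁ (x , b , e , y))) = inj₂ (inj₂ (0 , a , b , refl , e , x , y))
      fwd (inj₂ (inj₂ (i , F))) = inj₂ (inj₂ (suc i , F))
      bwd : f ≡ true ⊎ ((p ≡ true × First (a ∷ w)) ⊎ Factor (a ∷ w)) → (f ∨ (p ∧ R a) ≡ true) ⊎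
          ((P a ≡ true × First w) ⊎ Factor w)
      bwd (inj₁ e) = inj₁ (from (∨⇔ f _) (inj₁ e))
      bwd (inj₂ (inj₁ (x , _ , refl , y))) = inj₁ (from (∨⇔ f _) (inj₂ (from (∧⇔ p _) (x , y))))
      bwd (inj₂ (inj₂ (zero , _ , b , refl , e , x , y))) = inj₂ (inj₁ (x , b , e , y))
      bwd (inj₂ (inj₂ (suc i , F))) = inj₂ (inj₂ (i , F))

  abstract
    someFactor : DFA A
    someFactor = fromFinite (Finite-× Finite-Bool Finite-Bool) (false , false) succ proj₂

    accepts-someFactor : ∀ w → accepts someFactor w ≡ true ⇔ Factor w
    accepts-someFactor w = ⇔.trans
        (≡⇒⇔ (accepts-fromFinite (Finite-× Finite-Bool Finite-Bool) (false , false) succ proj₂ w))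
      (⇔.trans (runs false false w) (mk⇔ (λ { (inj₁ ()) ; (inj₂ (inj₁ (() , _))) ; (inj₂ (inj₂ F)) → F }) (inj₂ ∘ inj₂)))

module _ {A : Set} (P : A → Bool) where

  private
    count : Fin 3 → A → Fin 3
    count 0F a = Data.Bool.if P a then 1F else 0F
    count 1F a = Data.Bool.if P a then 2F else 1F
    count 2F a = 2F

    isOne : Fin 3 → Bool
    isOne 1F = true
    isOne _  = false

    two : ∀ w → ¬ isOne (List.foldl count 2F w) ≡ true
    two []      ()
    two (a ∷ w) = two w

    one : ∀ {n} (f : Fin n → A) → isOne (List.foldl count 1F (List.tabulate f)) ≡ true ⇔ (∀ i → P (f i) ≡ false)
    one {zero}  f = mk⇔ (λ _ ()) (λ _ → refl)
    one {suc n} f with P (f 0F) in eq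
    ... | true  = mk⇔ (⊥-elim ∘ two (List.tabulate (f ∘ fsuc))) (λ h → contradiction (trans (≡sym eq) (h 0F)) λ ())
    ... | false = ⇔.trans (one (f ∘ fsuc)) (mk⇔ (λ h → λ { 0F → eq ; (fsuc i) → h i }) (_∘ fsuc))

    zero' : ∀ {n} (f : Fin n → A) → isOne (List.foldl count 0F (List.tabulate f)) ≡ true ⇔ ∃ λ u → ∀ i → P
        (f i) ≡ ⌊ u ≟F i ⌋
    zero' {zero}  f = mk⇔ (λ ()) (λ ())
    zero' {suc n} f with P (f 0F) in eq
    ... | true  = ⇔.trans (one (f ∘ fsuc)) (mk⇔
      (λ h → 0F , λ { 0F → eq ; (fsuc i) → h i })
      (λ { (0F , h) i → h (fsuc i) ; (fsuc u , h) i → contradiction (trans (≡sym eq) (h 0F)) λ () }))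
    ... | false = ⇔.trans (zero' (f ∘ fsuc)) (mk⇔
      (λ (u , h) → fsuc u , λ { 0F → eq ; (fsuc i) → trans (h i) (suc≟ u i) })
      (λ { (0F , h) → contradiction (trans (≡sym eq) (h 0F)) λ () ; (fsuc u , h) → u , λ i → trans (h (fsuc i)) (≡sym (suc≟ u i)) }))
      where
      suc≟ : ∀ {n} (u i : Fin n) → ⌊ u ≟F i ⌋ ≡ ⌊ fsuc u ≟F fsuc i ⌋
      suc≟ u i with u ≟F i
      ... | yes _ = refl
      ... | no _  = refl

  abstract
    exactlyOne : DFA A
    exactlyOne = record { q = 3 ; init = 0F ; succ = count ; acc = isOne }

    accepts-exactlyOne : ∀ {n} (f : Fin n → A) → accepts exactlyOne (List.tabulate f) ≡ true ⇔ ∃ λ u → ∀ i → P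
        (f i) ≡ ⌊ u ≟F i ⌋
    accepts-exactlyOne = zero'

module _ {A B : Set} (add : Bool → A → B) (D : DFA B) where
  private module D = DFA D

  data Marking : List A → List B → Set where
    []  : Marking [] []
    _∷_ : ∀ b {a w w'} → Marking w w' → Marking (a ∷ w) (add b a ∷ w')

  private
    Moves : Subset D.q → A → Fin D.q → Set
    Moves X a j = ∃ λ i → lookupᵥ X i ≡ true × (D.succ i (add true a) ≡ j ⊎ D.succ i (add false a) ≡ j)

    moves? : ∀ X a → Decidable (Moves X a)
    moves? X a j = Finₚ.any? λ i → lookupᵥ X i ≟B true ×-dec
        (D.succ i (add true a) ≟F j ⊎-dec D.succ i (add false a) ≟F j)

    step : Subset D.q → A → Subset D.q
    step X a = mkSubset (moves? X a)

    start : Subset D.q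
    start = mkSubset (D.init ≟F_)

    accepting : Subset D.q → Bool
    accepting X = ⌊ Finₚ.any? (λ i → lookupᵥ X i ≟B true ×-dec D.acc i ≟B true) ⌋

    runs : ∀ X w → accepting (List.foldl step X w) ≡ true ⇔
      ∃ λ i → lookupᵥ X i ≡ true × ∃ λ w' → Marking w w' × D.acc (D.runFrom i w') ≡ true
    runs X []      = ⇔.trans (⌊⌋⇔ _) (∃-⇔ λ i → ⇔.refl ×-⇔ mk⇔ (λ e → [] , [] , e) (λ { (_ , [] , e) → e }))
    runs X (a ∷ w) = ⇔.trans (runs (step X a) w) (mk⇔ fwd bwd)
      where
      fwd : _ → _
      fwd (j , j∈ , w' , m , e) with to (∈mkSubset (moves? X a) j) j∈
      ... | i , i∈ , inj₁ refl = i , i∈ , _ , true ∷ m , e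
      ... | i , i∈ , inj₂ refl = i , i∈ , _ , false ∷ m , e
      bwd : _ → _
      bwd (i , i∈ , _ , true ∷ m , e)  = _ , from (∈mkSubset (moves? X a) _) (i , i∈ , inj₁ refl) , _ , m , e
      bwd (i , i∈ , _ , false ∷ m , e) = _ , from (∈mkSubset (moves? X a) _) (i , i∈ , inj₂ refl) , _ , m , e

  abstract
    -- Erasing a track leaves a choice of bit at every letter; the subset construction determinizes
    -- the resulting automaton.
    project : DFA A
    project = fromFinite (Finite-Vec Finite-Bool D.q) start step accepting

    accepts-project : ∀ w → accepts project w ≡ true ⇔ ∃ λ w' → Marking w w' × accepts D w' ≡ true
    accepts-project w = ⇔.trans (≡⇒⇔ (accepts-fromFinite (Finite-Vec Finite-Bool D.q) start step accepting w))
      (⇔.trans (runs start w) (mk⇔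
        (λ (i , i∈ , r) → subst (λ i → ∃ λ w' → Marking w w' × D.acc (D.runFrom i w') ≡ true)
            (≡sym (to (∈mkSubset (D.init ≟F_) i) i∈)) r)
        (λ r → D.init , from (∈mkSubset (D.init ≟F_) D.init) refl , r)))

  marking-tabulate⇔ : ∀ {n} (f : Fin n → A) w' → Marking (List.tabulate f) w' ⇔
                      ∃ λ (S : Subset n) → w' ≡ List.tabulate (λ i → add (lookupᵥ S i) (f i))
  marking-tabulate⇔ {zero}  f w' = mk⇔ (λ { [] → []ᵥ , refl }) (λ { (_ , refl) → [] })
  marking-tabulate⇔ {suc n} f w' = mk⇔
    (λ { (b ∷ m) → let S , e = to (marking-tabulate⇔ (f ∘ fsuc) _) m in (b ∷ᵥ S) , cong (_ ∷_) e })
    (λ { (b ∷ᵥ S , refl) → b ∷ from (marking-tabulate⇔ (f ∘ fsuc) _) (S , refl) })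

-- A node of `egr w` carries the letter of its outgoing edge, so the last one carries `nothing`.
-- Each variable contributes a track of bits.
Letter : ℕ → ℕ → ℕ → Set
Letter n fo so = Maybe (Fin n) × Vec Bool fo × Vec Bool so

module _ {n : ℕ} where

  encAt : ∀ {fo so} (w : List (Fin n)) → (Fin fo → Fin (suc (length w))) → (Fin so → Subset (suc (length w))) →
          Fin (suc (length w)) → Letter n fo so
  encAt w ρ U i = at w (toℕ i) , Vec.tabulate (λ x → ⌊ ρ x ≟F i ⌋) , Vec.tabulate (λ X → lookupᵥ (U X) i)

  enc : ∀ {fo so} (w : List (Fin n)) → (Fin fo → Fin (suc (length w))) → (Fin so → Subset (suc (length w))) →
      List (Letter n fo so)
  enc w ρ U = List.tabulate (encAt w ρ U)

  at-tabulate : ∀ {A : Set} {m} (f : Fin m → A) i {a} → at (List.tabulate f) i ≡ just a ⇔ ∃ λ j → toℕ j ≡ i × f j ≡ a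
  at-tabulate {m = zero}  f i       = mk⇔ (λ ()) (λ ())
  at-tabulate {m = suc m} f zero    = mk⇔ (λ e → 0F , refl , Maybeₚ.just-injective e) (λ { (0F , _ , e) → cong just e })
  at-tabulate {m = suc m} f (suc i) = ⇔.trans (at-tabulate (f ∘ fsuc) i) (mk⇔
    (λ (j , e , p) → fsuc j , cong suc e , p) (λ { (fsuc j , e , p) → j , ℕₚ.suc-injective e , p }))

  foBit : ∀ {fo so} → Fin fo → Letter n fo so → Bool
  foBit x (_ , v , _) = lookupᵥ v x

  soBit : ∀ {fo so} → Fin so → Letter n fo so → Bool
  soBit X (_ , _ , v) = lookupᵥ v X

  isLetter : ∀ {fo so} → Fin n → Letter n fo so → Bool
  isLetter γ (l , _) = ⌊ Maybeₚ.≡-dec _≟F_ l (just γ) ⌋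

  addNode : ∀ {fo so} → Bool → Letter n fo so → Letter n (suc fo) so
  addNode b (l , v , u) = l , b ∷ᵥ v , u

  addSet : ∀ {fo so} → Bool → Letter n fo so → Letter n fo (suc so)
  addSet b (l , v , u) = l , v , b ∷ᵥ u

  -- A node variable is a track with a single mark, which `exactlyOne` enforces at its quantifier;
  -- universal quantifiers go through complements. All nodes of `egr w` have the same label, so
  -- `labF` is always true.
  dfa : ∀ {fo so} → Formula 1 n fo so → DFA (Letter n fo so)
  dfa (labF σ x)    = record { q = 1 ; init = 0F ; succ = λ _ _ → 0F ; acc = λ _ → true }
  dfa (edgeF γ x y) = someFactor (λ a → foBit x a ∧ isLetter γ a) (foBit y)
  dfa (eqF x y)     = someLetter (λ a → foBit x a ∧ foBit y a)
  dfa (memF x X)    = someLetter (λ a → foBit x a ∧ soBit X a)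
  dfa (¬F φ)        = complement (dfa φ)
  dfa (φ ∧F ψ)      = pair _∧_ (dfa φ) (dfa ψ)
  dfa (φ ∨F ψ)      = pair _∨_ (dfa φ) (dfa ψ)
  dfa (∃₁ φ)        = project addNode (pair _∧_ (exactlyOne (foBit 0F)) (dfa φ))
  dfa (∀₁ φ)        = complement (project addNode (pair _∧_ (exactlyOne (foBit 0F)) (complement (dfa φ))))
  dfa (∃₂ φ)        = project addSet (dfa φ)
  dfa (∀₂ φ)        = complement (project addSet (complement (dfa φ)))

  module _ (w : List (Fin n)) where

    private
      g = egr w

    foBit⇔ : ∀ {fo so} {ρ : Fin fo → _} {U : Fin so → _} x i → foBit x (encAt w ρ U i) ≡ true ⇔ ρ x ≡ i
    foBit⇔ {ρ = ρ} x i rewrite Vecₚ.lookup∘tabulate (λ x → ⌊ ρ x ≟F i ⌋) x = ⌊⌋⇔ (ρ x ≟F i)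

    soBit≡ : ∀ {fo so} {ρ : Fin fo → _} {U : Fin so → _} X i → soBit X (encAt w ρ U i) ≡ lookupᵥ (U X) i
    soBit≡ {U = U} X i = Vecₚ.lookup∘tabulate (λ X → lookupᵥ (U X) i) X

    dfa-eq : ∀ {fo so} (x y : Fin fo) ρ (U : Fin so → _) → accepts (dfa (eqF x y)) (enc w ρ U) ≡ true ⇔ ρ x ≡ ρ y
    dfa-eq x y ρ U = ⇔.trans (accepts-someLetter _ (enc w ρ U)) (mk⇔ fwd bwd)
      where
      fwd : _ → ρ x ≡ ρ y
      fwd (i , a , e , p) with to (at-tabulate (encAt w ρ U) i) e
      ... | j , _ , refl = let b , c = to (∧⇔ _ _) p in trans (to (foBit⇔ {U = U} x j) b) (≡sym (to (foBit⇔ {U = U} y j) c))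
      bwd : ρ x ≡ ρ y → _
      bwd e = toℕ (ρ x) , _ , from (at-tabulate (encAt w ρ U) _) (ρ x , refl , refl) ,
        from (∧⇔ _ _) (from (foBit⇔ {U = U} x (ρ x)) refl , from (foBit⇔ {U = U} y (ρ x)) (≡sym e))

    dfa-mem : ∀ {fo so} (x : Fin fo) (X : Fin so) ρ U → accepts (dfa (memF x X)) (enc w ρ U) ≡ true ⇔ lookupᵥ
        (U X) (ρ x) ≡ true
    dfa-mem x X ρ U = ⇔.trans (accepts-someLetter _ (enc w ρ U)) (mk⇔ fwd bwd)
      where
      fwd : _ → lookupᵥ (U X) (ρ x) ≡ true
      fwd (i , a , e , p) with to (at-tabulate (encAt w ρ U) i) e
      ... | j , _ , refl = let b , c = to (∧⇔ _ _) p in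
        subst (λ j → lookupᵥ (U X) j ≡ true) (≡sym (to (foBit⇔ {U = U} x j) b))
            (trans (≡sym (soBit≡ {ρ = ρ} {U} X j)) c)
      bwd : lookupᵥ (U X) (ρ x) ≡ true → _
      bwd e = toℕ (ρ x) , _ , from (at-tabulate (encAt w ρ U) _) (ρ x , refl , refl) ,
        from (∧⇔ _ _) (from (foBit⇔ {U = U} x (ρ x)) refl , trans (soBit≡ {ρ = ρ} {U} X (ρ x)) e)

    dfa-edge : ∀ {fo so} γ (x y : Fin fo) ρ (U : Fin so → _) → accepts (dfa (edgeF γ x y)) (enc w ρ U) ≡ true ⇔
        edge g (ρ x) γ (ρ y) ≡ true
    dfa-edge γ x y ρ U = ⇔.trans (accepts-someFactor _ _ (enc w ρ U))
        (⇔.trans (mk⇔ fwd bwd) (⇔.sym (egr-edge⇔ w (ρ x) γ (ρ y))))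
      where
      fwd : Factor (λ a → foBit x a ∧ isLetter γ a) (foBit y) (enc w ρ U) → suc (toℕ (ρ x)) ≡ toℕ (ρ y) × at w
          (toℕ (ρ x)) ≡ just γ
      fwd (i , _ , _ , e , e' , p , q) with to (at-tabulate (encAt w ρ U) i) e | to
          (at-tabulate (encAt w ρ U) (suc i)) e'
      ... | j , j≡ , refl | j' , j'≡ , refl =
        let b , c = to (∧⇔ (foBit x (encAt w ρ U j)) (isLetter γ (encAt w ρ U j))) p ; x≡ = to (foBit⇔ {U = U} x j) b ; y≡ = to (foBit⇔ {U = U} y j') q in
        trans (cong (suc ∘ toℕ) x≡) (trans (cong suc j≡) (trans (≡sym j'≡) (cong toℕ (≡sym y≡)))) ,
        trans (cong (at w ∘ toℕ) x≡) (to (⌊⌋⇔ (Maybeₚ.≡-dec _≟F_ (at w (toℕ j)) (just γ))) c)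
      bwd : suc (toℕ (ρ x)) ≡ toℕ (ρ y) × at w (toℕ (ρ x)) ≡ just γ → Factor (λ a → foBit x a ∧ isLetter γ a)
          (foBit y) (enc w ρ U)
      bwd (e , l) = toℕ (ρ x) , _ , _ , from (at-tabulate (encAt w ρ U) _) (ρ x , refl , refl) , from
          (at-tabulate (encAt w ρ U) _) (ρ y , ≡sym e , refl) ,
        from (∧⇔ _ _) (from (foBit⇔ {U = U} x (ρ x)) refl , from
            (⌊⌋⇔ (Maybeₚ.≡-dec _≟F_ (at w (toℕ (ρ x))) (just γ))) l) , from (foBit⇔ {U = U} y (ρ y)) refl

    private
      conj : ∀ {A : Set} {D E : DFA A} {v} {P Q : Set} → accepts D v ≡ true ⇔ P → accepts E v ≡ true ⇔ Q →
          accepts (pair _∧_ D E) v ≡ true ⇔ (P × Q)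
      conj {D = D} {E} {v} e f = ⇔.trans (≡⇒⇔ (accepts-pair _∧_ D E v)) (⇔.trans (∧⇔ _ _) (e ×-⇔ f))

      disj : ∀ {A : Set} {D E : DFA A} {v} {P Q : Set} → accepts D v ≡ true ⇔ P → accepts E v ≡ true ⇔ Q →
          accepts (pair _∨_ D E) v ≡ true ⇔ (P ⊎ Q)
      disj {D = D} {E} {v} e f = ⇔.trans (≡⇒⇔ (accepts-pair _∨_ D E v)) (⇔.trans (∨⇔ _ _) (e ⊎-⇔ f))

      neg : ∀ {A : Set} {D : DFA A} {v} {P : Set} → accepts D v ≡ true ⇔ P → accepts (complement D) v ≡ true ⇔ (¬ P)
      neg {D = D} {v} e = ⇔.trans (≡⇒⇔ (accepts-complement D v)) (⇔.trans (not⇔ _) (¬-⇔ e))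

    project-set : ∀ {fo so} {D : DFA (Letter n fo (suc so))} {ρ U} {P : Subset _ → Set} →
                  (∀ S → accepts D (enc w ρ (S VF.∷ U)) ≡ true ⇔ P S) → accepts (project addSet D)
                      (enc w ρ U) ≡ true ⇔ ∃ P
    project-set {D = D} {ρ} {U} e = ⇔.trans (accepts-project addSet D _) (mk⇔
      (λ (w' , m , a) → let S , q = to (marking-tabulate⇔ addSet D (encAt w ρ U) w') m in S , to (e S) (subst (λ v → accepts D v ≡ true) q a))
      (λ (S , p) → _ , from (marking-tabulate⇔ addSet D (encAt w ρ U) _) (S , refl) , from (e S) p))

    project-node : ∀ {fo so} {D : DFA (Letter n (suc fo) so)} {ρ U} {P : Fin _ → Set} →
                   (∀ u → accepts D (enc w (u VF.∷ ρ) U) ≡ true ⇔ P u) →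
                   accepts (project addNode (pair _∧_ (exactlyOne (foBit 0F)) D)) (enc w ρ U) ≡ true ⇔ ∃ P
    project-node {D = D} {ρ} {U} {P} e = ⇔.trans (accepts-project addNode E _) (mk⇔ fwd bwd)
      where
      E = pair _∧_ (exactlyOne (foBit 0F)) D
      marks : Subset (suc (length w)) → List _
      marks S = List.tabulate (λ i → addNode (lookupᵥ S i) (encAt w ρ U i))
      both : ∀ S → accepts E (marks S) ≡ true ⇔
          ((∃ λ u → ∀ i → lookupᵥ S i ≡ ⌊ u ≟F i ⌋) × accepts D (marks S) ≡ true)
      both S = conj {D = exactlyOne (foBit 0F)} {D} {marks S}
          (accepts-exactlyOne (foBit 0F) (λ i → addNode (lookupᵥ S i) (encAt w ρ U i))) ⇔.refl
      single : ∀ S u → (∀ i → lookupᵥ S i ≡ ⌊ u ≟F i ⌋) → marks S ≡ enc w (u VF.∷ ρ) U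
      single S u h = Listₚ.tabulate-cong (λ i → cong (λ b → addNode b (encAt w ρ U i)) (h i))
      fwd : _ → ∃ P
      fwd (w' , m , a) with to (marking-tabulate⇔ addNode E (encAt w ρ U) w') m
      ... | S , refl with to (both S) a
      ... | (u , h) , a' = u , to (e u) (subst (λ v → accepts D v ≡ true) (single S u h) a')
      bwd : ∃ P → _
      bwd (u , p) = _ , from (marking-tabulate⇔ addNode E (encAt w ρ U) _) (S , refl) ,
        from (both S) ((u , h) , subst (λ v → accepts D v ≡ true) (≡sym (single S u h)) (from (e u) p))
        where
        S = Vec.tabulate (λ i → ⌊ u ≟F i ⌋)
        h = Vecₚ.lookup∘tabulate (λ i → ⌊ u ≟F i ⌋)

    dfa-correct : ∀ {fo so} (φ : Formula 1 n fo so) ρ U → accepts (dfa φ) (enc w ρ U) ≡ true ⇔ Sem g φ ρ U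
    dfa-correct (labF 0F x)   ρ U = mk⇔ (λ _ → refl) (λ _ → const-run (enc w ρ U))
      where
      const-run : ∀ v → accepts (dfa (labF 0F x)) v ≡ true
      const-run v = refl
    dfa-correct (edgeF γ x y) ρ U = dfa-edge γ x y ρ U
    dfa-correct (eqF x y)     ρ U = dfa-eq x y ρ U
    dfa-correct (memF x X)    ρ U = dfa-mem x X ρ U
    dfa-correct (¬F φ)        ρ U = neg {D = dfa φ} {enc w ρ U} (dfa-correct φ ρ U)
    dfa-correct (φ ∧F ψ)      ρ U = conj {D = dfa φ} {dfa ψ} {enc w ρ U} (dfa-correct φ ρ U) (dfa-correct ψ ρ U)
    dfa-correct (φ ∨F ψ)      ρ U = disj {D = dfa φ} {dfa ψ} {enc w ρ U} (dfa-correct φ ρ U) (dfa-correct ψ ρ U)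
    dfa-correct (∃₁ φ)        ρ U = project-node {D = dfa φ} {ρ} {U} (λ u → dfa-correct φ (u VF.∷ ρ) U)
    dfa-correct (∀₁ φ)        ρ U = ⇔.trans
        (neg {D = project addNode (pair _∧_ (exactlyOne (foBit 0F)) (complement (dfa φ)))} {enc w ρ U}
        (project-node {D = complement (dfa φ)} {ρ} {U}
            (λ u → neg {D = dfa φ} {enc w (u VF.∷ ρ) U} (dfa-correct φ (u VF.∷ ρ) U))))
      (⇔.sym (∀⇔¬∃¬ (λ u → Sem? g φ (u VF.∷ ρ) U)))
    dfa-correct (∃₂ φ)        ρ U = project-set {D = dfa φ} {ρ} {U} (λ S → dfa-correct φ ρ (S VF.∷ U))
    dfa-correct (∀₂ φ)        ρ U = ⇔.trans (neg {D = project addSet (complement (dfa φ))} {enc w ρ U}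
        (project-set {D = complement (dfa φ)} {ρ} {U}
            (λ S → neg {D = dfa φ} {enc w ρ (S VF.∷ U)} (dfa-correct φ ρ (S VF.∷ U)))))
      (⇔.sym (∀⇔¬∃¬ (λ S → Sem? g φ ρ (S VF.∷ U))))

-- Unlike the state of an automaton, a semigroup value can be extended at either end.
record Recognizer (A : Set) : Set₁ where
  infixl 7 _·_
  field
    Mo  : Set
    fin : Finite Mo
    h   : List A → Mo
    _·_ : Mo → Mo → Mo
    hom : ∀ u v → h (u ++ v) ≡ h u · h v

-- The transition semigroup. State maps are vectors because these, unlike functions, are finite with
-- decidable equality; the left factor acts first.
transitions : ∀ {A : Set} → DFA A → Recognizer A
transitions D = record
  { Mo = Vec (Fin q) q ; fin = Finite-Vec (Finite-Fin q) q
  ; h = λ w → Vec.tabulate (λ i → runFrom i w)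
  ; _·_ = λ x y → Vec.tabulate (λ i → lookupᵥ y (lookupᵥ x i))
  ; hom = λ u v → Vecₚ.tabulate-cong (λ i → trans (Listₚ.foldl-++ succ i u v) (≡sym (trans
      (Vecₚ.lookup∘tabulate (λ j → runFrom j v) (lookupᵥ (Vec.tabulate (λ j → runFrom j u)) i))
      (cong (λ j → runFrom j v) (Vecₚ.lookup∘tabulate (λ j → runFrom j u) i))))) }
  where open DFA D

-- The product of the transition semigroups: one value then decides all hop formulas, and a single
-- annotation of the word serves every hop.
recognizeAll : ∀ {A : Set} m (D : Fin m → DFA A) → ∃ λ (R : Recognizer A) →
               ∃ λ (accept : Fin m → Recognizer.Mo R → Bool) → ∀ i w → accept i (Recognizer.h R w) ≡ accepts (D i) w
recognizeAll zero    D = record { Mo = ⊤ ; fin = Finite-⊤ ; h = λ _ → tt ; _·_ = λ _ _ → tt ; hom = λ _ _ →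
    refl } , (λ ()) , (λ ())
recognizeAll {A} (suc m) D = R×R' , accept' , correct
  where
  module R = Recognizer (transitions (D 0F))
  rest = recognizeAll m (D ∘ fsuc)
  module R' = Recognizer (proj₁ rest)
  R×R' : Recognizer A
  R×R' = record
    { Mo = R.Mo × R'.Mo ; fin = Finite-× R.fin R'.fin ; h = λ w → R.h w , R'.h w
    ; _·_ = λ (x , x') (y , y') → x R.· y , x' R'.· y' ; hom = λ u v → cong₂ _,_ (R.hom u v) (R'.hom u v) }
  accept' : Fin (suc m) → R.Mo × R'.Mo → Bool
  accept' 0F       (x , x') = DFA.acc (D 0F) (lookupᵥ x (DFA.init (D 0F)))
  accept' (fsuc i) (x , x') = proj₁ (proj₂ rest) i x'
  correct : ∀ i w → accept' i (R.h w , R'.h w) ≡ accepts (D i) w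
  correct 0F       w = cong (DFA.acc (D 0F)) (Vecₚ.lookup∘tabulate (λ i → DFA.runFrom (D 0F) i w) (DFA.init (D 0F)))
  correct (fsuc i) w = proj₂ (proj₂ rest) i w

-- Two-way machines

Finite-⊎ : ∀ {A B : Set} → Finite A → Finite B → Finite (A ⊎ B)
Finite-⊎ {A} {B} F G = record
  { size = size F + size G
  ; code = λ { (inj₁ a) → code F a ↑ˡ size G ; (inj₂ b) → size F ↑ʳ code G b }
  ; decode = λ i → dec (Fin.splitAt (size F) i)
  ; decode-code = λ { (inj₁ a) → trans (cong dec (Finₚ.splitAt-↑ˡ (size F) (code F a) (size G))) (cong inj₁ (decode-code F a))
                    ; (inj₂ b) → trans (cong dec (Finₚ.splitAt-↑ʳ (size F) (size G) (code G b)))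
                        (cong inj₂ (decode-code G b)) } }
  where
  dec : Fin (size F) ⊎ Fin (size G) → A ⊎ B
  dec (inj₁ i) = inj₁ (decode F i)
  dec (inj₂ j) = inj₂ (decode G j)

-- Finite visit by cutting loops

module LoopCutting {n₁ n₂} (M : GSM n₁ n₂) (w : List (Fin n₁)) where
  open GSM M

  SameLength : Config Q → Set
  SameLength c = ∀ {z z' cs cs'} → Comp M w c z cs → Comp M w c z' cs' → length z ≡ length z'

  sameLength-step : ∀ {c α c'} → SameLength c → Step M w c α c' → SameLength c'
  sameLength-step {α = α} s S {z} {z'} C C' = ℕₚ.+-cancelˡ-≡ (length α) _ _
    (trans (≡sym (Listₚ.length-++ α)) (trans (s (next S C) (next S C')) (Listₚ.length-++ α)))

  head∈ : ∀ {c z cs} → Comp M w c z cs → ∃ λ cs' → cs ≡ c ∷ cs'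
  head∈ halt       = [] , refl
  head∈ (next _ _) = _ , refl

  suffix : ∀ {c z cs d} → Comp M w c z cs → Unique cs → d ∈ cs →
           ∃ λ z₁ → ∃ λ z₂ → ∃ λ cs₂ → z ≡ z₁ ++ z₂ × Comp M w d z₂ cs₂ × Unique cs₂
  suffix {z = z} C u d∈ with head∈ C
  suffix {z = z} C u (here refl) | _ , refl = [] , z , _ , refl , C , u
  suffix (next {α = α} S C) (_ ∷ u) (there d∈) | _ , refl =
    let z₁ , z₂ , cs₂ , e , C₂ , u₂ = suffix C u d∈
    in α ++ z₁ , z₂ , cs₂ , trans (cong (α ++_) e) (≡sym (Listₚ.++-assoc α z₁ z₂)) , C₂ , u₂

  _≟C_ : DecidableEquality (Config Q)
  _≟C_ = ×ₚ.≡-dec _≟F_ ℕₚ._≟_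

  -- Repeating a loop would lengthen the output, so every loop has empty output and can be cut.
  cut : ∀ {c z cs} → Comp M w c z cs → SameLength c → ∃ λ cs' → Comp M w c z cs' × Unique cs'
  cut halt s = _ , halt , [] ∷ []
  cut {c} (next {α = α} {z = z} S C) s with cut C (sameLength-step s S)
  ... | cs' , C' , u' with Any.any? (c ≟C_) cs'
  ... | no c∉ = _ , next S C' , All.tabulate (λ d∈ e → c∉ (subst (_∈ cs') (≡sym e) d∈)) ∷ u'
  ... | yes c∈ = drop-loop (suffix C' u' c∈)
    where
    drop-loop : (∃ λ z₁ → ∃ λ z₂ → ∃ λ cs₂ → z ≡ z₁ ++ z₂ × Comp M w c z₂ cs₂ × Unique cs₂) →
                ∃ λ cs' → Comp M w c (α ++ z) cs' × Unique cs'
    drop-loop (z₁ , z₂ , cs₂ , e , C₂ , u₂) = cs₂ , subst (λ z → Comp M w c z cs₂)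
        (≡sym (trans eq (cong (_++ z₂) (empty (α ++ z₁) len)))) C₂ , u₂
      where
      eq : α ++ z ≡ (α ++ z₁) ++ z₂
      eq = trans (cong (α ++_) e) (≡sym (Listₚ.++-assoc α z₁ z₂))
      len : length ((α ++ z₁) ++ z₂) ≡ length z₂
      -- The computation with the loop and the one that skips it both start in `c`, so their outputs
      -- have the same length.
      len = trans (cong length (≡sym eq)) (s (next S C) C₂)
      empty : ∀ {z₂} (y : List (Fin n₂)) → length (y ++ z₂) ≡ length z₂ → y ≡ []
      empty []      _ = refl
      empty {z₂} (a ∷ y) e = ⊥-elim
          (ℕₚ.<⇒≢ (s≤s (ℕₚ.m≤n+m (length z₂) (length y))) (≡sym (trans (cong suc (≡sym (Listₚ.length-++ y))) e)))

  visits≤Q : ∀ {cs} → Unique cs → ∀ i → visits M w i cs ≤ Q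
  visits≤Q {cs} u i = subst (_≤ Q) (Listₚ.length-map proj₁ xs)
      (length≤ (states xs (Uniqueₚ.filter⁺ _ u) (λ c∈ → proj₂ (∈ₚ.∈-filter⁻ (λ c → proj₂ c ℕₚ.≟ i) {xs = cs} c∈))))
    where
    xs : List (Config Q)
    xs = filter (λ c → proj₂ c ℕₚ.≟ i) cs
    states : ∀ xs → Unique xs → (∀ {c} → c ∈ xs → proj₂ c ≡ i) → Unique (map proj₁ xs)
    states []       _       _ = []
    states (c ∷ xs) (n ∷ u) p = Allₚ.map⁺
        (All.tabulate (λ d∈ e → All.lookup n d∈
        (cong₂ _,_ e (trans (p (here refl)) (≡sym (p (there d∈))))))) ∷ states xs u (p ∘ there)

sameLength⇒FiniteVisit : ∀ {n₁ n₂} (M : GSM n₁ n₂) →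
    (∀ w {z z'} → ⟦ M ⟧G w z → ⟦ M ⟧G w z' → length z ≡ length z') → FiniteVisit M
sameLength⇒FiniteVisit M s = GSM.Q M , λ w z (cs , C) →
  let cs' , C' , u = LoopCutting.cut M w C (λ D D' → s w (_ , D) (_ , D')) in cs' , C' , LoopCutting.visits≤Q M w u

-- Machines from transition tables

∈concatMap : ∀ {A B : Set} (f : A → List B) {x y xs} → x ∈ xs → y ∈ f x → y ∈ concatMap f xs
∈concatMap f x∈ y∈ = ∈ₚ.∈-concatMap⁺ f (Any.map (λ { refl → y∈ }) x∈)

-- State 0 is the final state and state 1 a sink that receives the failed tests.
module Machine {n₁ n₂} {W : Set} (FW : Finite W) (s₀ : W)
               (tr : W → TSym n₁ → List (Maybe W × List (Fin n₂) × Dir)) where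

  target : Maybe W → Fin (2 + size FW)
  target nothing  = 0F
  target (just s) = fsuc (fsuc (code FW s))

  instr : Fin (size FW) → TSym n₁ → Maybe W × List (Fin n₂) × Dir → Instr (2 + size FW) n₁ n₂
  instr i τ (r , α , ε) = record { p = fsuc
      (fsuc i) ; σ = τ ; q₁ = target r ; α₁ = α ; ε₁ = ε ; q₀ = 1F ; α₀ = [] ; ε₀ = stay }

  symbols : List (TSym n₁)
  symbols = lend ∷ rend ∷ map sym (allFin n₁)

  ∈symbols : ∀ τ → τ ∈ symbols
  ∈symbols lend    = here refl
  ∈symbols rend    = there (here refl)
  ∈symbols (sym a) = there (there (∈ₚ.∈-map⁺ sym (∈ₚ.∈-allFin a)))

  instrsAt : Fin (size FW) → TSym n₁ → List (Instr (2 + size FW) n₁ n₂)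
  instrsAt i τ = map (instr i τ) (tr (decode FW i) τ)

  instrsOf : Fin (size FW) → List (Instr (2 + size FW) n₁ n₂)
  instrsOf i = concatMap (instrsAt i) symbols

  instrs : List (Instr (2 + size FW) n₁ n₂)
  instrs = concatMap instrsOf (allFin (size FW))

  ∈instrs⁺ : ∀ {s τ o} → o ∈ tr s τ → instr (code FW s) τ o ∈ instrs
  ∈instrs⁺ {s} {τ} {o} o∈ = ∈concatMap instrsOf (∈ₚ.∈-allFin (code FW s))
      (∈concatMap (instrsAt (code FW s)) (∈symbols τ)
    (∈ₚ.∈-map⁺ (instr (code FW s) τ) (subst (λ s → o ∈ tr s τ) (≡sym (decode-code FW s)) o∈)))

  ∈instrs⁻ : ∀ {ι} → ι ∈ instrs → ∃ λ i → ∃ λ τ → ∃ λ o → o ∈ tr (decode FW i) τ × ι ≡ instr i τ o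
  ∈instrs⁻ ι∈ with Any.satisfied (∈ₚ.∈-concatMap⁻ instrsOf {xs = allFin (size FW)} ι∈)
  ... | i , ι∈' with Any.satisfied (∈ₚ.∈-concatMap⁻ (instrsAt i) {xs = symbols} ι∈')
  ... | τ , ι∈'' with ∈ₚ.∈-map⁻ (instr i τ) ι∈''
  ... | o , o∈ , e = i , τ , o , o∈ , e

  machine : GSM n₁ n₂
  machine = record { Q = 2 + size FW ; δ = instrs ; qin = target (just s₀) ; qf = 0F
    ; δ-ok = All.tabulate (λ ι∈ → not-final (∈instrs⁻ ι∈)) }
    where
    not-final : ∀ {ι} → (∃ λ i → ∃ λ τ → ∃ λ o → o ∈ tr (decode FW i) τ × ι ≡ instr i τ o) → Instr.p ι ≢ 0F
    not-final (_ , _ , _ , _ , refl) ()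

  module _ (w : List (Fin n₁)) where

    Move : W → ℕ → Maybe W → List (Fin n₂) → ℕ → Set
    Move s i r α j = ∃ λ ε → (r , α , ε) ∈ tr s (symAt w i) × i < suc (suc (length w)) × move i ε ≡ just j ×
        j < suc (suc (length w))

    -- Only successful tests are recorded: a failed one leads to the sink, where no instruction
    -- starts, so it occurs in no halting computation.
    data Run : W → ℕ → List (Fin n₂) → Set where
      end  : ∀ {s i α j} → Move s i nothing α j → Run s i α
      cont : ∀ {s i s' α j z} → Move s i (just s') α j → Run s' j z → Run s i (α ++ z)

    run⇒comp : ∀ {s i z} → Run s i z → ∃ λ cs → Comp machine w (target (just s) , i) z cs
    move⇒step : ∀ {s i r α j} → Move s i r α j → Step machine w (target (just s) , i) α (target r , j)
    move⇒step {j = j} (ε , o∈ , i< , m , j<) = step-eq (∈instrs⁺ o∈) (at-tape w i<) refl m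
        (subst (j <_) (≡sym (length-tape w)) j<)
    run⇒comp {s} {i} {z} (end m) = _ , subst (λ z → Comp machine w (target (just s) , i) z _)
        (Listₚ.++-identityʳ z) (next (move⇒step m) halt)
    run⇒comp (cont m r) = _ , next (move⇒step m) (proj₂ (run⇒comp r))

    step⇒move : ∀ {q i α q' j} s → q ≡ fsuc (fsuc s) → Step machine w (q , i) α (q' , j) →
                q' ≡ 1F ⊎ ∃ λ r → q' ≡ target r × Move (decode FW s) i r α j
    step⇒move {i = i} {j = j} s e (step-eq {ι} ι∈ a refl m j<) = go (∈instrs⁻ ι∈) e m
      where
      go : (∃ λ i → ∃ λ τ → ∃ λ o → o ∈ tr (decode FW i) τ × ι ≡ instr i τ o) → Instr.p ι ≡ fsuc (fsuc s) →
          move i (Instr.ε₁ ι) ≡ just j →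
           Instr.q₁ ι ≡ 1F ⊎ ∃ λ r → Instr.q₁ ι ≡ target r × Move (decode FW s) i r (Instr.α₁ ι) j
      go (_ , τ , (r , α , ε) , o∈ , refl) refl m = inj₂
          (r , refl , ε , subst (λ τ → (r , α , ε) ∈ tr (decode FW s) τ) (≡sym (proj₂ (at-tape⁻ w {i} a))) o∈ ,
        proj₁ (at-tape⁻ w {i} a) , m , subst (j <_) (length-tape w) j<)
    step⇒move s e (step-neq {ι} ι∈ a n m j<) = go (∈instrs⁻ ι∈)
      where
      go : (∃ λ i → ∃ λ τ → ∃ λ o → o ∈ tr (decode FW i) τ × ι ≡ instr i τ o) → Instr.q₀ ι ≡ 1F ⊎ _
      go (_ , _ , _ , _ , refl) = inj₁ refl

    not-sink : ∀ {q i z cs} → q ≡ 1F → ¬ Comp machine w (q , i) z cs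
    not-sink () halt
    not-sink e (next S C) = no-step e S
      where
      no-step : ∀ {q i α c} → q ≡ 1F → ¬ Step machine w (q , i) α c
      no-step e (step-eq ι∈ _ _ _ _)  with ∈instrs⁻ ι∈
      no-step () (step-eq ι∈ _ _ _ _) | _ , _ , _ , _ , refl
      no-step e (step-neq ι∈ _ _ _ _)  with ∈instrs⁻ ι∈
      no-step () (step-neq ι∈ _ _ _ _) | _ , _ , _ , _ , refl

    final-output : ∀ {q i z cs} → q ≡ 0F → Comp machine w (q , i) z cs → z ≡ []
    final-output e halt = refl
    final-output e (next S C) = ⊥-elim (no-step e S)
      where
      no-step : ∀ {q i α c} → q ≡ 0F → ¬ Step machine w (q , i) α c
      no-step e (step-eq ι∈ _ _ _ _)  with ∈instrs⁻ ι∈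
      no-step () (step-eq ι∈ _ _ _ _) | _ , _ , _ , _ , refl
      no-step e (step-neq ι∈ _ _ _ _)  with ∈instrs⁻ ι∈
      no-step () (step-neq ι∈ _ _ _ _) | _ , _ , _ , _ , refl

    comp⇒run : ∀ {q i z cs} s → q ≡ fsuc (fsuc s) → Comp machine w (q , i) z cs → Run (decode FW s) i z
    comp⇒run s () halt
    comp⇒run s e (next {α = α} S C) with step⇒move s e S
    ... | inj₁ sink = ⊥-elim (not-sink sink C)
    ... | inj₂ (nothing , e' , m) rewrite final-output e' C = subst (Run _ _) (≡sym (Listₚ.++-identityʳ α)) (end m)
    ... | inj₂ (just s' , e' , m) = cont m (subst (λ s → Run s _ _) (decode-code FW s') (comp⇒run (code FW s') e' C))

    machine⇔ : ∀ z → ⟦ machine ⟧G w z ⇔ Run s₀ 0 z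
    machine⇔ z = mk⇔ (λ (cs , C) → subst (λ s → Run s 0 z) (decode-code FW s₀)
        (comp⇒run (code FW s₀) refl C)) run⇒comp

-- The guessing machine

when : ∀ {A P : Set} → Dec P → A → List A
when (yes _) a = a ∷ []
when (no _)  a = []

∈when⁻ : ∀ {A P : Set} (d : Dec P) {a x : A} → x ∈ when d a → P × x ≡ a
∈when⁻ (yes p) (here e) = p , e

∈when⁺ : ∀ {A P : Set} (d : Dec P) {a : A} → P → a ∈ when d a
∈when⁺ (yes _) p = here refl
∈when⁺ (no ¬p) p = ⊥-elim (¬p p)

drop-at : ∀ {A : Set} (xs : List A) i {a} → at xs i ≡ just a → List.drop i xs ≡ a ∷ List.drop (suc i) xs
drop-at (x ∷ xs) zero    refl = refl
drop-at (x ∷ xs) (suc i) e    = drop-at xs i e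

drop-end : ∀ {A : Set} (xs : List A) i → at xs i ≡ nothing → List.drop i xs ≡ []
drop-end []       zero    e = refl
drop-end []       (suc i) e = refl
drop-end (x ∷ xs) (suc i) e = drop-end xs i e

-- For each input letter some letter above it is written, and at ⊣ one more that projects to
-- `nothing`. This makes one letter for each node of `egr w`.
module Guess {n₁ n₃} (proj : Fin n₃ → Maybe (Fin n₁)) where

  proj? : ∀ ℓ l → Dec (proj ℓ ≡ l)
  proj? ℓ l = Maybeₚ.≡-dec _≟F_ (proj ℓ) l

  tr : Bool → TSym n₁ → List (Maybe Bool × List (Fin n₃) × Dir)
  tr false lend    = (just true , [] , right) ∷ []
  tr false _       = []
  tr true  (sym a) = concatMap (λ ℓ → when (proj? ℓ (just a)) (just true , ℓ ∷ [] , right)) (allFin n₃)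
  tr true  rend    = concatMap (λ ℓ → when (proj? ℓ nothing) (nothing , ℓ ∷ [] , stay)) (allFin n₃)
  tr true  lend    = []

  open Machine Finite-Bool false tr public using (machine)
  open Machine Finite-Bool false tr using (Run; end; cont; machine⇔)

  Spec : List (Fin n₁) → List (Fin n₃) → Set
  Spec v x = map proj x ≡ map just v ++ nothing ∷ []

  module _ (w : List (Fin n₁)) where

    private
      guesses : ∀ {A : Set} → Maybe (Fin n₁) → (Fin n₃ → A) → List A
      guesses l r = concatMap (λ ℓ → when (proj? ℓ l) (r ℓ)) (allFin n₃)

      ∈guess⁻ : ∀ {A : Set} {l} {r : Fin n₃ → A} {o} → o ∈ guesses l r → ∃ λ ℓ → proj ℓ ≡ l × o ≡ r ℓ
      ∈guess⁻ {l = l} {r} o∈ with Any.satisfied (∈ₚ.∈-concatMap⁻ (λ ℓ → when (proj? ℓ l) (r ℓ)) {xs = allFin n₃} o∈)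
      ... | ℓ , m = ℓ , ∈when⁻ (proj? ℓ l) m

      ∈guess⁺ : ∀ {A : Set} {l} {r : Fin n₃ → A} ℓ → proj ℓ ≡ l → r ℓ ∈ guesses l r
      ∈guess⁺ {l = l} {r} ℓ e = ∈concatMap (λ ℓ → when (proj? ℓ l) (r ℓ)) (∈ₚ.∈-allFin ℓ) (∈when⁺ (proj? ℓ l) e)

      Option : Set
      Option = Maybe Bool × List (Fin n₃) × Dir

      option⁻ : ∀ p {o : Option} → o ∈ tr true (symAt w (suc p)) →
        (∃ λ a → at w p ≡ just a × ∃ λ ℓ → proj ℓ ≡ just a × o ≡ (just true , ℓ ∷ [] , right)) ⊎
        (at w p ≡ nothing × ∃ λ ℓ → proj ℓ ≡ nothing × o ≡ (nothing , ℓ ∷ [] , stay))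
      option⁻ p o∈ with at w p
      ... | just a  = inj₁ (a , refl , ∈guess⁻ {l = just a} {λ ℓ → just true , ℓ ∷ [] , right} o∈)
      ... | nothing = inj₂ (refl , ∈guess⁻ {l = nothing} {λ ℓ → nothing , ℓ ∷ [] , stay} o∈)

      option-right : ∀ p {a ℓ} → at w p ≡ just a → proj ℓ ≡ just a → (just true , ℓ ∷ [] , right) ∈ tr true
          (symAt w (suc p))
      option-right p {a} {ℓ} e q rewrite e = ∈guess⁺ {l = just a} {λ ℓ → just true , ℓ ∷ [] , right} ℓ q

      option-end : ∀ p {ℓ} → at w p ≡ nothing → proj ℓ ≡ nothing → (nothing , ℓ ∷ [] , stay) ∈ tr true
          (symAt w (suc p))
      option-end p {ℓ} e q rewrite e = ∈guess⁺ {l = nothing} {λ ℓ → nothing , ℓ ∷ [] , stay} ℓ q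

    run⇒spec : ∀ {p x} → Run w true (suc p) x → Spec (List.drop p w) x
    run⇒spec {p} (end (ε , o∈ , _)) with option⁻ p o∈
    ... | inj₂ (e , ℓ , q , refl) rewrite drop-end w p e | q = refl
    run⇒spec {p} (cont (ε , o∈ , _ , m , _) r) with option⁻ p o∈
    run⇒spec {p} (cont (ε , o∈ , _ , refl , _) r) | inj₁ (a , e , ℓ , q , refl) rewrite drop-at w p e | q = cong
        (just a ∷_) (run⇒spec r)

    spec⇒run : ∀ {p} x → p ≤ length w → Spec (List.drop p w) x → Run w true (suc p) x
    spec⇒run {p} x p≤ s with at w p in e
    spec⇒run {p} x p≤ s | nothing rewrite drop-end w p e = last x s
      where
      last : ∀ x → map proj x ≡ nothing ∷ [] → Run w true (suc p) x
      last (ℓ ∷ []) q = end (stay , option-end p e (Listₚ.∷-injectiveˡ q) , s≤s (s≤s p≤) , refl , s≤s (s≤s p≤))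
    spec⇒run {p} x p≤ s | just a rewrite drop-at w p e = more x s
      where
      more : ∀ x → map proj x ≡ just a ∷ (map just (List.drop (suc p) w) ++ nothing ∷ []) → Run w true (suc p) x
      more (ℓ ∷ x) q = cont (right , option-right p e (Listₚ.∷-injectiveˡ q) , s≤s (s≤s p≤) , refl , s≤s
          (s≤s (at-just⇒< w e)))
        (spec⇒run x (at-just⇒< w e) (Listₚ.∷-injectiveʳ q))

    guess⇔ : ∀ x → ⟦ machine ⟧G w x ⇔ Spec w x
    guess⇔ x = ⇔.trans (machine⇔ w x)
        (mk⇔ fwd (λ s → cont (right , here refl , s≤s z≤n , refl , s≤s (s≤s z≤n)) (spec⇒run x z≤n s)))
      where
      fwd : ∀ {x} → Run w false 0 x → Spec w x
      fwd (end (_ , here () , _))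
      fwd (cont (_ , here refl , _ , refl , _) r) = run⇒spec r

    spec-length : ∀ {x} → Spec w x → length x ≡ suc (length w)
    spec-length {x} s = trans (≡sym (Listₚ.length-map proj x)) (trans (cong length s)
      (trans (Listₚ.length-++ (map just w)) (trans (cong (_+ 1) (Listₚ.length-map just w)) (ℕₚ.+-comm _ 1))))

  guess-FiniteVisit : FiniteVisit machine
  guess-FiniteVisit = sameLength⇒FiniteVisit machine (λ w {x} {x'} c c' →
    trans (spec-length w (to (guess⇔ w x) c)) (≡sym (spec-length w (to (guess⇔ w x') c'))))

-- The walking machine

at-take : ∀ {A : Set} (xs : List A) i {a} → at xs i ≡ just a → List.take (suc i) xs ≡ List.take i xs ++ a ∷ []
at-take (x ∷ xs) zero    refl = refl
at-take (x ∷ xs) (suc i) e    = cong (x ∷_) (at-take xs i e)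

at-<-just : ∀ {A : Set} (xs : List A) {i} → i < length xs → ∃ λ a → at xs i ≡ just a
at-<-just xs i< = _ , trans (cong (at xs) (≡sym (Finₚ.toℕ-fromℕ< i<))) (at-lookup xs (fromℕ< i<))

at-nothing⇒≥ : ∀ {A : Set} (xs : List A) {i} → at xs i ≡ nothing → length xs ≤ i
at-nothing⇒≥ []       {i}     e = z≤n
at-nothing⇒≥ (x ∷ xs) {suc i} e = s≤s (at-nothing⇒≥ xs e)

≡ᵇ-false : ∀ {m n} → m ≢ n → (m ≡ᵇ n) ≡ false
≡ᵇ-false {m} {n} p with m ≡ᵇ n in e
... | false = refl
... | true  = ⊥-elim (p (to (≡ᵇ⇔ m n) e))

≡ᵇ-refl : ∀ n → (n ≡ᵇ n) ≡ true
≡ᵇ-refl n = from (≡ᵇ⇔ n n) refl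

-- A walker reads a word annotated, at each position, with the semigroup values of the parts before and
-- after it. It first checks the annotation locally, then hops from marked position to marked position.
-- During a hop it carries the value of the part of the doubly marked word behind it, so the annotation
-- at the target suffices to decide acceptance of the whole marked word.
module Walker {n₁ n₂ k : ℕ} (C : ℕ) (R : Recognizer (Letter n₁ 2 k)) where
  open Recognizer R

  Control : Set
  Control = Maybe (Fin C)

  -- Source control, target control and output letter. As a source, `nothing` means that no output
  -- node has been reached yet; as a target, that the last one has been left.
  Hop : Set
  Hop = Control × Control × Maybe (Fin n₂)

  FC : Finite Control
  FC = Finite-Maybe (Finite-Fin C)

  FH : Finite Hop
  FH = Finite-× FC (Finite-× FC (Finite-Maybe (Finite-Fin n₂)))

  Base : Set
  Base = Maybe (Fin n₁) × Vec Bool k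

  FB : Finite Base
  FB = Finite-× (Finite-Maybe (Finite-Fin n₁)) (Finite-Vec Finite-Bool k)

  abstract
    FA : Finite (Base × Mo × Mo)
    FA = Finite-× FB (Finite-× fin fin)

  n₃ : ℕ
  n₃ = size FA

  base : Fin n₃ → Base
  base ℓ = proj₁ (decode FA ℓ)

  pre suf : Fin n₃ → Mo
  pre ℓ = proj₁ (proj₂ (decode FA ℓ))
  suf ℓ = proj₂ (proj₂ (decode FA ℓ))

  letter : Fin n₃ → Maybe (Fin n₁)
  letter ℓ = proj₁ (base ℓ)

  mark : Bool → Bool → Base → Letter n₁ 2 k
  mark b c (l , u) = l , b ∷ᵥ (c ∷ᵥ []ᵥ) , u

  -- Marks are predicates on positions, so that cutting a word only shifts them, and agreement on a
  -- part is a pointwise statement (`mk-cong`).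
  mk : (ℕ → Bool) → (ℕ → Bool) → List Base → List (Letter n₁ 2 k)
  mk f g []      = []
  mk f g (β ∷ v) = mark (f 0) (g 0) β ∷ mk (f ∘ suc) (g ∘ suc) v

  none : ℕ → Bool
  none _ = false

  at! : ℕ → ℕ → Bool
  at! p i = i ≡ᵇ p

  mk-cong : ∀ {f g f' g'} v → (∀ i → i < length v → f i ≡ f' i) → (∀ i → i < length v → g i ≡ g' i) →
      mk f g v ≡ mk f' g' v
  mk-cong []      e e' = refl
  mk-cong (β ∷ v) e e' = cong₂ _∷_ (cong₂ (λ b c → mark b c β) (e 0 (s≤s z≤n)) (e' 0 (s≤s z≤n)))
    (mk-cong v (λ i p → e (suc i) (s≤s p)) (λ i p → e' (suc i) (s≤s p)))

  mk-++ : ∀ f g u v → mk f g (u ++ v) ≡ mk f g u ++ mk (f ∘ (length u +_)) (g ∘ (length u +_)) v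
  mk-++ f g []      v = refl
  mk-++ f g (β ∷ u) v = cong (_ ∷_) (mk-++ (f ∘ suc) (g ∘ suc) u v)

  one : Bool → Bool → Fin n₃ → Mo
  one b c ℓ = h (mark b c (base ℓ) ∷ [])

  First Last : Fin n₃ → Set
  First ℓ = pre ℓ ≡ h []
  Last ℓ  = letter ℓ ≡ nothing × suf ℓ ≡ h []

  -- Prefix values are forced from the left and suffix values from the right. The condition on the
  -- letter excludes `nothing` before the last position.
  Adjacent : Fin n₃ → Fin n₃ → Set
  Adjacent ℓ ℓ' = letter ℓ ≢ nothing × pre ℓ' ≡ pre ℓ · one false false ℓ × suf ℓ ≡ one false false ℓ' · suf ℓ'

  _≟M_ : DecidableEquality Mo
  _≟M_ = Finite-≟ fin

  _≟l_ : DecidableEquality (Maybe (Fin n₁))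
  _≟l_ = Maybeₚ.≡-dec _≟F_

  first? : ∀ ℓ → Dec (First ℓ)
  first? ℓ = pre ℓ ≟M h []

  last? : ∀ ℓ → Dec (Last ℓ)
  last? ℓ = letter ℓ ≟l nothing ×-dec suf ℓ ≟M h []

  adjacent? : ∀ ℓ ℓ' → Dec (Adjacent ℓ ℓ')
  adjacent? ℓ ℓ' = ¬? (letter ℓ ≟l nothing) ×-dec pre ℓ' ≟M (pre ℓ · one false false ℓ) ×-dec suf ℓ ≟M
      (one false false ℓ' · suf ℓ')

  record Valid (x : List (Fin n₃)) : Set where
    field
      nonempty : ∃ λ ℓ → at x 0 ≡ just ℓ
      first    : ∀ {ℓ} → at x 0 ≡ just ℓ → First ℓ
      adjacent : ∀ {i ℓ ℓ'} → at x i ≡ just ℓ → at x (suc i) ≡ just ℓ' → Adjacent ℓ ℓ'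
      last     : ∀ {i ℓ} → at x i ≡ just ℓ → at x (suc i) ≡ nothing → Last ℓ

  -- `check ℓ` remembers the previous letter, `ctl d` stands at a point of departure, and `goR` and
  -- `goL` are hops in flight with the value they carry.
  Work : Set
  Work = (Fin 3 ⊎ Fin n₃) ⊎ (Control ⊎ (Bool × Hop × Mo))

  FW : Finite Work
  FW = Finite-⊎ (Finite-⊎ (Finite-Fin 3) (Finite-Fin n₃)) (Finite-⊎ FC (Finite-× Finite-Bool (Finite-× FH fin)))

  pattern init      = inj₁ (inj₁ 0F)
  pattern check₀    = inj₁ (inj₁ 1F)
  pattern rewind    = inj₁ (inj₁ 2F)
  pattern check ℓ   = inj₁ (inj₂ ℓ)
  pattern ctl d     = inj₂ (inj₁ d)
  pattern goR t m   = inj₂ (inj₂ (true , t , m))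
  pattern goL t m   = inj₂ (inj₂ (false , t , m))

  Option : Set
  Option = Maybe Work × List (Fin n₂) × Dir

  out : Hop → List (Fin n₂)
  out (d , d' , o) = Data.Maybe.maybe (_∷ []) [] o

  landing : Control → Maybe Work
  landing nothing  = nothing
  landing (just c) = just (ctl (just c))

  arrive : Hop → Option
  arrive t = landing (proj₁ (proj₂ t)) , out t , stay

  module _ (accept : Hop → Mo → Bool) where

    -- The hop is guessed at departure. It may land on the spot, or set out in either direction with
    -- the value of all that lies behind the head, departure mark included. A hop that never lands
    -- gets stuck at an end of the tape.
    depart : Control → Fin n₃ → Hop → List Option
    depart d ℓ t = when (Finite-≟ FC (proj₁ t) d ×-dec accept t ((pre ℓ · one true true ℓ) · suf ℓ) ≟B true)
        (arrive t) ++
      (when (Finite-≟ FC (proj₁ t) d) (just (goR t (pre ℓ · one true false ℓ)) , [] , right) ++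
       when (Finite-≟ FC (proj₁ t) d) (just (goL t (one true false ℓ · suf ℓ)) , [] , left))

    hops : List Hop
    hops = map (decode FH) (allFin (size FH))

    ∈hops : ∀ t → t ∈ hops
    ∈hops t = subst (_∈ hops) (decode-code FH t) (∈ₚ.∈-map⁺ (decode FH) (∈ₚ.∈-allFin (code FH t)))

    tr : Work → TSym n₃ → List Option
    tr init      lend     = (just check₀ , [] , right) ∷ []
    tr check₀    (sym ℓ)  = when (first? ℓ) (just (check ℓ) , [] , right)
    tr (check ℓ) (sym ℓ') = when (adjacent? ℓ ℓ') (just (check ℓ') , [] , right)
    tr (check ℓ) rend     = when (last? ℓ) (just rewind , [] , left)
    tr rewind    (sym ℓ)  = (just rewind , [] , left) ∷ []
    tr rewind    lend     = (just (ctl nothing) , [] , right) ∷ []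
    tr (ctl d)   (sym ℓ)  = concatMap (depart d ℓ) hops
    tr (goR t m) (sym ℓ)  = when (accept t ((m · one false true ℓ) · suf ℓ) ≟B true) (arrive t) ++
                            (just (goR t (m · one false false ℓ)) , [] , right) ∷ []
    tr (goL t m) (sym ℓ)  = when (accept t (pre ℓ · (one false true ℓ · m)) ≟B true) (arrive t) ++
                            (just (goL t (one false false ℓ · m)) , [] , left) ∷ []
    tr _         _        = []

    open Machine FW init tr public using (machine)
    open Machine FW init tr using (Run; end; cont; Move; machine⇔)

    module _ (x : List (Fin n₃)) where

      bs : List Base
      bs = map base x

      HopAt : Hop → ℕ → ℕ → Set
      HopAt t p p' = accept t (h (mk (at! p) (at! p') bs)) ≡ true

      data Hops : Control → ℕ → List (Fin n₂) → Set where
        stop : ∀ {d p p'} o → p < length x → p' < length x → HopAt (d , nothing , o) p p' → Hops d p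
            (out (d , nothing , o))
        step : ∀ {d c p p' z} o → p < length x → p' < length x → HopAt (d , just c , o) p p' → Hops (just c) p' z →
               Hops d p (out (d , just c , o) ++ z)

      prefixM suffixM : (ℕ → Bool) → (ℕ → Bool) → ℕ → Mo
      prefixM f g i = h (mk f g (map base (List.take i x)))
      suffixM f g i = h (mk (f ∘ (i +_)) (g ∘ (i +_)) (map base (List.drop i x)))

      prefix-cong : ∀ {f g f' g'} i → (∀ j → j < i → f j ≡ f' j) → (∀ j → j < i → g j ≡ g' j) →
          prefixM f g i ≡ prefixM f' g' i
      prefix-cong i e e' = cong h (mk-cong (map base (List.take i x)) (λ j p → e j (lt j p)) (λ j p → e' j (lt j p)))
        where
        lt : ∀ j → j < length (map base (List.take i x)) → j < i
        lt j p = ℕₚ.≤-trans p (subst (_≤ i)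
            (≡sym (trans (Listₚ.length-map base (List.take i x)) (Listₚ.length-take i x))) (ℕₚ.m⊓n≤m i _))

      suffix-cong : ∀ {f g f' g'} i → (∀ j → i ≤ j → f j ≡ f' j) → (∀ j → i ≤ j → g j ≡ g' j) →
          suffixM f g i ≡ suffixM f' g' i
      suffix-cong i e e' = cong h
          (mk-cong (map base (List.drop i x)) (λ j _ → e (i + j) (ℕₚ.m≤m+n i j)) (λ j _ → e' (i + j) (ℕₚ.m≤m+n i j)))

      prefix-step : ∀ f g {i ℓ} → at x i ≡ just ℓ → prefixM f g (suc i) ≡ prefixM f g i · one (f i) (g i) ℓ
      prefix-step f g {i} {ℓ} e = trans (cong h (trans (cong (mk f g ∘ map base) (at-take x i e))
          (trans (cong (mk f g) (Listₚ.map-++ base (List.take i x) (ℓ ∷ [])))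
          (trans (mk-++ f g u (base ℓ ∷ []))
            (cong (λ j → mk f g u ++ mark (f j) (g j) (base ℓ) ∷ []) len)))))
        (hom (mk f g u) (mark (f i) (g i) (base ℓ) ∷ []))
        where
        u = map base (List.take i x)
        len : length u + 0 ≡ i
        len = trans (ℕₚ.+-identityʳ _)
            (trans (Listₚ.length-map base (List.take i x))
            (trans (Listₚ.length-take i x) (ℕₚ.m≤n⇒m⊓n≡m (ℕₚ.<⇒≤ (at-just⇒< x e)))))

      suffix-step : ∀ f g {i ℓ} → at x i ≡ just ℓ → suffixM f g i ≡ one (f i) (g i) ℓ · suffixM f g (suc i)
      suffix-step f g {i} {ℓ} e = trans
          (cong h (trans (cong (mk (f ∘ (i +_)) (g ∘ (i +_)) ∘ map base) (drop-at x i e))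
          (cong₂ (λ j v → mark (f j) (g j) (base ℓ) ∷ v) (ℕₚ.+-identityʳ i)
            (mk-cong (map base (List.drop (suc i) x)) (λ j _ → cong f (ℕₚ.+-suc i j))
                (λ j _ → cong g (ℕₚ.+-suc i j))))))
        (hom (mark (f i) (g i) (base ℓ) ∷ []) (mk (f ∘ (suc i +_)) (g ∘ (suc i +_)) (map base (List.drop (suc i) x))))

      split-word : ∀ f g {i} → i ≤ length x → h (mk f g bs) ≡ prefixM f g i · suffixM f g i
      split-word f g {i} i≤ = trans
          (cong h (trans (cong (mk f g)
          (trans (cong (map base) (≡sym (Listₚ.take++drop≡id i x)))
          (Listₚ.map-++ base (List.take i x) (List.drop i x))))
          (trans (mk-++ f g u v) (cong (λ j → mk f g u ++ mk (f ∘ (j +_)) (g ∘ (j +_)) v) len))))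
        (hom (mk f g u) _)
        where
        u = map base (List.take i x)
        v = map base (List.drop i x)
        len : length u ≡ i
        len = trans (Listₚ.length-map base (List.take i x)) (trans (Listₚ.length-take i x) (ℕₚ.m≤n⇒m⊓n≡m i≤))

      -- By `before` and `after` a mark does not affect the parts on either side of it. This is why
      -- values of the unmarked word suffice around both ends of a hop.
      before : ∀ {p i} j → i ≤ p → j < i → at! p j ≡ none j
      before j i≤p j<i = ≡ᵇ-false (ℕₚ.<⇒≢ (ℕₚ.≤-trans j<i i≤p))

      after : ∀ {p i} j → p < i → i ≤ j → at! p j ≡ none j
      after j p<i i≤j = ≡ᵇ-false (λ e → ℕₚ.<⇒≢ (ℕₚ.≤-trans p<i i≤j) (≡sym e))

      module _ (valid : Valid x) where
        open Valid valid

        pre-correct : ∀ i {ℓ} → at x i ≡ just ℓ → pre ℓ ≡ prefixM none none i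
        pre-correct zero    e = first e
        pre-correct (suc i) e =
          let ℓ' , e' = at-<-just x (ℕₚ.<-trans (ℕₚ.n<1+n i) (at-just⇒< x e)) ; _ , q , _ = adjacent e' e
          in trans q (trans (cong (_· one false false ℓ') (pre-correct i e')) (≡sym (prefix-step none none e')))

        -- The check ties each suffix value to the next one, so the induction is on the distance `d`
        -- to the right end.
        suf-correct : ∀ d i {ℓ} → suc i + d ≡ length x → at x i ≡ just ℓ → suf ℓ ≡ suffixM none none (suc i)
        suf-correct zero i len e = trans (proj₂ (last e (at-≥ x (ℕₚ.≤-reflexive (≡sym len')))))
            (≡sym (cong (h ∘ mk none none ∘ map base) (drop-end x (suc i) (at-≥ x (ℕₚ.≤-reflexive (≡sym len'))))))
          where
          len' : suc i ≡ length x
          len' = trans (≡sym (ℕₚ.+-identityʳ _)) len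
        suf-correct (suc d) i len e =
          let ℓ' , e' = at-<-just x {suc i} (subst (suc (suc i) ≤_) len' (ℕₚ.m≤m+n (suc (suc i)) d)) ; _ , _ , q = adjacent e e'
          in trans q (trans (cong (one false false ℓ' ·_) (suf-correct d (suc i) len' e')) (≡sym (suffix-step none none e')))
          where
          len' : suc (suc i) + d ≡ length x
          len' = trans (≡sym (ℕₚ.+-suc (suc i) d)) len

        suf-at : ∀ {i ℓ} → at x i ≡ just ℓ → suf ℓ ≡ suffixM none none (suc i)
        suf-at {i} e = suf-correct (length x ∸ suc i) i (ℕₚ.m+[n∸m]≡n (at-just⇒< x e)) e

        -- Word position `i` is tape cell `suc i`. There a hop to the right holds `carryR p i` and a
        -- hop to the left `carryL p (suc i)`; in both cases the cell under the head is not yet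
        -- included.
        carryR carryL : ℕ → ℕ → Mo
        carryR p i = prefixM (at! p) none i
        carryL p i = suffixM (at! p) none i

        departR : ∀ {p ℓ} → at x p ≡ just ℓ → pre ℓ · one true false ℓ ≡ carryR p (suc p)
        departR {p} {ℓ} e = trans (cong₂ (λ m b → m · one b false ℓ)
            (trans (pre-correct p e) (prefix-cong p (λ j l → ≡sym (before j ℕₚ.≤-refl l)) (λ _ _ → refl)))
                (≡sym (≡ᵇ-refl p)))
          (≡sym (prefix-step (at! p) none e))

        departL : ∀ {p ℓ} → at x p ≡ just ℓ → one true false ℓ · suf ℓ ≡ carryL p p
        departL {p} {ℓ} e = trans (cong₂ (λ b m → one b false ℓ · m) (≡sym (≡ᵇ-refl p))
            (trans (suf-at e) (suffix-cong {none} {none} {at! p} {none} (suc p)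
                (λ j l → ≡sym (after j (ℕₚ.n<1+n p) l)) (λ _ _ → refl))))
          (≡sym (suffix-step (at! p) none e))

        carryR-step : ∀ {p i ℓ} → p < i → at x i ≡ just ℓ → carryR p i · one false false ℓ ≡ carryR p (suc i)
        carryR-step {p} {i} {ℓ} p<i e = trans
            (cong (λ b → carryR p i · one b false ℓ) (≡sym (after i p<i ℕₚ.≤-refl)))
            (≡sym (prefix-step (at! p) none e))

        carryL-step : ∀ {p i ℓ} → i < p → at x i ≡ just ℓ → one false false ℓ · carryL p (suc i) ≡ carryL p i
        carryL-step {p} {i} {ℓ} i<p e = trans
            (cong (λ b → one b false ℓ · carryL p (suc i)) (≡sym (before i i<p ℕₚ.≤-refl)))
            (≡sym (suffix-step (at! p) none e))

        arriveStay : ∀ {p ℓ} → at x p ≡ just ℓ → (pre ℓ · one true true ℓ) · suf ℓ ≡ h (mk (at! p) (at! p) bs)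
        arriveStay {p} {ℓ} e = trans (cong₂ _·_
            (trans (cong₂ (λ m b → m · one b b ℓ)
                (trans (pre-correct p e) (prefix-cong p (λ j l → ≡sym (before j ℕₚ.≤-refl l))
                (λ j l → ≡sym (before j ℕₚ.≤-refl l)))) (≡sym (≡ᵇ-refl p)))
              (≡sym (prefix-step (at! p) (at! p) e)))
            (trans (suf-at e) (suffix-cong (suc p) (λ j l → ≡sym (after j (ℕₚ.n<1+n p) l))
                (λ j l → ≡sym (after j (ℕₚ.n<1+n p) l)))))
          (≡sym (split-word (at! p) (at! p) (at-just⇒< x e)))

        arriveR : ∀ {p i ℓ} → p < i → at x i ≡ just ℓ → (carryR p i · one false true ℓ) · suf ℓ ≡ h
            (mk (at! p) (at! i) bs)
        arriveR {p} {i} {ℓ} p<i e = trans (cong₂ _·_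
            (trans (cong₂ _·_ (prefix-cong i (λ _ _ → refl) (λ j l → ≡sym (before j ℕₚ.≤-refl l)))
                (cong₂ (λ b c → one b c ℓ) (≡sym (after i p<i ℕₚ.≤-refl)) (≡sym (≡ᵇ-refl i))))
              (≡sym (prefix-step (at! p) (at! i) e)))
            (trans (suf-at e) (suffix-cong (suc i) (λ j l → ≡sym (after j (ℕₚ.m<n⇒m<1+n p<i) l))
                (λ j l → ≡sym (after j (ℕₚ.n<1+n i) l)))))
          (≡sym (split-word (at! p) (at! i) (at-just⇒< x e)))

        arriveL : ∀ {p i ℓ} → i < p → at x i ≡ just ℓ → pre ℓ · (one false true ℓ · carryL p (suc i)) ≡ h
            (mk (at! p) (at! i) bs)
        arriveL {p} {i} {ℓ} i<p e = trans (cong₂ _·_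
            (trans (pre-correct i e) (prefix-cong i (λ j l → ≡sym (before j (ℕₚ.<⇒≤ i<p) l))
                (λ j l → ≡sym (before j ℕₚ.≤-refl l))))
            (trans (cong₂ _·_ (cong₂ (λ b c → one b c ℓ) (≡sym (before i i<p ℕₚ.≤-refl)) (≡sym (≡ᵇ-refl i)))
                (suffix-cong {at! p} {none} {at! p} {at! i} (suc i) (λ _ _ → refl)
                    (λ j l → ≡sym (after j (ℕₚ.n<1+n i) l))))
              (≡sym (suffix-step (at! p) (at! i) e))))
          (≡sym (split-word (at! p) (at! i) (ℕₚ.<⇒≤ (at-just⇒< x e))))

      goR⁻ : ∀ {t m o} i → o ∈ tr (goR t m) (symAt x (suc i)) → ∃ λ ℓ → at x i ≡ just ℓ ×
             ((accept t ((m · one false true ℓ) · suf ℓ) ≡ true × o ≡ arrive t) ⊎ o ≡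
                 (just (goR t (m · one false false ℓ)) , [] , right))
      goR⁻ {t} {m} i o∈ with at x i
      ... | just ℓ with ∈ₚ.∈-++⁻ (when (accept t ((m · one false true ℓ) · suf ℓ) ≟B true) (arrive t)) o∈
      ... | inj₁ a = ℓ , refl , inj₁ (∈when⁻ (accept t ((m · one false true ℓ) · suf ℓ) ≟B true) a)
      ... | inj₂ (here e) = ℓ , refl , inj₂ e

      goL⁻ : ∀ {t m o} i → o ∈ tr (goL t m) (symAt x (suc i)) → ∃ λ ℓ → at x i ≡ just ℓ ×
             ((accept t (pre ℓ · (one false true ℓ · m)) ≡ true × o ≡ arrive t) ⊎ o ≡
                 (just (goL t (one false false ℓ · m)) , [] , left))
      goL⁻ {t} {m} i o∈ with at x i
      ... | just ℓ with ∈ₚ.∈-++⁻ (when (accept t (pre ℓ · (one false true ℓ · m)) ≟B true) (arrive t)) o∈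
      ... | inj₁ a = ℓ , refl , inj₁ (∈when⁻ (accept t (pre ℓ · (one false true ℓ · m)) ≟B true) a)
      ... | inj₂ (here e) = ℓ , refl , inj₂ e

      Departure : Control → Fin n₃ → Option → Set
      Departure d ℓ o = ∃ λ t → proj₁ t ≡ d ×
        ((accept t ((pre ℓ · one true true ℓ) · suf ℓ) ≡ true × o ≡ arrive t) ⊎
         (o ≡ (just (goR t (pre ℓ · one true false ℓ)) , [] , right) ⊎ o ≡
             (just (goL t (one true false ℓ · suf ℓ)) , [] , left)))

      depart⁻ : ∀ {d ℓ o} t → o ∈ depart d ℓ t → Departure d ℓ o
      depart⁻ {d} {ℓ} t o∈ with ∈ₚ.∈-++⁻
          (when (Finite-≟ FC (proj₁ t) d ×-dec accept t ((pre ℓ · one true true ℓ) · suf ℓ) ≟B true) (arrive t)) o∈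
      ... | inj₁ a = let (s , c) , e = ∈when⁻ (Finite-≟ FC (proj₁ t) d ×-dec accept t ((pre ℓ · one true true ℓ) · suf ℓ) ≟B true) a in t , s , inj₁ (c , e)
      ... | inj₂ a with ∈ₚ.∈-++⁻
          (when (Finite-≟ FC (proj₁ t) d) (just (goR t (pre ℓ · one true false ℓ)) , [] , right)) a
      ... | inj₁ b = let s , e = ∈when⁻ (Finite-≟ FC (proj₁ t) d) b in t , s , inj₂ (inj₁ e)
      ... | inj₂ b = let s , e = ∈when⁻ (Finite-≟ FC (proj₁ t) d) b in t , s , inj₂ (inj₂ e)

      ctl⁻ : ∀ {d o} i → o ∈ tr (ctl d) (symAt x (suc i)) → ∃ λ ℓ → at x i ≡ just ℓ × Departure d ℓ o
      ctl⁻ {d} i o∈ with at x i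
      ... | just ℓ with Any.satisfied (∈ₚ.∈-concatMap⁻ (depart d ℓ) {xs = hops} o∈)
      ... | t , a = ℓ , refl , depart⁻ t a

      check⁻ : ∀ {ℓ o} i → o ∈ tr (check ℓ) (symAt x (suc i)) →
        (∃ λ ℓ' → at x i ≡ just ℓ' × Adjacent ℓ ℓ' × o ≡ (just (check ℓ') , [] , right)) ⊎
        (at x i ≡ nothing × Last ℓ × o ≡ (just rewind , [] , left))
      check⁻ {ℓ} i o∈ with at x i
      ... | just ℓ' = inj₁ (ℓ' , refl , ∈when⁻ (adjacent? ℓ ℓ') o∈)
      ... | nothing = inj₂ (refl , ∈when⁻ (last? ℓ) o∈)

      check₀⁻ : ∀ {o} i → o ∈ tr check₀ (symAt x (suc i)) → ∃ λ ℓ → at x i ≡ just ℓ × First ℓ × o ≡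
          (just (check ℓ) , [] , right)
      check₀⁻ i o∈ with at x i
      ... | just ℓ = ℓ , refl , ∈when⁻ (first? ℓ) o∈

      rewind⁻ : ∀ {o} i → o ∈ tr rewind (symAt x (suc i)) → o ≡ (just rewind , [] , left)
      rewind⁻ i o∈ with at x i
      rewind⁻ i (here e) | just ℓ = e

      rewound : ∀ {i z} → Run x rewind i z → Run x (ctl nothing) 1 z
      rewound {zero}  (end (_ , here () , _))
      rewound {zero}  (cont (_ , here refl , _ , refl , _) r) = r
      rewound {suc i} (end (_ , o∈ , _)) with rewind⁻ i o∈
      ... | ()
      rewound {suc i} (cont (_ , o∈ , _ , m , _) r) with rewind⁻ i o∈
      rewound {suc i} (cont (_ , o∈ , _ , refl , _) r) | refl = rewound r

      -- Validity from position `i` on, the part that a run in state `check` still has to establish.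
      Checked : ℕ → Set
      Checked i = (∀ {j ℓ ℓ'} → i ≤ j → at x j ≡ just ℓ → at x (suc j) ≡ just ℓ' → Adjacent ℓ ℓ') ×
                  (∀ {j ℓ} → i ≤ j → at x j ≡ just ℓ → at x (suc j) ≡ nothing → Last ℓ)

      just-≡ : ∀ {i ℓ ℓ'} → at x i ≡ just ℓ → at x i ≡ just ℓ' → ℓ ≡ ℓ'
      just-≡ e e' = Maybeₚ.just-injective (trans (≡sym e) e')

      checked : ∀ {i ℓ z} → at x i ≡ just ℓ → Run x (check ℓ) (suc (suc i)) z → Checked i × Run x (ctl nothing) 1 z
      checked {i} e (end (_ , o∈ , _)) with check⁻ (suc i) o∈
      ... | inj₁ (_ , _ , _ , ())
      ... | inj₂ (_ , _ , ())
      checked {i} {ℓ} e (cont (_ , o∈ , _ , m , _) r) with check⁻ (suc i) o∈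
      checked {i} {ℓ} e (cont (_ , o∈ , _ , refl , _) r) | inj₁ (ℓ' , e' , adj , refl) with checked e' r
      ... | (a , l) , r' = (a' , l') , r'
        where
        a' : ∀ {j ℓ₁ ℓ₂} → i ≤ j → at x j ≡ just ℓ₁ → at x (suc j) ≡ just ℓ₂ → Adjacent ℓ₁ ℓ₂
        a' i≤j p q with ℕₚ.m≤n⇒m<n∨m≡n i≤j
        ... | inj₁ i<j = a i<j p q
        ... | inj₂ refl = subst₂ Adjacent (just-≡ e p) (just-≡ e' q) adj
        l' : ∀ {j ℓ₁} → i ≤ j → at x j ≡ just ℓ₁ → at x (suc j) ≡ nothing → Last ℓ₁
        l' i≤j p q with ℕₚ.m≤n⇒m<n∨m≡n i≤j
        ... | inj₁ i<j = l i<j p q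
        ... | inj₂ refl = contradiction (trans (≡sym q) e') λ ()
      checked {i} {ℓ} e (cont (_ , o∈ , _ , refl , _) r) | inj₂ (e' , last , refl) = (a' , l') , rewound r
        where
        beyond : ∀ {j ℓ₁} → i < j → ¬ at x j ≡ just ℓ₁
        beyond i<j p = ℕₚ.<⇒≱ (at-just⇒< x p) (ℕₚ.≤-trans (at-nothing⇒≥ x e') i<j)
        a' : ∀ {j ℓ₁ ℓ₂} → i ≤ j → at x j ≡ just ℓ₁ → at x (suc j) ≡ just ℓ₂ → Adjacent ℓ₁ ℓ₂
        a' i≤j p q = ⊥-elim (beyond (s≤s i≤j) q)
        l' : ∀ {j ℓ₁} → i ≤ j → at x j ≡ just ℓ₁ → at x (suc j) ≡ nothing → Last ℓ₁
        l' i≤j p q with ℕₚ.m≤n⇒m<n∨m≡n i≤j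
        ... | inj₁ i<j = ⊥-elim (beyond i<j p)
        ... | inj₂ refl = subst Last (just-≡ e p) last

      start⇒valid : ∀ {z} → Run x init 0 z → Valid x × Run x (ctl nothing) 1 z
      start⇒valid (end (_ , here () , _))
      start⇒valid (cont (_ , here refl , _ , refl , _) (end (_ , o∈ , _))) with check₀⁻ 0 o∈
      ... | _ , _ , _ , ()
      start⇒valid (cont (_ , here refl , _ , refl , _) (cont (_ , o∈ , _ , m , _) r)) with check₀⁻ 0 o∈
      start⇒valid (cont (_ , here refl , _ , refl , _) (cont (_ , o∈ , _ , refl , _) r)) | ℓ , e , f ,
          refl with checked e r
      ... | (a , l) , r' = record { nonempty = ℓ , e ; first = λ p → subst First
          (just-≡ e p) f ; adjacent = a z≤n ; last = l z≤n } , r'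

      module _ (valid : Valid x) where

        -- Simultaneous induction on the run. A hop in flight is credited to its departure `p` until
        -- it lands, and an equation ties the carried value to `p`.
        soundCtl : ∀ {d p z} → Run x (ctl d) (suc p) z → Hops d p z
        soundR : ∀ {t m i p z} → Run x (goR t m) (suc i) z → p < i → p < length x → m ≡ carryR valid p i → Hops
            (proj₁ t) p z
        soundL : ∀ {t m i p z} → Run x (goL t m) i z → i ≤ p → p < length x → m ≡ carryL valid p i → Hops
            (proj₁ t) p z

        soundCtl {p = p} (end (_ , o∈ , _)) with ctl⁻ p o∈
        ... | ℓ , e , (d , nothing , o) , refl , inj₁ (acc , refl) =
          stop o (at-just⇒< x e) (at-just⇒< x e)
              (subst (λ m → accept (d , nothing , o) m ≡ true) (arriveStay valid e) acc)
        ... | ℓ , e , (d , just c , o) , refl , inj₁ (acc , ())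
        ... | ℓ , e , t , refl , inj₂ (inj₁ ())
        ... | ℓ , e , t , refl , inj₂ (inj₂ ())
        soundCtl {p = p} (cont (_ , o∈ , _ , m , _) r) with ctl⁻ p o∈
        soundCtl {p = p} (cont (_ , o∈ , _ , refl , _) r) | ℓ , e , (d , just c , o) , refl , inj₁ (acc , refl) =
          step o (at-just⇒< x e) (at-just⇒< x e)
              (subst (λ m → accept (d , just c , o) m ≡ true) (arriveStay valid e) acc) (soundCtl r)
        soundCtl {p = p} (cont (_ , o∈ , _ , refl , _) r) | ℓ , e , t , refl , inj₂ (inj₁ refl) = soundR r
            (ℕₚ.n<1+n p) (at-just⇒< x e) (departR valid e)
        soundCtl {p = p} (cont (_ , o∈ , _ , refl , _) r) | ℓ , e , t , refl , inj₂ (inj₂ refl) =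
            soundL r ℕₚ.≤-refl (at-just⇒< x e) (departL valid e)

        soundR {d , nothing , o} {i = i} (end (_ , o∈ , _)) p<i p< refl with goR⁻ i o∈
        ... | ℓ , e , inj₁ (acc , refl) = stop o p< (at-just⇒< x e)
            (subst (λ m → accept (d , nothing , o) m ≡ true) (arriveR valid p<i e) acc)
        ... | ℓ , e , inj₂ ()
        soundR {d , just c , o} {i = i} (end (_ , o∈ , _)) p<i p< refl with goR⁻ i o∈
        ... | ℓ , e , inj₁ (acc , ())
        ... | ℓ , e , inj₂ ()
        soundR {d , d' , o} {i = i} (cont (_ , o∈ , _ , m , _) r) p<i p< refl with goR⁻ i o∈
        soundR {d , just c , o} {i = i} (cont (_ , o∈ , _ , refl , _) r) p<i p< refl | ℓ , e , inj₁ (acc , refl) =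
          step o p< (at-just⇒< x e) (subst (λ m → accept (d , just c , o) m ≡ true) (arriveR valid p<i e) acc)
              (soundCtl r)
        soundR {d , nothing , o} {i = i} (cont (_ , o∈ , _ , m , _) r) p<i p< refl | ℓ , e , inj₁ (acc , ())
        soundR {d , d' , o} {i = i} (cont (_ , o∈ , _ , refl , _) r) p<i p< refl | ℓ , e , inj₂ refl = soundR r
            (ℕₚ.m<n⇒m<1+n p<i) p< (carryR-step valid p<i e)

        soundL {i = zero} (end (_ , () , _)) _ _ _
        soundL {i = zero} (cont (_ , () , _) _) _ _ _
        soundL {d , nothing , o} {i = suc i} (end (_ , o∈ , _)) i<p p< refl with goL⁻ i o∈
        ... | ℓ , e , inj₁ (acc , refl) = stop o p< (at-just⇒< x e)
            (subst (λ m → accept (d , nothing , o) m ≡ true) (arriveL valid i<p e) acc)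
        ... | ℓ , e , inj₂ ()
        soundL {d , just c , o} {i = suc i} (end (_ , o∈ , _)) i<p p< refl with goL⁻ i o∈
        ... | ℓ , e , inj₁ (acc , ())
        ... | ℓ , e , inj₂ ()
        soundL {d , d' , o} {i = suc i} (cont (_ , o∈ , _ , m , _) r) i<p p< refl with goL⁻ i o∈
        soundL {d , just c , o} {i = suc i} (cont (_ , o∈ , _ , refl , _) r) i<p p< refl | ℓ , e , inj₁ (acc , refl) =
          step o p< (at-just⇒< x e) (subst (λ m → accept (d , just c , o) m ≡ true) (arriveL valid i<p e) acc)
              (soundCtl r)
        soundL {d , nothing , o} {i = suc i} (cont (_ , o∈ , _ , m , _) r) i<p p< refl | ℓ , e , inj₁ (acc , ())
        soundL {d , d' , o} {i = suc i} (cont (_ , o∈ , _ , refl , _) r) i<p p< refl | ℓ , e , inj₂ refl =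
            soundL r (ℕₚ.<⇒≤ i<p) p< (carryL-step valid i<p e)

      ∈goR-arrive : ∀ {t m i ℓ} → at x i ≡ just ℓ → accept t ((m · one false true ℓ) · suf ℓ) ≡ true →
          arrive t ∈ tr (goR t m) (symAt x (suc i))
      ∈goR-arrive e acc rewrite e = ∈ₚ.∈-++⁺ˡ (∈when⁺ (_ ≟B true) acc)

      ∈goR : ∀ {t m i ℓ} → at x i ≡ just ℓ → (just (goR t (m · one false false ℓ)) , [] , right) ∈ tr (goR t m)
          (symAt x (suc i))
      ∈goR {t} {m} {i} {ℓ} e rewrite e = ∈ₚ.∈-++⁺ʳ
          (when (accept t ((m · one false true ℓ) · suf ℓ) ≟B true) (arrive t)) (here refl)

      ∈goL-arrive : ∀ {t m i ℓ} → at x i ≡ just ℓ → accept t (pre ℓ · (one false true ℓ · m)) ≡ true →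
          arrive t ∈ tr (goL t m) (symAt x (suc i))
      ∈goL-arrive e acc rewrite e = ∈ₚ.∈-++⁺ˡ (∈when⁺ (_ ≟B true) acc)

      ∈goL : ∀ {t m i ℓ} → at x i ≡ just ℓ → (just (goL t (one false false ℓ · m)) , [] , left) ∈ tr (goL t m)
          (symAt x (suc i))
      ∈goL {t} {m} {i} {ℓ} e rewrite e = ∈ₚ.∈-++⁺ʳ
          (when (accept t (pre ℓ · (one false true ℓ · m)) ≟B true) (arrive t)) (here refl)

      ∈ctl : ∀ {t o i ℓ} → at x i ≡ just ℓ → o ∈ depart (proj₁ t) ℓ t → o ∈ tr (ctl (proj₁ t)) (symAt x (suc i))
      ∈ctl {t} {ℓ = ℓ} e o∈ rewrite e = ∈concatMap (depart (proj₁ t) ℓ) (∈hops t) o∈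

      ∈depart-arrive : ∀ {t ℓ} → accept t ((pre ℓ · one true true ℓ) · suf ℓ) ≡ true → arrive t ∈ depart (proj₁ t) ℓ t
      ∈depart-arrive {t} {ℓ} acc = ∈ₚ.∈-++⁺ˡ
          (∈when⁺ (Finite-≟ FC (proj₁ t) (proj₁ t) ×-dec accept t ((pre ℓ · one true true ℓ) · suf ℓ) ≟B true)
          (refl , acc))

      ∈depart-R : ∀ {t ℓ} → (just (goR t (pre ℓ · one true false ℓ)) , [] , right) ∈ depart (proj₁ t) ℓ t
      ∈depart-R {t} {ℓ} = ∈ₚ.∈-++⁺ʳ
          (when (Finite-≟ FC (proj₁ t) (proj₁ t) ×-dec accept t ((pre ℓ · one true true ℓ) · suf ℓ) ≟B true)
          (arrive t))
        (∈ₚ.∈-++⁺ˡ (∈when⁺ (Finite-≟ FC (proj₁ t) (proj₁ t)) refl))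

      ∈depart-L : ∀ {t ℓ} → (just (goL t (one true false ℓ · suf ℓ)) , [] , left) ∈ depart (proj₁ t) ℓ t
      ∈depart-L {t} {ℓ} = ∈ₚ.∈-++⁺ʳ
          (when (Finite-≟ FC (proj₁ t) (proj₁ t) ×-dec accept t ((pre ℓ · one true true ℓ) · suf ℓ) ≟B true)
          (arrive t))
        (∈ₚ.∈-++⁺ʳ (when (Finite-≟ FC (proj₁ t) (proj₁ t))
            (just (goR t (pre ℓ · one true false ℓ)) , [] , right)) (∈when⁺ (Finite-≟ FC (proj₁ t) (proj₁ t)) refl))

      tape≤ : ∀ {i} → i < length x → suc i < suc (suc (length x))
      tape≤ p = s≤s (ℕₚ.m<n⇒m<1+n p)

      -- `land` stands for the run from the arrival on, so that the last hop, which halts, and the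
      -- others, which continue, share one construction.
      module _ (valid : Valid x) {t : Hop} {p p' : ℕ} {z : List (Fin n₂)} (p< : p < length x)
          (p'< : p' < length x) (hop : HopAt t p p')
               (land : ∀ {s} → arrive t ∈ tr s (symAt x (suc p')) → Run x s (suc p') z) where

        private
          ℓp = proj₁ (at-<-just x p<)
          ep = proj₂ (at-<-just x p<)
          ep' = proj₂ (at-<-just x p'<)

        runR : ∀ dist i → i + dist ≡ p' → p < i → Run x (goR t (carryR valid p i)) (suc i) z
        runR zero i e p<i with trans (≡sym (ℕₚ.+-identityʳ i)) e
        ... | refl = land (∈goR-arrive {t} ep' (trans (cong (accept t) (arriveR valid p<i ep')) hop))
        runR (suc dist) i e p<i = cont (right , ∈goR {t} ei , tape≤ i< , refl , s≤s (s≤s i<))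
            (subst (λ m → Run x (goR t m) (suc (suc i)) z) (≡sym (carryR-step valid p<i ei))
                (runR dist (suc i) (trans (≡sym (ℕₚ.+-suc i dist)) e) (ℕₚ.m<n⇒m<1+n p<i)))
          where
          i< : i < length x
          i< = ℕₚ.≤-trans (s≤s (ℕₚ.m+n≤o⇒m≤o i (ℕₚ.≤-reflexive e))) p'<
          ei = proj₂ (at-<-just x i<)

        runL : ∀ dist i → p' + dist ≡ i → i < p → Run x (goL t (carryL valid p (suc i))) (suc i) z
        runL zero i e i<p with trans (≡sym (ℕₚ.+-identityʳ p')) e
        ... | refl = land (∈goL-arrive {t} ep' (trans (cong (accept t) (arriveL valid i<p ep')) hop))
        runL (suc dist) zero e i<p = contradiction (trans (≡sym (ℕₚ.+-suc p' dist)) e) λ ()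
        runL (suc dist) (suc i) e i<p = cont
            (left , ∈goL {t} ei , tape≤ i< , refl , tape≤ (ℕₚ.<-trans (ℕₚ.n<1+n i) i<))
            (subst (λ m → Run x (goL t m) (suc i) z) (≡sym (carryL-step valid i<p ei))
              (runL dist i (ℕₚ.suc-injective (trans (≡sym (ℕₚ.+-suc p' dist)) e)) (ℕₚ.<-trans (ℕₚ.n<1+n i) i<p)))
          where
          i< : suc i < length x
          i< = ℕₚ.<-trans i<p p<
          ei = proj₂ (at-<-just x i<)

        runHop : Run x (ctl (proj₁ t)) (suc p) z
        runHop with ℕₚ.<-cmp p p'
        ... | tri≈ _ refl _ = land
            (∈ctl {t} ep (∈depart-arrive {t} {ℓp} (trans (cong (accept t) (arriveStay valid ep)) hop)))
        ... | tri< p<p' _ _ = cont (right , ∈ctl {t} ep (∈depart-R {t} {ℓp}) , tape≤ p< , refl , s≤s (s≤s p<))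
            (subst (λ m → Run x (goR t m) (suc (suc p)) z) (≡sym (departR valid ep))
                (runR (p' ∸ suc p) (suc p) (ℕₚ.m+[n∸m]≡n p<p') (ℕₚ.n<1+n p)))
        ... | tri> _ _ p'<p = cont
            (left , ∈ctl {t} ep (∈depart-L {t} {ℓp}) , tape≤ p< , refl , ℕₚ.<-trans (ℕₚ.n<1+n p) (tape≤ p<))
            (subst (λ m → Run x (goL t m) p z) (≡sym (departL valid ep)) (from-left p'<p refl))
          where
          from-left : ∀ {q} → p' < q → q ≡ p → Run x (goL t (carryL valid p q)) q z
          from-left {suc q} (s≤s p'≤q) e = runL (q ∸ p') q (ℕₚ.m+[n∸m]≡n p'≤q) (ℕₚ.≤-reflexive e)

      run-hops : Valid x → ∀ {d p z} → Hops d p z → Run x (ctl d) (suc p) z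
      run-hops valid (stop o p< p'< hop) = runHop valid p< p'< hop
        (λ o∈ → end (stay , o∈ , tape≤ p'< , refl , tape≤ p'<))
      run-hops valid (step o p< p'< hop r) = runHop valid p< p'< hop
        (λ o∈ → cont (stay , o∈ , tape≤ p'< , refl , tape≤ p'<) (run-hops valid r))

      run-rewind : ∀ {z} → Run x (ctl nothing) 1 z → ∀ i → i ≤ length x → Run x rewind i z
      run-rewind r zero    i≤ = cont (right , here refl , s≤s z≤n , refl , s≤s (s≤s z≤n)) r
      run-rewind r (suc i) i≤ = cont
          (left , ∈rewind , s≤s (s≤s (ℕₚ.<⇒≤ i≤)) , refl , s≤s (ℕₚ.m≤n⇒m≤1+n (ℕₚ.<⇒≤ i≤)))
          (run-rewind r i (ℕₚ.<⇒≤ i≤))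
        where
        ∈rewind : (just rewind , [] , left) ∈ tr rewind (symAt x (suc i))
        ∈rewind rewrite proj₂ (at-<-just x i≤) = here refl

      module _ (valid : Valid x) {z} (r : Run x (ctl nothing) 1 z) where
        open Valid valid

        ∈check : ∀ {i ℓ ℓ'} → at x i ≡ just ℓ → at x (suc i) ≡ just ℓ' → (just (check ℓ') , [] , right) ∈ tr
            (check ℓ) (symAt x (suc (suc i)))
        ∈check {i} {ℓ} {ℓ'} e e' with adjacent e e'
        ... | a rewrite e' = ∈when⁺ (adjacent? ℓ ℓ') a

        ∈last : ∀ {i ℓ} → at x i ≡ just ℓ → at x (suc i) ≡ nothing → (just rewind , [] , left) ∈ tr (check ℓ)
            (symAt x (suc (suc i)))
        ∈last {i} {ℓ} e e' with last e e'
        ... | a rewrite e' = ∈when⁺ (last? ℓ) a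

        run-check : ∀ dist i {ℓ} → suc i + dist ≡ length x → at x i ≡ just ℓ → Run x (check ℓ) (suc (suc i)) z
        run-check zero i len e = cont
            (left , ∈last e (at-≥ x (ℕₚ.≤-reflexive (≡sym (trans (≡sym (ℕₚ.+-identityʳ _)) len)))) , s≤s
            (s≤s (at-just⇒< x e)) , refl , tape≤ (at-just⇒< x e))
          (run-rewind r (suc i) (at-just⇒< x e))
        run-check (suc dist) i len e = cont
            (right , ∈check e e' , s≤s (s≤s (at-just⇒< x e)) , refl , s≤s (s≤s (at-just⇒< x e')))
            (run-check dist (suc i) len' e')
          where
          len' : suc (suc i) + dist ≡ length x
          len' = trans (≡sym (ℕₚ.+-suc (suc i) dist)) len
          e' = proj₂ (at-<-just x {suc i} (subst (suc (suc i) ≤_) len' (ℕₚ.m≤m+n (suc (suc i)) dist)))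

        run-start : Run x init 0 z
        run-start = cont (right , here refl , s≤s z≤n , refl , s≤s (s≤s z≤n))
            (cont (right , ∈check₀ , s≤s (s≤s z≤n) , refl , s≤s (s≤s (at-just⇒< x e)))
            (run-check (length x ∸ 1) 0 (ℕₚ.m+[n∸m]≡n (at-just⇒< x e)) e))
          where
          ℓ = proj₁ nonempty
          e = proj₂ nonempty
          ∈check₀ : (just (check ℓ) , [] , right) ∈ tr check₀ (symAt x 1)
          ∈check₀ with first e
          ... | f rewrite e = ∈when⁺ (first? ℓ) f

      walker⇔ : ∀ z → ⟦ machine ⟧G x z ⇔ (Valid x × Hops nothing 0 z)
      walker⇔ z = ⇔.trans (machine⇔ x z) (mk⇔
        (λ r → let valid , r' = start⇒valid r in valid , soundCtl valid r')
        (λ (valid , H) → run-start valid (run-hops valid H)))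

-- From MSO transductions to compositions of two machines

at-ext : ∀ {A : Set} (xs ys : List A) → (∀ i → at xs i ≡ at ys i) → xs ≡ ys
at-ext []       []       e = refl
at-ext []       (y ∷ ys) e = contradiction (e 0) λ ()
at-ext (x ∷ xs) []       e = contradiction (e 0) λ ()
at-ext (x ∷ xs) (y ∷ ys) e = cong₂ _∷_ (Maybeₚ.just-injective (e 0)) (at-ext xs ys (e ∘ suc))

-- Node 0 is the only one without a predecessor, and edges lead from a node to its right neighbour.
-- By induction an isomorphism preserves positions, which is why a graph determines its word.
egr-index : ∀ {n} {w w' : List (Fin n)} (s : Iso (egr w) (egr w')) i → toℕ (Iso.f s i) ≡ toℕ i
egr-index {n} {w} {w'} s i = go (toℕ i) i refl
  where
  open Iso s
  minimal : ∀ (v : Fin (suc (length w'))) → (∀ {u} → ¬ Adj (egr w') u v) → toℕ v ≡ 0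
  minimal fzero    n = refl
  minimal (fsuc v) n = ⊥-elim (n (from (adj-egr w' (λ ()) (Fin.inject₁ v) (fsuc v)) (cong suc (Finₚ.toℕ-inject₁ v))))
  go : ∀ m i → toℕ i ≡ m → toℕ (f i) ≡ m
  go zero fzero e = minimal (f fzero) unreached
    where
    unreached : ∀ {u} → ¬ Adj (egr w') u (f fzero)
    unreached {u} (γ , a) with f-surj u
    ... | j , refl with to (adj-egr w (λ ()) j fzero) (γ , to (f-edge j γ fzero) a)
    ... | ()
  go (suc m) (fsuc i) e with from (adj-egr w (λ ()) (Fin.inject₁ i) (fsuc i)) (cong suc (Finₚ.toℕ-inject₁ i))
  ... | γ , a = trans (≡sym (to (adj-egr w' (λ ()) (f (Fin.inject₁ i)) (f (fsuc i)))
      (γ , from (f-edge (Fin.inject₁ i) γ (fsuc i)) a)))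
    (cong suc (go m (Fin.inject₁ i) (trans (Finₚ.toℕ-inject₁ i) (ℕₚ.suc-injective e))))

egr-injective : ∀ {n} {w w' : List (Fin n)} → Iso (egr w) (egr w') → w ≡ w'
egr-injective {n} {w} {w'} s = at-ext w w' λ i → same i (at w i) (at w' i) refl refl
  where
  letters : ∀ {w w' : List (Fin n)} → Iso (egr w) (egr w') → ∀ i {γ} → at w i ≡ just γ → at w' i ≡ just γ
  letters {w} {w'} s i {γ} e =
    let i< = at-just⇒< w e
        j = fromℕ< i<
        a = from (egr-edge⇔ w (Fin.inject₁ j) γ (fsuc j))
            (cong suc (Finₚ.toℕ-inject₁ j) , trans (cong (at w) (trans (Finₚ.toℕ-inject₁ j) (Finₚ.toℕ-fromℕ< i<))) e)
        _ , e' = to (egr-edge⇔ w' (Iso.f s (Fin.inject₁ j)) γ (Iso.f s (fsuc j)))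
            (from (Iso.f-edge s (Fin.inject₁ j) γ (fsuc j)) a)
    in trans (cong (at w') (≡sym (trans (egr-index {w = w} {w'} s (Fin.inject₁ j)) (trans (Finₚ.toℕ-inject₁ j) (Finₚ.toℕ-fromℕ< i<))))) e'
  same : ∀ i l l' → at w i ≡ l → at w' i ≡ l' → at w i ≡ at w' i
  same i (just γ) l'       e e' = trans e (≡sym (letters {w} {w'} s i e))
  same i nothing  (just γ) e e' = trans (letters {w'} {w} (Iso-sym s) i e') (≡sym e')
  same i nothing  nothing  e e' = trans e (≡sym e')

-- Valuations written as words

module _ {n k : ℕ} where

  baseAt : (w : List (Fin n)) → (Fin k → Subset (suc (length w))) → Fin (suc (length w)) → Maybe (Fin n) × Vec Bool k
  baseAt w U i = at w (toℕ i) , Vec.tabulate (λ X → lookupᵥ (U X) i)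

  baseEnc : (w : List (Fin n)) → (Fin k → Subset (suc (length w))) → List (Maybe (Fin n) × Vec Bool k)
  baseEnc w U = List.tabulate (baseAt w U)

  LetterWord : List (Fin n) → List (Maybe (Fin n) × Vec Bool k) → Set
  LetterWord w bs = map proj₁ bs ≡ map just w ++ nothing ∷ []

  letters-tabulate : ∀ (w : List (Fin n)) {m} (f : Fin m → Maybe (Fin n)) →
      List.tabulate f ≡ map just w ++ nothing ∷ [] →
                     ∃ λ (e : m ≡ suc (length w)) → ∀ i → f i ≡ at w (toℕ i)
  letters-tabulate []      {suc zero} f e = refl , λ { fzero → Listₚ.∷-injectiveˡ e }
  letters-tabulate []      {suc (suc m)} f e = contradiction (Listₚ.∷-injectiveʳ e) λ ()
  letters-tabulate (a ∷ w) {suc m} f e = let e' , g = letters-tabulate w (f ∘ fsuc) (Listₚ.∷-injectiveʳ e) in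
    cong suc e' , λ { fzero → Listₚ.∷-injectiveˡ e ; (fsuc i) → g i }

  -- The bits are guessed freely, and any choice is a valuation: the bits at position `i` are read
  -- as the memberships of node `i`.
  letterWord⇒baseEnc : ∀ w bs → LetterWord w bs → ∃ λ U → bs ≡ baseEnc w U
  letterWord⇒baseEnc w bs e = build (length bs) (List.lookup bs) (letters-tabulate w (proj₁ ∘ List.lookup bs)
      (trans (≡sym (Listₚ.map-tabulate (List.lookup bs) proj₁))
          (trans (cong (map proj₁) (Listₚ.tabulate-lookup bs)) e)))
      (≡sym (Listₚ.tabulate-lookup bs))
    where
    build : ∀ m (f : Fin m → Maybe (Fin n) × Vec Bool k) →
        (∃ λ (e : m ≡ suc (length w)) → ∀ i → proj₁ (f i) ≡ at w (toℕ i)) →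
            bs ≡ List.tabulate f → ∃ λ U → bs ≡ baseEnc w U
    build _ f (refl , g) q = U , trans q (Listₚ.tabulate-cong λ i → cong₂ _,_ (g i)
        (≡sym (trans (Vecₚ.tabulate-cong (λ X → Vecₚ.lookup∘tabulate (λ i → lookupᵥ (proj₂ (f i)) X) i))
            (Vecₚ.tabulate∘lookup (proj₂ (f i))))))
      where
      U : Fin k → Subset (suc (length w))
      U X = Vec.tabulate (λ i → lookupᵥ (proj₂ (f i)) X)

  letterWord-baseEnc : ∀ w U → LetterWord w (baseEnc w U)
  letterWord-baseEnc w U = trans (Listₚ.map-tabulate (baseAt w U) proj₁) (letters w)
    where
    letters : ∀ w → List.tabulate {n = suc (length w)} (λ i → at w (toℕ i)) ≡ map just w ++ nothing ∷ []
    letters []      = refl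
    letters (a ∷ w) = cong (just a ∷_) (letters w)

module Annotate {n₁ n₂ k : ℕ} (C : ℕ) (R : Recognizer (Letter n₁ 2 k)) where
  open Recognizer R
  open Walker {n₁} {n₂} {k} C R using (Base; FA; n₃; base; pre; suf; letter; mk; none; mk-++; one; Valid; Adjacent; First; Last)

  word : List Base → Mo
  word v = h (mk none none v)

  -- The true annotation, which is one of the possible guesses; `u` accumulates what has been
  -- passed.
  annotate : List Base → List Base → List (Fin n₃)
  annotate u []      = []
  annotate u (β ∷ v) = code FA (β , word u , word v) ∷ annotate (u ++ β ∷ []) v

  map-base : ∀ u v → map base (annotate u v) ≡ v
  map-base u []      = refl
  map-base u (β ∷ v) = cong₂ _∷_ (cong proj₁ (decode-code FA (β , word u , word v))) (map-base (u ++ β ∷ []) v)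

  annotate-at : ∀ u v i {ℓ} → at (annotate u v) i ≡ just ℓ →
                at v i ≡ just (base ℓ) × pre ℓ ≡ word (u ++ List.take i v) × suf ℓ ≡ word (List.drop (suc i) v)
  annotate-at u (β ∷ v) zero refl = cong (just ∘ proj₁) (≡sym d) ,
      trans (cong (proj₁ ∘ proj₂) d) (cong word (≡sym (Listₚ.++-identityʳ u))) , cong (proj₂ ∘ proj₂) d
    where d = decode-code FA (β , word u , word v)
  annotate-at u (β ∷ v) (suc i) e = let b , p , s = annotate-at (u ++ β ∷ []) v i e in
    b , trans p (cong word (Listₚ.++-assoc u (β ∷ []) (List.take i v))) , s

  letters-at : ∀ w {bs : List Base} → LetterWord w bs → ∀ i {β} → at bs i ≡ just β →
               (∀ {β'} → at bs (suc i) ≡ just β' → proj₁ β ≢ nothing) × (at bs (suc i) ≡ nothing → proj₁ β ≡ nothing)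
  letters-at []      {β ∷ []}     e zero refl = (λ ()) , λ _ → Listₚ.∷-injectiveˡ e
  letters-at []      {β ∷ _ ∷ _}  e i    _    = contradiction (Listₚ.∷-injectiveʳ e) λ ()
  letters-at (a ∷ w) {β ∷ bs}     e zero refl =
      (λ _ q → contradiction (trans (≡sym (Listₚ.∷-injectiveˡ e)) q) λ ()) , λ q → ⊥-elim
      (more w bs (Listₚ.∷-injectiveʳ e) q)
    where
    more : ∀ w bs → LetterWord w bs → ¬ at bs 0 ≡ nothing
    more []      (_ ∷ _) _ ()
    more (_ ∷ _) (_ ∷ _) _ ()
  letters-at (a ∷ w) {_ ∷ bs} e (suc i) p = letters-at w (Listₚ.∷-injectiveʳ e) i p

  annotate-valid : ∀ w bs → LetterWord w bs → Valid (annotate [] bs)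
  annotate-valid w bs e = record
    { nonempty = nonempty w bs e
    ; first = λ p → proj₁ (proj₂ (annotate-at [] bs 0 p))
    ; adjacent = adjacent
    ; last = last }
    where
    x = annotate [] bs
    nonempty : ∀ w bs → LetterWord w bs → ∃ λ ℓ → at (annotate [] bs) 0 ≡ just ℓ
    nonempty w       (β ∷ bs) e = _ , refl
    nonempty []      []       ()
    nonempty (_ ∷ _) []       ()
    at-base : ∀ i {ℓ} → at x i ≡ just ℓ → at bs i ≡ just (base ℓ)
    at-base i p = proj₁ (annotate-at [] bs i p)
    adjacent : ∀ {i ℓ ℓ'} → at x i ≡ just ℓ → at x (suc i) ≡ just ℓ' → Adjacent ℓ ℓ'
    adjacent {i} {ℓ} {ℓ'} p p' = proj₁ (letters-at w e i (at-base i p)) (at-base (suc i) p') ,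
      trans (proj₁ (proj₂ (annotate-at [] bs (suc i) p'))) (trans (cong word (at-take bs i (at-base i p)))
        (trans (cong h (mk-++ none none (List.take i bs) (base ℓ ∷ [])))
            (trans (hom (mk none none (List.take i bs)) _)
          (cong (_· one false false ℓ) (≡sym (proj₁ (proj₂ (annotate-at [] bs i p)))))))) ,
      trans (proj₂ (proj₂ (annotate-at [] bs i p))) (trans (cong word (drop-at bs (suc i) (at-base (suc i) p')))
        (trans (hom (mk none none (base ℓ' ∷ [])) _)
            (cong (one false false ℓ' ·_) (≡sym (proj₂ (proj₂ (annotate-at [] bs (suc i) p')))))))
    at-end : ∀ {i} → at x i ≡ nothing → at bs i ≡ nothing
    at-end {i} q = at-≥ bs (subst (_≤ i) (trans (≡sym (Listₚ.length-map base x)) (cong length (map-base [] bs)))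
        (at-nothing⇒≥ x q))
    last : ∀ {i ℓ} → at x i ≡ just ℓ → at x (suc i) ≡ nothing → Last ℓ
    last {i} p q = proj₂ (letters-at w e i (at-base i p)) (at-end q) ,
      trans (proj₂ (proj₂ (annotate-at [] bs i p))) (cong word (drop-end bs (suc i) (at-end q)))

  -- The second machine must be finite visit on every word, also on one that the first never writes.
  -- The local check itself ensures that the letters spell some `w`, so that reasoning over `egr w`
  -- applies whenever the check succeeds.
  valid⇒letterWord : ∀ x → Valid x → ∃ λ w → LetterWord w (map base x)
  valid⇒letterWord x v = go x (proj₂ nonempty) (λ {i} p q → proj₁ (adjacent {i} p q)) (λ {i} p q → proj₁ (last {i} p q))
    where
    open Valid v
    go : ∀ x {ℓ₀} → at x 0 ≡ just ℓ₀ → (∀ {i ℓ ℓ'} → at x i ≡ just ℓ → at x (suc i) ≡ just ℓ' → letter ℓ ≢ nothing) →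
         (∀ {i ℓ} → at x i ≡ just ℓ → at x (suc i) ≡ nothing → letter ℓ ≡ nothing) → ∃ λ w → LetterWord w (map base x)
    go (ℓ ∷ [])     _ a l = [] , cong (_∷ []) (l {0} refl refl)
    go (ℓ ∷ ℓ' ∷ x) _ a l with go (ℓ' ∷ x) refl (λ {i} → a {suc i}) (λ {i} → l {suc i}) | letter ℓ in eq
    ... | w , e | just b  = b ∷ w , cong (just b ∷_) e
    ... | w , e | nothing = ⊥-elim (a {0} refl refl eq)

-- Simulating a string-valued MSO transduction

module Simulation {n₁ n₂ : ℕ} (T : MSOT 1 n₁ 1 n₂)
                  (string-valued : ∀ w {h} → T ⊨ egr w ↦ h → ∃ λ z → Iso h (egr z)) where
  open MSOT T

  Control : Set
  Control = Maybe (Fin C)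

  Hop : Set
  Hop = Control × Control × Maybe (Fin n₂)

  FH : Finite Hop
  FH = Finite-× (Finite-Maybe (Finite-Fin C)) (Finite-× (Finite-Maybe (Finite-Fin C)) (Finite-Maybe (Finite-Fin n₂)))

  nodeF : ∀ {fo} → Fin C → Fin fo → Formula 1 n₁ fo k
  nodeF c x = ren (λ _ → x) id (φnode c 0F)

  arcF : ∀ {fo} → Fin C → Fin n₂ → Fin C → Fin fo → Fin fo → Formula 1 n₁ fo k
  arcF c γ d x y = ren (x VF.∷ (y VF.∷ VF.[])) id (φedge c d γ)

  -- A hop from x to y: onto the first output node (whatever x), along an output edge, or off the last
  -- output node (whatever y).
  hopF : Hop → Formula 1 n₁ 2 k
  hopF (nothing , just c  , nothing) = ren (λ ()) id φdom ∧F
      (nodeF c 1F ∧F ¬F (∃₁ (⋁ λ c' → ⋁ λ γ → nodeF c' 0F ∧F arcF c' γ c 0F 2F)))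
  hopF (just c  , just c' , just γ)  = nodeF c' 1F ∧F arcF c γ c' 0F 1F
  hopF (just c  , nothing , nothing) = ¬F (∃₁ (⋁ λ c' → ⋁ λ γ → nodeF c' 0F ∧F arcF c γ c' 1F 0F))
  hopF (nothing , nothing , _)       = ⊥F
  hopF (nothing , just _  , just _)  = ⊥F
  hopF (just _  , nothing , just _)  = ⊥F
  hopF (just _  , just _  , nothing) = ⊥F

  abstract
    family : ∃ λ (R : Recognizer (Letter n₁ 2 k)) → ∃ λ (accept : Fin (size FH) → Recognizer.Mo R → Bool) →
             ∀ i w → accept i (Recognizer.h R w) ≡ accepts (dfa (hopF (decode FH i))) w
    family = recognizeAll (size FH) (λ i → dfa (hopF (decode FH i)))

  R : Recognizer (Letter n₁ 2 k)
  R = proj₁ family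

  accept : Hop → Recognizer.Mo R → Bool
  accept t = proj₁ (proj₂ family) (code FH t)

  accept-correct : ∀ t w → accept t (Recognizer.h R w) ≡ accepts (dfa (hopF t)) w
  accept-correct t w = trans (proj₂ (proj₂ family) (code FH t) w)
      (cong (λ t → accepts (dfa (hopF t)) w) (decode-code FH t))

  open Walker {n₁} {n₂} {k} C R using (n₃; base; letter; mk; at!; mark; Valid; machine; walker⇔; HopAt; Hops; stop; step)
  open Annotate {n₁} {n₂} {k} C R using (annotate; map-base; annotate-valid; valid⇒letterWord)

  module _ (w : List (Fin n₁)) (U : Fin k → Subset (suc (length w))) where

    private
      Node : Set
      Node = Fin (suc (length w)) × Fin C

      IsNode : Node → Set
      IsNode p = Nd T (egr w) U p 0F

      Arc : Node → Fin n₂ → Node → Set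
      Arc = Ed T (egr w) U

      m-node : ∀ {fo} {ρ : Fin fo → _} c x → Means (egr w) ρ U (nodeF c x) (IsNode (ρ x , c))
      m-node c x = means (Sem-ren (egr w) _ id (φnode c 0F) (λ { 0F → refl }) (λ _ → refl))

      m-arc : ∀ {fo} {ρ : Fin fo → _} c γ d x y → Means (egr w) ρ U (arcF c γ d x y) (Arc (ρ x , c) γ (ρ y , d))
      m-arc c γ d x y = means (Sem-ren (egr w) _ id (φedge c d γ) (λ { 0F → refl ; 1F → refl }) (λ _ → refl))

    HopSem : Hop → Fin (suc (length w)) → Fin (suc (length w)) → Set
    HopSem (nothing , just c  , nothing) u v = Sem (egr w) φdom VF.[] U × IsNode (v , c) × ¬ ∃ λ u' → ∃ λ c' →
        ∃ λ γ → IsNode (u' , c') × Arc (u' , c') γ (v , c)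
    HopSem (just c  , just c' , just γ)  u v = IsNode (v , c') × Arc (u , c) γ (v , c')
    HopSem (just c  , nothing , nothing) u v = ¬ ∃ λ u' → ∃ λ c' → ∃ λ γ → IsNode (u' , c') × Arc (u , c) γ (u' , c')
    HopSem (nothing , nothing , _)       u v = ⊥
    HopSem (nothing , just _  , just _)  u v = ⊥
    HopSem (just _  , nothing , just _)  u v = ⊥
    HopSem (just _  , just _  , nothing) u v = ⊥

    m-hopF : ∀ t u v → Means (egr w) (u VF.∷ (v VF.∷ VF.[])) U (hopF t) (HopSem t u v)
    m-hopF (nothing , just c  , nothing) u v = means
        (Sem-ren (egr w) (λ ()) id φdom (λ ()) (λ _ → refl)) m∧ m-node c 1F m∧
      m¬ (m∃ λ u' → m⋁ λ c' → m⋁ λ γ → m-node c' 0F m∧ m-arc c' γ c 0F 2F)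
    m-hopF (just c  , just c' , just γ)  u v = m-node c' 1F m∧ m-arc c γ c' 0F 1F
    m-hopF (just c  , nothing , nothing) u v = m¬ (m∃ λ u' → m⋁ λ c' → m⋁ λ γ → m-node c' 0F m∧ m-arc c γ c' 1F 0F)
    m-hopF (nothing , nothing , _)       u v = m-⊥
    m-hopF (nothing , just _  , just _)  u v = m-⊥
    m-hopF (just _  , nothing , just _)  u v = m-⊥
    m-hopF (just _  , just _  , nothing) u v = m-⊥

    mk-tabulate : ∀ f g {m} (φ : Fin m → Maybe (Fin n₁) × Vec Bool k) →
                  mk f g (List.tabulate φ) ≡ List.tabulate (λ i → mark (f (toℕ i)) (g (toℕ i)) (φ i))
    mk-tabulate f g {zero}  φ = refl
    mk-tabulate f g {suc m} φ = cong (_ ∷_) (mk-tabulate (f ∘ suc) (g ∘ suc) (φ ∘ fsuc))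

    at!≡ : ∀ (u i : Fin (suc (length w))) → at! (toℕ u) (toℕ i) ≡ ⌊ u ≟F i ⌋
    at!≡ u i = bool-ext (⇔.trans (≡ᵇ⇔ (toℕ i) (toℕ u))
        (⇔.trans (mk⇔ (≡sym ∘ Finₚ.toℕ-injective) (≡sym ∘ cong toℕ)) (⇔.sym (⌊⌋⇔ (u ≟F i)))))

    marked-word : ∀ u v → mk (at! (toℕ u)) (at! (toℕ v)) (baseEnc w U) ≡ enc w (u VF.∷ (v VF.∷ VF.[])) U
    marked-word u v = trans (mk-tabulate (at! (toℕ u)) (at! (toℕ v)) (baseAt w U))
      (Listₚ.tabulate-cong (λ i → cong₂ (λ b c → mark b c (baseAt w U i)) (at!≡ u i) (at!≡ v i)))

    module _ (x : List (Fin n₃)) (encodes : map base x ≡ baseEnc w U) where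

      abstract
        hop⇔ : ∀ t u v → HopAt accept x t (toℕ u) (toℕ v) ⇔ HopSem t u v
        hop⇔ t u v = ⇔.trans (≡⇒⇔ (trans
            (cong (λ bs → accept t (Recognizer.h R (mk (at! (toℕ u)) (at! (toℕ v)) bs))) encodes)
            (trans (cong (accept t ∘ Recognizer.h R) (marked-word u v)) (accept-correct t _))))
          (⇔.trans (dfa-correct w (hopF t) (u VF.∷ (v VF.∷ VF.[])) U) (sem (m-hopF t u v)))

        length-x : length x ≡ suc (length w)
        length-x = trans (≡sym (Listₚ.length-map base x))
            (trans (cong length encodes) (Listₚ.length-tabulate (baseAt w U)))

        hop : ∀ t {p p'} → p < length x → p' < length x → HopAt accept x t p p' →
              ∃ λ u → ∃ λ v → toℕ u ≡ p × toℕ v ≡ p' × HopSem t u v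
        hop t {p} {p'} p< p'< H = u , v , u≡ , v≡ , to (hop⇔ t u v) (subst₂ (HopAt accept x t) (≡sym u≡) (≡sym v≡) H)
          where
          u v : Fin (suc (length w))
          u = fromℕ< (subst (p <_) length-x p<)
          v = fromℕ< (subst (p' <_) length-x p'<)
          u≡ : toℕ u ≡ p
          u≡ = Finₚ.toℕ-fromℕ< (subst (p <_) length-x p<)
          v≡ : toℕ v ≡ p'
          v≡ = Finₚ.toℕ-fromℕ< (subst (p' <_) length-x p'<)

        bound : ∀ (u : Fin (suc (length w))) → toℕ u < length x
        bound u = subst (toℕ u <_) (≡sym length-x) (Finₚ.toℕ<n u)

      module _ {z' : List (Fin n₂)} (o : Out T (egr w) U (egr z')) where
        open Out o

        abstract
          isNode⇒ : ∀ p → IsNode p → ∃ λ i → f i ≡ p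
          isNode⇒ p n = f-surj p 0F (λ { 0F → mk⇔ (λ _ → refl) (λ _ → n) })

          ⇒isNode : ∀ i → IsNode (f i)
          ⇒isNode i = from (f-lab i 0F) refl

          arc⇔ : ∀ i γ j → Arc (f i) γ (f j) ⇔ (suc (toℕ i) ≡ toℕ j × at z' (toℕ i) ≡ just γ)
          arc⇔ i γ j = ⇔.trans (⇔.sym (f-edge i γ j)) (egr-edge⇔ z' i γ j)

          next-node : ∀ i → toℕ i < length z' → ∃ λ γ → ∃ λ j → toℕ j ≡ suc (toℕ i) × at z' (toℕ i) ≡ just γ ×
              Arc (f i) γ (f j)
          next-node i i< = let γ , e = at-<-just z' i< in γ , fsuc (fromℕ< i<) , cong suc (Finₚ.toℕ-fromℕ< i<) , e ,
            from (arc⇔ i γ (fsuc (fromℕ< i<))) (cong suc (≡sym (Finₚ.toℕ-fromℕ< i<)) , e)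

        follow : ∀ {c p z} i {u} → f i ≡ (u , c) → toℕ u ≡ p → Hops accept x (just c) p z → z ≡ List.drop (toℕ i) z'
        follow {c} i {u} fi u≡ (stop nothing p< p'< H) with hop (just c , nothing , nothing) p< p'< H
        ... | u₁ , v , u₁≡ , _ , final with Finₚ.toℕ-injective (trans u₁≡ (≡sym u≡))
        ... | refl with toℕ i ℕₚ.<? length z'
        ... | no i≮ = ≡sym (drop-end z' (toℕ i) (at-≥ z' (ℕₚ.≮⇒≥ i≮)))
        ... | yes i< with next-node i i<
        ... | γ , j , _ , _ , a = ⊥-elim
            (final (proj₁ (f j) , proj₂ (f j) , γ , ⇒isNode j , subst (λ p → Arc p γ (f j)) fi a))
        follow {c} i fi u≡ (stop (just γ) p< p'< H) with hop (just c , nothing , just γ) p< p'< H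
        ... | _ , _ , _ , _ , ()
        follow {c} i {u} fi u≡ (step {c = c'} (just γ) p< p'< H r) with hop (just c , just c' , just γ) p< p'< H
        ... | u₁ , v , u₁≡ , v≡ , n , a with Finₚ.toℕ-injective (trans u₁≡ (≡sym u≡)) | isNode⇒ (v , c') n
        ... | refl | j , fj with to (arc⇔ i γ j) (subst₂ (λ p q → Arc p γ q) (≡sym fi) (≡sym fj) a)
        ... | j≡ , l = trans (cong (γ ∷_) (trans (follow j fj v≡ r) (cong (λ i → List.drop i z') (≡sym j≡))))
            (≡sym (drop-at z' (toℕ i) l))
        follow {c} i fi u≡ (step {c = c'} nothing p< p'< H r) with hop (just c , just c' , nothing) p< p'< H
        ... | _ , _ , _ , _ , ()

        -- The first hop lands on an output node that no arc enters, and every node of the output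
        -- path except node 0 is entered by one.
        hops-output : ∀ {z} → Hops accept x nothing 0 z → z ≡ z'
        hops-output (stop o' p< p'< H) with hop (nothing , nothing , o') p< p'< H
        ... | _ , _ , _ , _ , ()
        hops-output (step {c = c} (just γ) p< p'< H r) with hop (nothing , just c , just γ) p< p'< H
        ... | _ , _ , _ , _ , ()
        hops-output (step {c = c} nothing p< p'< H r) with hop (nothing , just c , nothing) p< p'< H
        ... | u , v , _ , v≡ , _ , n , initial with isNode⇒ (v , c) n
        ... | fzero , fj = follow fzero fj v≡ r
        ... | fsuc j , fj with next-node (Fin.inject₁ j)
            (subst (_< length z') (≡sym (Finₚ.toℕ-inject₁ j)) (Finₚ.toℕ<n j))
        ... | γ , j' , j'≡ , _ , a with Finₚ.toℕ-injective {i = j'} {fsuc j}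
            (trans j'≡ (cong suc (Finₚ.toℕ-inject₁ j)))
        ... | refl = ⊥-elim (initial
            (proj₁ (f (Fin.inject₁ j)) , proj₂ (f (Fin.inject₁ j)) , γ , ⇒isNode (Fin.inject₁ j) , subst
            (λ q → Arc (f (Fin.inject₁ j)) γ q) fj a))

        traverse : ∀ d i → toℕ i + d ≡ length z' → Hops accept x (just (proj₂ (f i))) (toℕ (proj₁ (f i)))
            (List.drop (toℕ i) z')
        traverse zero i e = subst (Hops accept x (just (proj₂ (f i))) (toℕ (proj₁ (f i))))
            (≡sym (drop-end z' (toℕ i) (at-≥ z' (ℕₚ.≤-reflexive (≡sym i≡)))))
            -- The last hop may land anywhere; it stays where it is.
            (stop {p' = toℕ (proj₁ (f i))} nothing (bound (proj₁ (f i))) (bound (proj₁ (f i)))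
                (from (hop⇔ (just (proj₂ (f i)) , nothing , nothing) (proj₁ (f i)) (proj₁ (f i))) final))
          where
          i≡ : toℕ i ≡ length z'
          i≡ = trans (≡sym (ℕₚ.+-identityʳ _)) e
          final : ¬ ∃ λ u' → ∃ λ c' → ∃ λ γ → IsNode (u' , c') × Arc (f i) γ (u' , c')
          final (u' , c' , γ , n , a) with isNode⇒ (u' , c') n
          ... | j , refl = contradiction
              (trans (≡sym (at-≥ z' (ℕₚ.≤-reflexive (≡sym i≡)))) (proj₂ (to (arc⇔ i γ j) a))) λ ()
        traverse (suc d) i e with next-node i
            (ℕₚ.≤-trans (s≤s (ℕₚ.m≤m+n (toℕ i) d)) (ℕₚ.≤-reflexive (trans (≡sym (ℕₚ.+-suc (toℕ i) d)) e)))
        ... | γ , j , j≡ , l , a = subst (Hops accept x (just (proj₂ (f i))) (toℕ (proj₁ (f i))))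
            (trans (cong (λ i → γ ∷ List.drop i z') j≡) (≡sym (drop-at z' (toℕ i) l)))
            (step (just γ) (bound (proj₁ (f i))) (bound (proj₁ (f j)))
                (from (hop⇔ (just (proj₂ (f i)) , just (proj₂ (f j)) , just γ) (proj₁ (f i)) (proj₁ (f j)))
                (⇒isNode j , a))
              (traverse d j (trans (cong (_+ d) j≡) (trans (≡sym (ℕₚ.+-suc (toℕ i) d)) e))))

        output-hops : Sem (egr w) φdom VF.[] U → Hops accept x nothing 0 z'
        output-hops s = step {p' = toℕ (proj₁ (f 0F))} nothing (bound 0F) (bound (proj₁ (f 0F)))
            (from (hop⇔ (nothing , just (proj₂ (f 0F)) , nothing) 0F (proj₁ (f 0F)))
            (s , ⇒isNode 0F , initial)) (traverse (length z') 0F refl)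
          where
          initial : ¬ ∃ λ u' → ∃ λ c' → ∃ λ γ → IsNode (u' , c') × Arc (u' , c') γ (f 0F)
          initial (u' , c' , γ , n , a) with isNode⇒ (u' , c') n
          ... | j , refl with to (arc⇔ j γ 0F) a
          ... | () , _

      hops⇒dom : ∀ {z} → Hops accept x nothing 0 z → Sem (egr w) φdom VF.[] U
      hops⇒dom (stop o p< p'< H) with hop (nothing , nothing , o) p< p'< H
      ... | _ , _ , _ , _ , ()
      hops⇒dom (step {c = c} (just γ) p< p'< H r) with hop (nothing , just c , just γ) p< p'< H
      ... | _ , _ , _ , _ , ()
      hops⇒dom (step {c = c} nothing p< p'< H r) = proj₁
          (proj₂ (proj₂ (proj₂ (proj₂ (hop (nothing , just c , nothing) p< p'< H)))))

      -- The first hop tests the domain formula, so a complete sequence of hops shows the valuation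
      -- to be admissible. Then `string-valued` makes the output graph a path, and the path forces
      -- the output.
      hops⇒output : ∀ {z} → Hops accept x nothing 0 z → ∃ λ z' → Sem (egr w) φdom VF.[] U × Out T (egr w) U (egr z') ×
                    (∀ y → Hops accept x nothing 0 y → y ≡ z')
      hops⇒output H = result (string-valued w (U , hops⇒dom H , proj₂ (Out-exists {T = T} {egr w} {U})))
        where
        result : (∃ λ z → Iso (proj₁ (Out-exists {T = T} {egr w} {U})) (egr z)) → _
        result (z' , i) = z' , hops⇒dom H , o , λ y H' → hops-output o H'
          where o = Out-≅ (proj₂ (Out-exists {T = T} {egr w} {U})) i

  walker : GSM n₃ n₂
  walker = machine accept

  -- The annotated word already contains the valuation, so the second machine realizes a partial
  -- function.
  output-unique : ∀ x {w} → LetterWord w (map base x) → ∀ {z} → ⟦ walker ⟧G x z →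
                  ∃ λ z' → T ⊨ egr w ↦ egr z' × (∀ y → ⟦ walker ⟧G x y → y ≡ z')
  output-unique x {w} lw {z} c =
    let U , e = letterWord⇒baseEnc w (map base x) lw
        z' , s , o , u = hops⇒output w U x e (proj₂ (to (walker⇔ accept x z) c))
    in z' , (U , s , o) , λ y c' → u y (proj₂ (to (walker⇔ accept x y) c'))

  walker-FiniteVisit : FiniteVisit walker
  walker-FiniteVisit = sameLength⇒FiniteVisit walker λ x {z} {z'} c c' →
    let w , lw = valid⇒letterWord x (proj₁ (to (walker⇔ accept x z) c))
        _ , _ , u = output-unique x lw c
    in cong length (trans (u z c) (≡sym (u z' c')))

  open Guess {n₁} {n₃} letter using (guess⇔; guess-FiniteVisit) renaming (machine to guesser)

  spec⇔ : ∀ w x → ⟦ guesser ⟧G w x ⇔ LetterWord w (map base x)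
  spec⇔ w x = ⇔.trans (guess⇔ w x) (mk⇔ (trans (≡sym (Listₚ.map-∘ x))) (trans (Listₚ.map-∘ x)))

  simulates : ∀ w z → T ⊨ egr w ↦ egr z ⇔ (⟦ guesser ⟧G ⨾ ⟦ walker ⟧G) w z
  simulates w z = mk⇔ fwd bwd
    where
    fwd : T ⊨ egr w ↦ egr z → (⟦ guesser ⟧G ⨾ ⟦ walker ⟧G) w z
    fwd (U , s , o) = x , from (spec⇔ w x) (subst (LetterWord w) (≡sym e) lw) ,
        from (walker⇔ accept x z) (annotate-valid w (baseEnc w U) lw , output-hops w U x e o s)
      where
      x = annotate [] (baseEnc w U)
      e = map-base [] (baseEnc w U)
      lw = letterWord-baseEnc w U
    bwd : (⟦ guesser ⟧G ⨾ ⟦ walker ⟧G) w z → T ⊨ egr w ↦ egr z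
    bwd (x , g , c) = let z' , t , u = output-unique x (to (spec⇔ w x) g) c in subst (λ z → T ⊨ egr w ↦ egr z) (≡sym (u z c)) t

-- The two inclusions

NMSOe⇒NGSMfin² : ∀ {n₁ n₂} (m : Transduction n₁ n₂) → NMSOe m → NGSMfin² m
NMSOe⇒NGSMfin² {n₁} {n₂} m (T₀ , sound₀ , complete₀) =
  _ , _ , _ , (_ , guess-FiniteVisit' , λ _ _ → ⇔.refl) , (walker , walker-FiniteVisit , λ _ _ → ⇔.refl) ,
  λ w z → ⇔.trans (m⇔ w z) (simulates w z)
  where
  T : MSOT 1 n₁ 1 n₂
  -- `T₀` is only known to accept some graph isomorphic to `egr w`. The identity in front closes it
  -- under isomorphism of the input, so that `egr w` itself may be used.
  T = comp (idT ⊤F) T₀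
  sound : ∀ w {h} → T ⊨ egr w ↦ h → ∃ λ z → m w z × Iso h (egr z)
  sound w {h} t =
    let g , t₁ , t₂ = comp-sound (idT ⊤F) T₀ t
        w' , z , mwz , g≅ , h≅ = sound₀ g h (from ⊢⇔⊨ (t₂ g Iso-refl))
        w≡ = egr-injective {w = w} {w'} (Iso-trans (proj₂ (idT-sound t₁)) (≅⇒Iso g≅))
    in z , subst (λ w → m w z) (≡sym w≡) mwz , ≅⇒Iso h≅
  m⇔ : ∀ w z → m w z ⇔ T ⊨ egr w ↦ egr z
  m⇔ w z = mk⇔
    (λ mwz → let g , g≅ , t = complete₀ w z mwz in
      comp-complete (idT ⊤F) T₀ (idT-complete (⊤F-intro (egr w) VF.[] VF.[]) (Iso-sym (≅⇒Iso g≅))) (to ⊢⇔⊨ t))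
    (λ t → let z' , mwz' , i = sound w t in subst (m w) (≡sym (egr-injective {w = z} {z'} i)) mwz')
  string-valued : ∀ w {h} → T ⊨ egr w ↦ h → ∃ λ z → Iso h (egr z)
  string-valued w t = proj₁ (sound w t) , proj₂ (proj₂ (sound w t))
  open Simulation T string-valued
  guess-FiniteVisit' = Guess.guess-FiniteVisit {n₁} (Walker.letter {n₁} {n₂} (MSOT.C T) R)

NGSMfin²⇒NMSOe : ∀ {n₁ n₂} (m : Transduction n₁ n₂) → NGSMfin² m → NMSOe m
NGSMfin²⇒NMSOe {n₁} {n₂} m (n₃ , m₁ , m₂ , (M₁ , (k₁ , fv₁) , e₁) , (M₂ , (k₂ , fv₂) , e₂) , e) = T , sound , complete
  where
  S : MSOT 1 n₁ 1 n₂
  S = comp (VisitT.gsmT M₁ k₁) (VisitT.gsmT M₂ k₂)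
  S-realizes : Realizes egr egr S (⟦ M₁ ⟧G ⨾ ⟦ M₂ ⟧G)
  S-realizes = Realizes-comp (VisitT.gsmT-realizes M₁ k₁ fv₁) (VisitT.gsmT-realizes M₂ k₂ fv₂)
  m⇔ : ∀ w z → m w z ⇔ (⟦ M₁ ⟧G ⨾ ⟦ M₂ ⟧G) w z
  m⇔ w z = ⇔.trans (e w z) (∃-⇔ λ y → e₁ w y ×-⇔ e₂ y z)
  T : MSOT 1 n₁ 1 n₂
  -- The behaviour of `S` is known only on graphs of the form `egr w`. The filter rejects every
  -- graph that is not isomorphic to one of these.
  T = comp (idT isPathF) S
  sound : ∀ g h → T ⊢ g ↦ h → ∃ λ w → ∃ λ z → m w z × (g ≅ egr w) × (h ≅ egr z)
  sound g h t =
    let g₁ , t₁ , t₂ = comp-sound (idT isPathF) S (to ⊢⇔⊨ t)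
        p , i = idT-sound t₁
        w , j = isPath⇒egr (to (sem (m-isPathF g)) p)
        z , c , l = Realizes.sound S-realizes w (t₂ (egr w) (Iso-sym (Iso-trans j i)))
    in w , z , from (m⇔ w z) c , Iso⇒≅ (Iso-sym j) , Iso⇒≅ l
  complete : ∀ w z → m w z → ∃ λ g → (g ≅ egr w) × (T ⊢ g ↦ egr z)
  complete w z c = egr w , Iso⇒≅ Iso-refl , from ⊢⇔⊨ (comp-complete (idT isPathF) S
    (idT-complete (from (sem (m-isPathF (egr w))) (IsPath-egr w)) Iso-refl)
        (Realizes.complete S-realizes (to (m⇔ w z) c)))

theorem6p5 : ∀ (n₁ n₂ : ℕ) (m : Transduction n₁ n₂) →
    (NMSOe m → NGSMfin² m) × (NGSMfin² m → NMSOe m)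
theorem6p5 n₁ n₂ m = NMSOe⇒NGSMfin² m , NGSMfin²⇒NMSOe m
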